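{- The following three equivalences hold. (1) There exists a Seidel matrix with spectrum $\{ [-5]^{42}, [11]^{15}, [15]^3 \}$ if and only if there exists a graph with spectrum $\{ [22]^1, [2]^{42}, [-6]^{15}, [-8]^2 \}$. (2) There exists a Seidel matrix with spectrum $\{ [-5]^{53}, [13]^{16}, [19]^3 \}$ if and only if there exists a graph with spectrum $\{ [26]^1, [2]^{53}, [-7]^{16}, [-10]^2 \}$. (3) There exists a Seidel matrix with spectrum $\{ [-5]^{70}, [13]^{5}, [19]^{15} \}$ if and only if there exists a graph with spectrum $\{ [38]^1, [2]^{70}, [-7]^{4}, [-10]^{15} \}$.
   Context: A Seidel matrix is a symmetric $\{0,\pm1\}$-matrix with zero diagonal and all off-diagonal entries nonzero. The notation $\{[\theta_1]^{m_1},\dots,[\theta_r]^{m_r}\}$ for the spectrum of a real symmetric matrix means that its distinct eigenvalues are $\theta_1,\dots,\theta_r$, with $\theta_i$ having multiplicity $m_i$. Graphs are finite, simple and undirected, and the spectrum of a graph is the spectrum of its adjacency matrix. -}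

module Defs where

open import Data.Bool using (Bool; false; if_then_else_)
open import Data.Fin using (Fin; zero; suc; toℕ; punchIn; _≟_)
open import Data.Integer using (ℤ; 0ℤ; 1ℤ; -1ℤ; _-_; _*_; _^_)
open import Data.Integer.Properties using (+-0-monoid)
open import Data.List using (List; foldr)
open import Data.Nat using (ℕ; zero; suc)
open import Data.Product using (_×_; _,_)
open import Data.Sum using (_⊎_)
open import Data.Vec.Functional using (Vector)
open import Relation.Binary.PropositionalEquality using (_≡_; _≢_)
open import Relation.Nullary.Decidable using (⌊_⌋)
open import Algebra.Properties.Monoid.Sum +-0-monoid using (sum)

Matrix : ℕ → Set
Matrix n = Vector (Vector ℤ n) n

Symmetric : ∀ {n} → Matrix n → Set
Symmetric A = ∀ i j → A i j ≡ A j i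

-- Laplace expansion along the first row; punchIn j enumerates the columns other than j.
det : ∀ {n} → Matrix n → ℤ
det {zero}  A = 1ℤ
det {suc n} A = sum λ j → -1ℤ ^ toℕ j * A zero j * det (λ i k → A (suc i) (punchIn j k))

identity : ∀ n → Matrix n
identity n i j = if ⌊ i ≟ j ⌋ then 1ℤ else 0ℤ

-- The characteristic polynomial det (xI - A), as a polynomial function of x.
charPoly : ∀ {n} → Matrix n → ℤ → ℤ
charPoly {n} A x = det λ i j → x * identity n i j - A i j

-- The list of pairs (θᵢ , mᵢ) stands for {[θ₁]^m₁, …, [θᵣ]^mᵣ}; the θᵢ are meant to be distinct.
Spectrum : Set
Spectrum = List (ℤ × ℕ)

infix 6 [_]^_

[_]^_ : ℤ → ℕ → ℤ × ℕ
[ θ ]^ m = θ , m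

-- The eigenvalues with their multiplicities are the roots of the characteristic polynomial.
-- All eigenvalues of a real symmetric matrix being real, the spectrum is σ exactly when
-- det (xI - A) = ∏ᵢ (x - θᵢ)^mᵢ. As ℤ is an infinite domain, this polynomial identity is
-- the same as equality at every integer x; comparing degrees, it forces n = ∑ᵢ mᵢ.
HasSpectrum : ∀ {n} → Matrix n → Spectrum → Set
HasSpectrum A σ =
  ∀ x → charPoly A x ≡ foldr (λ (θ , m) p → (x - θ) ^ m * p) 1ℤ σ

record SeidelMatrix (n : ℕ) : Set where
  field
    matrix      : Matrix n
    entries     : ∀ i j → matrix i j ≡ 0ℤ ⊎ matrix i j ≡ 1ℤ ⊎ matrix i j ≡ -1ℤ
    symmetric   : Symmetric matrix
    diagonal    : ∀ i → matrix i i ≡ 0ℤ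
    offDiagonal : ∀ i j → i ≢ j → matrix i j ≢ 0ℤ

record Graph (n : ℕ) : Set where
  field
    adjacent    : Fin n → Fin n → Bool
    symmetric   : ∀ i j → adjacent i j ≡ adjacent j i
    irreflexive : ∀ i → adjacent i i ≡ false

adjacencyMatrix : ∀ {n} → Graph n → Matrix n
adjacencyMatrix G i j = if Graph.adjacent G i j then 1ℤ else 0ℤ

SeidelMatrixHasSpectrum : ∀ {n} → SeidelMatrix n → Spectrum → Set
SeidelMatrixHasSpectrum S = HasSpectrum (SeidelMatrix.matrix S)

GraphHasSpectrum : ∀ {n} → Graph n → Spectrum → Set
GraphHasSpectrum G = HasSpectrum (adjacencyMatrix G)

{-# OPTIONS --safe #-}
module Submission where

-- Write the Seidel spectrum as {-5, σ, τ} and let P be half of ±(S + 5)(S - τ): an integral multiple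
-- of the projection onto the σ-eigenspace, hence the Gram matrix of a tight frame of vectors of norm 2
-- or 3 with small integral inner products whose parities follow a rule. Counting with the tightness
-- condition shows that these vectors lie on few lines, and yields a ±1 vector in the σ-eigenspace.
-- Switching by it gives S constant row sums σ, and then S = J - I - 2A for a regular graph A.
-- Conversely the first coefficients of the characteristic polynomial of a graph with the given
-- spectrum show that its mean degree is its largest eigenvalue, so that it is regular.
-- For constant row sums, a rank-one update relates the characteristic polynomials of S and A.
--
-- Polynomials occur only as functions: an identity between them extends to a further point x because
-- x - y divides f(x) - f(y), and degrees are compared by growth at large positive integers.

open import Data.Bool using (Bool; true; false; if_then_else_)
open import Data.Fin using (Fin; zero; suc; toℕ; punchIn; lift; _≟_)
open import Data.Fin.Properties using (suc-injective; any?; all?)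
open import Data.Integer using (ℤ; -_; 0ℤ; 1ℤ; -1ℤ; _+_; _-_; _*_; _^_; ∣_∣)
import Data.Integer as ℤ
import Data.Integer.Properties as ℤ
open import Data.Integer.Tactic.RingSolver using (solve-∀)
open import Data.List using ([]; _∷_; foldr)
open import Data.Nat using (ℕ; zero; suc)
import Data.Nat as ℕ
open import Data.Nat.DivMod using (m*n%n≡0)
import Data.Nat.Properties as ℕ
open import Data.Product using (_×_; _,_; proj₁; proj₂; Σ-syntax; ∃-syntax)
open import Data.Sum using (_⊎_; inj₁; inj₂)
open import Data.Unit using (⊤; tt)
import Data.Vec.Functional as Vector
open import Data.Vec.Functional using (Vector; updateAt)
open import Data.Vec.Functional.Properties using (updateAt-updates; updateAt-minimal)
open import Function.Base using (_∘_; const)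
open import Relation.Binary.PropositionalEquality
open import Relation.Nullary using (¬_; Dec; yes; no; contradiction)
open import Relation.Nullary.Decidable using (toWitness; _→-dec_; _×-dec_; _⊎-dec_; ¬?; ⌊_⌋)
open import Algebra.Properties.Semiring.Sum ℤ.+-*-semiring
  using (sum; sum-cong-≗; ∑-distrib-+; ∑-comm; *-distribˡ-sum; *-distribʳ-sum; sum-replicate-zero)
import Algebra.Properties.CommutativeMonoid.Sum ℤ.*-1-commutativeMonoid as Product
open import Defs
open ≡-Reasoning

-- The product (S + 5)(S - τ) kills the other two eigenspaces, so the frame spans dimension 3, 3 and
-- 5, with 60, 72 and 90 vectors. Since S² has diagonal n - 1, the norm t is half of ±(n - 1 - 5τ),
-- and c is half of ±(σ + 5)(σ - τ); this gives (t, c) = (2, 40), (3, 72), (3, 54). The choice σ =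
-- -1 - 2κ with n = 2(k - κ) makes σ the row sum n - 1 - 2k of J - I - 2A for a k-regular graph. The
-- all-ones vector then carries σ on one side and k on the other, which accounts for the one
-- multiplicity that differs. Everything stays over the integers, without real eigenvectors or
-- diagonalisation. Positivity of the standard inner product takes their place: it passes from the
-- characteristic polynomial to its squarefree part, gives the Cauchy-Schwarz bounds on the frame
-- and, through a quadratic of negative discriminant, replaces the Rayleigh quotient in the proof of
-- regularity.

sum-zero : ∀ {n} {f : Vector ℤ n} → (∀ i → f i ≡ 0ℤ) → sum f ≡ 0ℤ
sum-zero {n} f≡0 = trans (sum-cong-≗ f≡0) (sum-replicate-zero n)

sum-linear : ∀ {n} a b (f g : Vector ℤ n) → sum (λ i → a * f i + b * g i) ≡ a * sum f + b * sum g
sum-linear a b f g = trans (∑-distrib-+ (λ i → a * f i) (λ i → b * g i))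
  (sym (cong₂ _+_ (*-distribˡ-sum a f) (*-distribˡ-sum b g)))

sum-- : ∀ {n} (f g : Vector ℤ n) → sum (λ i → f i - g i) ≡ sum f - sum g
sum-- f g = begin
  sum (λ i → f i - g i)                   ≡⟨ sum-cong-≗ (λ i → lemma (f i) (g i)) ⟩
  sum (λ i → 1ℤ * f i + -1ℤ * g i)        ≡⟨ sum-linear 1ℤ -1ℤ f g ⟩
  1ℤ * sum f + -1ℤ * sum g                ≡⟨ lemma (sum f) (sum g) ⟨
  sum f - sum g                           ∎
  where
  lemma : ∀ a b → a - b ≡ 1ℤ * a + -1ℤ * b
  lemma a b = cong₂ _+_ (sym (ℤ.*-identityˡ a)) (sym (ℤ.-1*i≡-i b))

sum-const : ∀ n a → sum {n} (λ _ → a) ≡ ℤ.+ n * a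
sum-const zero    a = refl
sum-const (suc n) a = trans (cong (a +_) (sum-const n a)) (sym (ℤ.suc-* (ℤ.+ n) a))

identity-diagonal : ∀ {n} (i : Fin n) → identity n i i ≡ 1ℤ
identity-diagonal i with i ≟ i
... | yes _  = refl
... | no i≢i = contradiction refl i≢i

identity-off : ∀ {n} {i j : Fin n} → i ≢ j → identity n i j ≡ 0ℤ
identity-off {i = i} {j} i≢j with i ≟ j
... | yes i≡j = contradiction i≡j i≢j
... | no  _   = refl

identity-sym : ∀ {n} → Symmetric (identity n)
identity-sym i j with i ≟ j
... | yes refl = sym (identity-diagonal i)
... | no  i≢j  = sym (identity-off (≢-sym i≢j))

identity-suc : ∀ {n} (i j : Fin n) → identity (suc n) (suc i) (suc j) ≡ identity n i j
identity-suc i j = same (i ≟ j)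
  where
  same : Dec (i ≡ j) → identity _ (suc i) (suc j) ≡ identity _ i j
  same (yes refl) = trans (identity-diagonal (suc i)) (sym (identity-diagonal i))
  same (no i≢j)   = trans (identity-off (i≢j ∘ suc-injective)) (sym (identity-off i≢j))

sum-single : ∀ {n} (i : Fin n) {f : Vector ℤ n} → (∀ j → j ≢ i → f j ≡ 0ℤ) → sum f ≡ f i
sum-single zero    {f} f≡0 =
  trans (cong (f zero +_) (sum-zero {f = f ∘ suc} λ j → f≡0 (suc j) λ ())) (ℤ.+-identityʳ (f zero))
sum-single (suc i) {f} f≡0 =
  trans (cong (_+ sum (f ∘ suc)) (f≡0 zero λ ()))
    (trans (ℤ.+-identityˡ _) (sum-single i λ j j≢i → f≡0 (suc j) (j≢i ∘ suc-injective)))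

sum-identity : ∀ {n} (i : Fin n) (f : Vector ℤ n) → sum (λ j → identity n i j * f j) ≡ f i
sum-identity i f = trans (sum-single i λ j j≢i → cong (_* f j) (identity-off (≢-sym j≢i)))
  (trans (cong (_* f i) (identity-diagonal i)) (ℤ.*-identityˡ (f i)))

-- Determinants

minor : ∀ {n} → Matrix (suc n) → Fin (suc n) → Matrix n
minor A j i k = A (suc i) (punchIn j k)

det-cong : ∀ {n} {A B : Matrix n} → (∀ i j → A i j ≡ B i j) → det A ≡ det B
det-cong {zero}  A≡B = refl
det-cong {suc n} A≡B = sum-cong-≗ λ j →
  cong₂ (λ a d → -1ℤ ^ toℕ j * a * d) (A≡B zero j) (det-cong λ i k → A≡B (suc i) (punchIn j k))

-- Stated for three matrices that agree off row `r`, rather than for an operation on rows, so that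
-- it applies to any presentation of them.
det-linear : ∀ {n} (r : Fin n) a b {A B C : Matrix n} →
  (∀ j → A r j ≡ a * B r j + b * C r j) →
  (∀ i → i ≢ r → ∀ j → A i j ≡ B i j) →
  (∀ i → i ≢ r → ∀ j → A i j ≡ C i j) →
  det A ≡ a * det B + b * det C
det-linear zero a b {A} {B} {C} row A≡B A≡C =
  trans (sum-cong-≗ λ j → begin
      s j * A zero j * det (minor A j)
        ≡⟨ cong (λ x → s j * x * det (minor A j)) (row j) ⟩
      s j * (a * B zero j + b * C zero j) * det (minor A j)
        ≡⟨ ring (s j) a b (B zero j) (C zero j) (det (minor A j)) ⟩
      a * (s j * B zero j * det (minor A j)) + b * (s j * C zero j * det (minor A j))
        ≡⟨ cong₂ (λ x y → a * (s j * B zero j * x) + b * (s j * C zero j * y))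
             (det-cong λ i k → A≡B (suc i) (λ ()) (punchIn j k))
             (det-cong λ i k → A≡C (suc i) (λ ()) (punchIn j k)) ⟩
      a * (s j * B zero j * det (minor B j)) + b * (s j * C zero j * det (minor C j)) ∎)
    (sum-linear a b (λ j → s j * B zero j * det (minor B j)) λ j → s j * C zero j * det (minor C j))
  where
  s : Fin _ → ℤ
  s j = -1ℤ ^ toℕ j
  ring : ∀ s a b x y d → s * (a * x + b * y) * d ≡ a * (s * x * d) + b * (s * y * d)
  ring = solve-∀
det-linear (suc r) a b {A} {B} {C} row A≡B A≡C =
  trans (sum-cong-≗ λ j → begin
      s j * A zero j * det (minor A j)
        ≡⟨ cong (s j * A zero j *_) (det-linear r a b {B = minor B j} {minor C j}
             (λ k → row (punchIn j k))
             (λ i i≢r k → A≡B (suc i) (i≢r ∘ suc-injective) (punchIn j k))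
             (λ i i≢r k → A≡C (suc i) (i≢r ∘ suc-injective) (punchIn j k))) ⟩
      s j * A zero j * (a * det (minor B j) + b * det (minor C j))
        ≡⟨ ring (s j) a b (A zero j) (det (minor B j)) (det (minor C j)) ⟩
      a * (s j * A zero j * det (minor B j)) + b * (s j * A zero j * det (minor C j))
        ≡⟨ cong₂ (λ x y → a * (s j * x * det (minor B j)) + b * (s j * y * det (minor C j)))
             (A≡B zero (λ ()) j) (A≡C zero (λ ()) j) ⟩
      a * (s j * B zero j * det (minor B j)) + b * (s j * C zero j * det (minor C j)) ∎)
    (sum-linear a b (λ j → s j * B zero j * det (minor B j)) λ j → s j * C zero j * det (minor C j))
  where
  s : Fin _ → ℤ
  s j = -1ℤ ^ toℕ j
  ring : ∀ s a b x d e → s * x * (a * d + b * e) ≡ a * (s * x * d) + b * (s * x * e)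
  ring = solve-∀

-- Antisymmetry of a function of ordered pairs of distinct columns in the `punchIn` encoding: (suc j
-- , zero) and (zero , j) are the two orders of the columns `zero` and `suc j`, and the remaining
-- index pairs avoid column `zero`.
Cancelling : ∀ {n} → (Fin (suc n) → Fin n → ℤ) → Set
Cancelling {zero}  F = ⊤
Cancelling {suc n} F =
  (∀ j → F (suc j) zero ≡ - F zero j) × Cancelling λ j k → F (suc j) (suc k)

sum-cancelling : ∀ {n} (F : Fin (suc n) → Fin n → ℤ) → Cancelling F → sum (λ j → sum (F j)) ≡ 0ℤ
sum-cancelling {zero}  F _       = refl
sum-cancelling {suc n} F (h , c) = begin
  sum (F zero) + sum (λ j → F (suc j) zero + sum (λ k → F (suc j) (suc k)))
    ≡⟨ cong (sum (F zero) +_) (∑-distrib-+ (λ j → F (suc j) zero) λ j → sum λ k → F (suc j) (suc k)) ⟩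
  sum (F zero) + (sum (λ j → F (suc j) zero) + sum (λ j → sum λ k → F (suc j) (suc k)))
    ≡⟨ cong₂ (λ x y → sum (F zero) + (x + y)) first (sum-cancelling (λ j k → F (suc j) (suc k)) c) ⟩
  sum (F zero) + (- sum (F zero) + 0ℤ)
    ≡⟨ ring (sum (F zero)) ⟩
  0ℤ ∎
  where
  ring : ∀ a → a + (- a + 0ℤ) ≡ 0ℤ
  ring = solve-∀
  first : sum (λ j → F (suc j) zero) ≡ - sum (F zero)
  first = trans (sum-cong-≗ λ j → trans (h j) (sym (ℤ.-1*i≡-i (F zero j))))
    (trans (sym (*-distribˡ-sum -1ℤ (F zero))) (ℤ.-1*i≡-i _))

cancelling-cong : ∀ {n} {F G : Fin (suc n) → Fin n → ℤ} → (∀ j k → F j k ≡ G j k) →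
  Cancelling F → Cancelling G
cancelling-cong {zero}  F≡G _       = tt
cancelling-cong {suc n} F≡G (h , c) =
  (λ j → trans (sym (F≡G (suc j) zero)) (trans (h j) (cong -_ (F≡G zero j)))) ,
  cancelling-cong (λ j k → F≡G (suc j) (suc k)) c

-- Two equal rows a in front, expanded along both: (j , k) stands for the pair of distinct columns
-- j and punchIn j k, and D is the complementary minor as a function of its column embedding.
twoRowTerm : ∀ {n} (a : Vector ℤ (2 ℕ.+ n)) (D : (Fin n → Fin (2 ℕ.+ n)) → ℤ) →
  Fin (2 ℕ.+ n) → Fin (1 ℕ.+ n) → ℤ
twoRowTerm a D j k =
  -1ℤ ^ toℕ j * a j * (-1ℤ ^ toℕ k * a (punchIn j k) * D (punchIn j ∘ punchIn k))

twoRowTerm-cancelling : ∀ {n} (a : Vector ℤ (2 ℕ.+ n)) (D : (Fin n → Fin (2 ℕ.+ n)) → ℤ) →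
  (∀ {c d} → (∀ l → c l ≡ d l) → D c ≡ D d) → Cancelling (twoRowTerm a D)
twoRowTerm-cancelling {n} a D D-cong = first , rest n a D D-cong
  where
  first : ∀ j → twoRowTerm a D (suc j) zero ≡ - twoRowTerm a D zero j
  first j = ring (-1ℤ ^ toℕ j) (a (suc j)) (a zero) _
    where
    ring : ∀ s x y d → -1ℤ * s * x * (1ℤ * y * d) ≡ - (1ℤ * y * (s * x * d))
    ring = solve-∀
  rest : ∀ n (a : Vector ℤ (2 ℕ.+ n)) (D : (Fin n → Fin (2 ℕ.+ n)) → ℤ) →
    (∀ {c d} → (∀ l → c l ≡ d l) → D c ≡ D d) →
    Cancelling λ j k → twoRowTerm a D (suc j) (suc k)
  rest zero    a D D-cong = tt
  -- Column `zero` now belongs to the complementary minor, hence `lift 1`; the two signs from the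
  -- shifted indices cancel.
  rest (suc n) a D D-cong =
    cancelling-cong same (twoRowTerm-cancelling (a ∘ suc) (D ∘ lift 1) λ c≡d → D-cong (lift-cong c≡d))
    where
    lift-cong : ∀ {m n} {c d : Fin m → Fin n} → (∀ l → c l ≡ d l) → ∀ l → lift 1 c l ≡ lift 1 d l
    lift-cong c≡d zero    = refl
    lift-cong c≡d (suc l) = cong suc (c≡d l)
    columns : ∀ j k l → lift 1 (punchIn j ∘ punchIn k) l ≡ punchIn (suc j) (punchIn (suc k) l)
    columns j k zero    = refl
    columns j k (suc l) = refl
    ring : ∀ s t x y d → s * x * (t * y * d) ≡ -1ℤ * s * x * (-1ℤ * t * y * d)
    ring = solve-∀
    same : ∀ j k → twoRowTerm (a ∘ suc) (D ∘ lift 1) j k ≡ twoRowTerm a D (suc j) (suc k)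
    same j k = trans
      (cong (λ d → -1ℤ ^ toℕ j * a (suc j) * (-1ℤ ^ toℕ k * a (suc (punchIn j k)) * d))
        (D-cong (columns j k)))
      (ring (-1ℤ ^ toℕ j) (-1ℤ ^ toℕ k) (a (suc j)) (a (suc (punchIn j k))) _)

det-firstTwoEqual : ∀ {n} {A : Matrix (2 ℕ.+ n)} → (∀ j → A zero j ≡ A (suc zero) j) → det A ≡ 0ℤ
det-firstTwoEqual {n} {A} A₀≡A₁ = trans (sum-cong-≗ expand)
  (sum-cancelling (twoRowTerm (A zero) D) (twoRowTerm-cancelling (A zero) D λ c≡d → det-cong λ i l → cong (A (suc (suc i))) (c≡d l)))
  where
  D : (Fin n → Fin (2 ℕ.+ n)) → ℤ
  D c = det λ i l → A (suc (suc i)) (c l)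
  expand : ∀ j → -1ℤ ^ toℕ j * A zero j * det (minor A j) ≡ sum (twoRowTerm (A zero) D j)
  expand j = trans
    (cong (λ d → -1ℤ ^ toℕ j * A zero j * d) (sum-cong-≗ λ k →
      cong (λ x → -1ℤ ^ toℕ k * x * D (punchIn j ∘ punchIn k)) (sym (A₀≡A₁ (punchIn j k)))))
    (*-distribˡ-sum (-1ℤ ^ toℕ j * A zero j)
      (λ k → -1ℤ ^ toℕ k * A zero (punchIn j k) * D (punchIn j ∘ punchIn k)))

Alternating : ℕ → Set
Alternating n = ∀ {r s : Fin n} → r ≢ s → (A : Matrix n) → (∀ j → A r j ≡ A s j) → det A ≡ 0ℤ

det-laterEqual : ∀ {n} → Alternating n → ∀ {r s : Fin n} → r ≢ s → (A : Matrix (suc n)) →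
  (∀ j → A (suc r) j ≡ A (suc s) j) → det A ≡ 0ℤ
det-laterEqual alternating r≢s A eq = sum-zero λ j →
  trans (cong (-1ℤ ^ toℕ j * A zero j *_) (alternating r≢s (minor A j) λ k → eq (punchIn j k)))
    (ℤ.*-zeroʳ (-1ℤ ^ toℕ j * A zero j))

-- Only adjacent rows are treated by expansion. For a later row, let a be the common row and b row
-- one: with a + b both in row one and in the later row the determinant is 0, and expanding it
-- leaves only det A, since the other terms have two equal rows.
det-firstEqual : ∀ {n} → Alternating n → ∀ (s : Fin n) (A : Matrix (suc n)) →
  (∀ j → A zero j ≡ A (suc s) j) → det A ≡ 0ℤ
det-firstEqual {suc n} alternating zero    A eq = det-firstTwoEqual {A = A} eq
det-firstEqual {suc n} alternating (suc s) A eq = begin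
  det A                                          ≡⟨ det-cong restore ⟩
  det (M b a)                                    ≡⟨ ring (det (M b a)) ⟩
  1ℤ * 0ℤ + 1ℤ * (1ℤ * det (M b a) + 1ℤ * 0ℤ)
    ≡⟨ cong₂ (λ x y → 1ℤ * x + 1ℤ * (1ℤ * det (M b a) + 1ℤ * y))
         (det-firstTwoEqual {A = M a a+b} λ j → refl) (later b b λ j → refl) ⟨
  1ℤ * det (M a a+b) + 1ℤ * (1ℤ * det (M b a) + 1ℤ * det (M b b))
    ≡⟨ cong (λ x → 1ℤ * det (M a a+b) + 1ℤ * x)
         (det-linear q 1ℤ 1ℤ {M b a+b} {M b a} {M b b} (lastRow b) (lastOthers b a+b a) (lastOthers b a+b b)) ⟨
  1ℤ * det (M a a+b) + 1ℤ * det (M b a+b)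
    ≡⟨ det-linear (suc zero) 1ℤ 1ℤ {M a+b a+b} {M a a+b} {M b a+b} (λ j → refl) (others a) (others b) ⟨
  det (M a+b a+b)                                ≡⟨ later a+b a+b (λ j → refl) ⟩
  0ℤ                                             ∎
  where
  q = suc (suc s)
  a b a+b : Vector ℤ _
  a = A zero
  b = A (suc zero)
  a+b j = 1ℤ * a j + 1ℤ * b j
  M : Vector ℤ _ → Vector ℤ _ → Matrix _
  M y z zero          = a
  M y z (suc zero)    = y
  M y z (suc (suc i)) = updateAt (λ i → A (suc (suc i))) s (const z) i
  restore : ∀ i j → A i j ≡ M b a i j
  restore zero          j = refl
  restore (suc zero)    j = refl
  restore (suc (suc i)) j with i ≟ s
  ... | yes refl = trans (sym (eq j)) (cong (λ v → v j) (sym (updateAt-updates s (λ i → A (suc (suc i))))))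
  ... | no  i≢s  = cong (λ v → v j) (sym (updateAt-minimal i s (λ i → A (suc (suc i))) i≢s))
  lastRow : ∀ y j → M y a+b q j ≡ 1ℤ * M y a q j + 1ℤ * M y b q j
  lastRow y j rewrite updateAt-updates s {const a+b} (λ i → A (suc (suc i)))
    | updateAt-updates s {const a} (λ i → A (suc (suc i)))
    | updateAt-updates s {const b} (λ i → A (suc (suc i))) = refl
  lastOthers : ∀ y z z′ i → i ≢ q → ∀ j → M y z i j ≡ M y z′ i j
  lastOthers y z z′ zero          i≢q j = refl
  lastOthers y z z′ (suc zero)    i≢q j = refl
  lastOthers y z z′ (suc (suc i)) i≢q j
    rewrite updateAt-minimal i s {const z} (λ i → A (suc (suc i))) (λ e → i≢q (cong (λ x → suc (suc x)) e))
    | updateAt-minimal i s {const z′} (λ i → A (suc (suc i))) (λ e → i≢q (cong (λ x → suc (suc x)) e)) = refl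
  others : ∀ y i → i ≢ suc zero → ∀ j → M a+b a+b i j ≡ M y a+b i j
  others y zero          _   j = refl
  others y (suc zero)    i≢1 j = contradiction refl i≢1
  others y (suc (suc i)) _   j = refl
  later : ∀ y z → (∀ j → y j ≡ z j) → det (M y z) ≡ 0ℤ
  later y z y≡z = det-laterEqual alternating {zero} {suc s} (λ ()) (M y z) λ j →
    trans (y≡z j) (cong (λ v → v j) (sym (updateAt-updates s (λ i → A (suc (suc i))))))
  ring : ∀ d → d ≡ 1ℤ * 0ℤ + 1ℤ * (1ℤ * d + 1ℤ * 0ℤ)
  ring = solve-∀

det-alternating : ∀ {n} → Alternating n
det-alternating {suc n} {zero}  {zero}  r≢s A eq = contradiction refl r≢s
det-alternating {suc n} {zero}  {suc s} r≢s A eq = det-firstEqual det-alternating s A eq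
det-alternating {suc n} {suc r} {zero}  r≢s A eq = det-firstEqual det-alternating r A (sym ∘ eq)
det-alternating {suc n} {suc r} {suc s} r≢s A eq =
  det-laterEqual det-alternating (r≢s ∘ cong suc) A eq

-- Row replacement and Cramer's rule

mul : ∀ {n} → Matrix n → Vector ℤ n → Vector ℤ n
mul A v i = sum λ j → A i j * v j

replaceRow : ∀ {n} → Matrix n → Fin n → Vector ℤ n → Matrix n
replaceRow A r v = updateAt A r (const v)

replaceRow-at : ∀ {n} (A : Matrix n) r v j → replaceRow A r v r j ≡ v j
replaceRow-at A r v j = cong (λ w → w j) (updateAt-updates r A)

replaceRow-off : ∀ {n} (A : Matrix n) {r} v {i} → i ≢ r → ∀ j → replaceRow A r v i j ≡ A i j
replaceRow-off A {r} v {i} i≢r j = cong (λ w → w j) (updateAt-minimal i r A i≢r)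

replaceRow-linear : ∀ {n} (A : Matrix n) r a b {u v w} → (∀ j → w j ≡ a * u j + b * v j) →
  det (replaceRow A r w) ≡ a * det (replaceRow A r u) + b * det (replaceRow A r v)
replaceRow-linear A r a b {u} {v} {w} w≡ = det-linear r a b
  (λ j → begin
    replaceRow A r w r j ≡⟨ replaceRow-at A r w j ⟩
    w j                  ≡⟨ w≡ j ⟩
    a * u j + b * v j
      ≡⟨ cong₂ (λ x y → a * x + b * y) (replaceRow-at A r u j) (replaceRow-at A r v j) ⟨
    a * replaceRow A r u r j + b * replaceRow A r v r j ∎)
  (λ i i≢r j → trans (replaceRow-off A w i≢r j) (sym (replaceRow-off A u i≢r j)))
  (λ i i≢r j → trans (replaceRow-off A w i≢r j) (sym (replaceRow-off A v i≢r j)))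

replaceRow-cong : ∀ {n} (A : Matrix n) r {u v} → (∀ j → u j ≡ v j) →
  det (replaceRow A r u) ≡ det (replaceRow A r v)
replaceRow-cong A r {u} {v} u≡v = trans
  (replaceRow-linear A r 1ℤ 0ℤ {v} {v} λ j → trans (u≡v j) (ring (v j)))
  (sym (ring (det (replaceRow A r v))))
  where
  ring : ∀ a → a ≡ 1ℤ * a + 0ℤ * a
  ring = solve-∀

replaceRow-scale : ∀ {n} (A : Matrix n) r a v →
  det (replaceRow A r (λ j → a * v j)) ≡ a * det (replaceRow A r v)
replaceRow-scale A r a v = trans
  (replaceRow-linear A r a 0ℤ {v} {v} λ j → ring a (v j))
  (sym (ring a (det (replaceRow A r v))))
  where
  ring : ∀ a b → a * b ≡ a * b + 0ℤ * b
  ring = solve-∀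

replaceRow-sum : ∀ {n m} (A : Matrix n) r (w : Vector ℤ m) (V : Fin m → Vector ℤ n) →
  det (replaceRow A r (λ j → sum λ k → w k * V k j)) ≡ sum λ k → w k * det (replaceRow A r (V k))
replaceRow-sum {m = zero}  A r w V =
  replaceRow-linear A r 0ℤ 0ℤ {A r} {A r} λ j → refl
replaceRow-sum {m = suc m} A r w V = trans
  (replaceRow-linear A r (w zero) 1ℤ {V zero} {λ j → sum λ k → w (suc k) * V (suc k) j}
    λ j → cong (w zero * V zero j +_) (sym (ℤ.*-identityˡ _)))
  (cong (w zero * det (replaceRow A r (V zero)) +_)
    (trans (ℤ.*-identityˡ _) (replaceRow-sum A r (w ∘ suc) (V ∘ suc))))

replaceRow-self : ∀ {n} (A : Matrix n) r → det (replaceRow A r (A r)) ≡ det A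
replaceRow-self A r = det-cong same
  where
  same : ∀ i j → replaceRow A r (A r) i j ≡ A i j
  same i j with i ≟ r
  ... | yes refl = replaceRow-at A r (A r) j
  ... | no  i≢r  = replaceRow-off A (A r) i≢r j

replaceRow-other : ∀ {n} (A : Matrix n) {r s} → r ≢ s → det (replaceRow A r (A s)) ≡ 0ℤ
replaceRow-other A {r} {s} r≢s = det-alternating r≢s (replaceRow A r (A s)) λ j →
  trans (replaceRow-at A r (A s) j) (sym (replaceRow-off A (A s) (≢-sym r≢s) j))

replaceRow-combination : ∀ {n} (A : Matrix n) r (w : Vector ℤ n) →
  det (replaceRow A r (λ j → sum λ k → w k * A k j)) ≡ w r * det A
replaceRow-combination A r w = begin
  det (replaceRow A r (λ j → sum λ k → w k * A k j))  ≡⟨ replaceRow-sum A r w A ⟩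
  sum (λ k → w k * det (replaceRow A r (A k)))
    ≡⟨ sum-single r (λ k k≢r → trans (cong (w k *_) (replaceRow-other A (≢-sym k≢r))) (ℤ.*-zeroʳ (w k))) ⟩
  w r * det (replaceRow A r (A r))                    ≡⟨ cong (w r *_) (replaceRow-self A r) ⟩
  w r * det A                                         ∎

-- By symmetry `mul B w` is the combination of the rows of `B` with coefficients `w`, so the rule
-- can be stated for a replaced row.
cramer : ∀ {n} {B : Matrix n} → Symmetric B → ∀ i w →
  det (replaceRow B i (mul B w)) ≡ w i * det B
cramer {B = B} symmetric i w = trans
  (replaceRow-cong B i λ j → sum-cong-≗ λ k →
    trans (ℤ.*-comm (B j k) (w k)) (cong (w k *_) (symmetric j k)))
  (replaceRow-combination B i w)

-- Every vector is reached from zero by changing one coordinate at a time. This lets multiples of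
-- one row be added to the others one row after another.
vector-induction : ∀ {n} (Q : Vector ℤ n → Set) →
  (∀ {c} → (∀ i → c i ≡ 0ℤ) → Q c) →
  (∀ {c d} i → (∀ j → j ≢ i → d j ≡ c j) → Q c → Q d) → ∀ c → Q c
vector-induction {zero}  Q base step c = base λ ()
vector-induction {suc n} Q base step c = step zero off
  (vector-induction (λ d → Q (0ℤ Vector.∷ d))
    (λ d≡0 → base λ { zero → refl ; (suc i) → d≡0 i })
    (λ i d≡c → step (suc i) λ { zero _ → refl ; (suc j) j≢i → d≡c j (j≢i ∘ cong suc) })
    (c ∘ suc))
  where
  off : ∀ j → j ≢ zero → c j ≡ (0ℤ Vector.∷ (c ∘ suc)) j
  off zero    0≢0 = contradiction refl 0≢0
  off (suc j) _   = refl

det-addFirstRow : ∀ {n} (A : Matrix (suc n)) (c : Vector ℤ n) (A′ : Matrix (suc n)) →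
  (∀ j → A′ zero j ≡ A zero j) → (∀ i j → A′ (suc i) j ≡ A (suc i) j + c i * A zero j) →
  det A′ ≡ det A
det-addFirstRow {n} A = vector-induction Q base step
  where
  Q : Vector ℤ n → Set
  Q c = (A′ : Matrix (suc n)) → (∀ j → A′ zero j ≡ A zero j) →
    (∀ i j → A′ (suc i) j ≡ A (suc i) j + c i * A zero j) → det A′ ≡ det A
  base : ∀ {c} → (∀ i → c i ≡ 0ℤ) → Q c
  base {c} c≡0 A′ first others = det-cong {A = A′} {A} λ where
    zero    j → first j
    (suc i) j → trans (others i j)
      (trans (cong (λ x → A (suc i) j + x * A zero j) (c≡0 i)) (ℤ.+-identityʳ (A (suc i) j)))
  step : ∀ {c d} i → (∀ j → j ≢ i → d j ≡ c j) → Q c → Q d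
  step {c} {d} r d≡c Qc A′ first others = begin
    det A′
      ≡⟨ det-linear (suc r) 1ℤ (d r - c r) {A′} {A″} {replaceRow A″ (suc r) (A″ zero)} row off
           (λ i i≢r j → trans (off i i≢r j) (sym (replaceRow-off A″ (A″ zero) i≢r j))) ⟩
    1ℤ * det A″ + (d r - c r) * det (replaceRow A″ (suc r) (A″ zero))
      ≡⟨ cong (λ x → 1ℤ * det A″ + (d r - c r) * x) (replaceRow-other A″ {suc r} {zero} (λ ())) ⟩
    1ℤ * det A″ + (d r - c r) * 0ℤ
      ≡⟨ ring (det A″) (d r - c r) ⟩
    det A″
      ≡⟨ Qc A″ (λ j → refl) (λ i j → refl) ⟩
    det A ∎
    where
    A″ : Matrix (suc n)
    A″ zero    j = A zero j
    A″ (suc i) j = A (suc i) j + c i * A zero j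
    ring : ∀ x e → 1ℤ * x + e * 0ℤ ≡ x
    ring = solve-∀
    ring′ : ∀ a x y z → a + y * z ≡ 1ℤ * (a + x * z) + (y - x) * z
    ring′ = solve-∀
    row : ∀ j → A′ (suc r) j ≡ 1ℤ * A″ (suc r) j + (d r - c r) * replaceRow A″ (suc r) (A″ zero) (suc r) j
    row j = trans (others r j) (trans (ring′ (A (suc r) j) (c r) (d r) (A zero j))
      (cong (λ x → 1ℤ * A″ (suc r) j + (d r - c r) * x) (sym (replaceRow-at A″ (suc r) (A″ zero) j))))
    off : ∀ i → i ≢ suc r → ∀ j → A′ i j ≡ A″ i j
    off zero    _   j = first j
    off (suc i) i≢r j = trans (others i j)
      (cong (λ x → A (suc i) j + x * A zero j) (d≡c i (i≢r ∘ cong suc)))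

-- Replacing row zero by the sum of all rows preserves the determinant and makes that row constant.
det-columnSums : ∀ {n} (A : Matrix (suc n)) β → (∀ j → sum (λ i → A i j) ≡ β) →
  det A ≡ β * det (replaceRow A zero (const 1ℤ))
det-columnSums A β sums = begin
  det A                                                    ≡⟨ ℤ.*-identityˡ (det A) ⟨
  1ℤ * det A                                               ≡⟨ replaceRow-combination A zero (const 1ℤ) ⟨
  det (replaceRow A zero (λ j → sum λ i → 1ℤ * A i j))
    ≡⟨ replaceRow-cong A zero (λ j → trans (sum-cong-≗ λ i → ℤ.*-identityˡ (A i j))
         (trans (sums j) (sym (ℤ.*-identityʳ β)))) ⟩
  det (replaceRow A zero (λ j → β * 1ℤ))                   ≡⟨ replaceRow-scale A zero β (const 1ℤ) ⟩
  β * det (replaceRow A zero (const 1ℤ))                   ∎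

-- Both determinants are multiples of the one whose first row is constant 1, by the column sums.
det-minusAllOnes : ∀ {n} (B : Matrix n) β → (∀ j → sum (λ i → B i j) ≡ β) →
  β * det (λ i j → B i j - 1ℤ) ≡ (β - ℤ.+ n) * det B
det-minusAllOnes {zero}  B β sums = ring β
  where
  ring : ∀ β → β * 1ℤ ≡ (β - 0ℤ) * 1ℤ
  ring = solve-∀
det-minusAllOnes {suc n} B β sums = begin
  β * det B-J                                  ≡⟨ cong (β *_) (det-columnSums B-J (β - ℤ.+ suc n) sums′) ⟩
  β * ((β - ℤ.+ suc n) * det (ones B-J))       ≡⟨ ring β (β - ℤ.+ suc n) (det (ones B-J)) ⟩
  (β - ℤ.+ suc n) * (β * det (ones B-J))       ≡⟨ cong (λ x → (β - ℤ.+ suc n) * (β * x)) same ⟩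
  (β - ℤ.+ suc n) * (β * det (ones B))         ≡⟨ cong ((β - ℤ.+ suc n) *_) (det-columnSums B β sums) ⟨
  (β - ℤ.+ suc n) * det B                      ∎
  where
  ring : ∀ a b c → a * (b * c) ≡ b * (a * c)
  ring = solve-∀
  B-J : Matrix (suc n)
  B-J i j = B i j - 1ℤ
  ones : Matrix (suc n) → Matrix (suc n)
  ones M = replaceRow M zero (const 1ℤ)
  sums′ : ∀ j → sum (λ i → B-J i j) ≡ β - ℤ.+ suc n
  sums′ j = trans (sum-- (λ i → B i j) (const 1ℤ))
    (cong₂ _-_ (sums j) (trans (sum-const (suc n) 1ℤ) (ℤ.*-identityʳ (ℤ.+ suc n))))
  same : det (ones B-J) ≡ det (ones B)
  same = det-addFirstRow (ones B) (const -1ℤ) (ones B-J) (λ j → refl) λ i j → refl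

-- Diagonal scaling and switching

product : ∀ {n} → Vector ℤ n → ℤ
product = Product.sum

product-const : ∀ n a → product {n} (const a) ≡ a ^ n
product-const zero    a = refl
product-const (suc n) a = cong (a *_) (product-const n a)

det-scale : ∀ {n} (d e : Vector ℤ n) (A : Matrix n) →
  det (λ i j → d i * A i j * e j) ≡ product d * product e * det A
det-scale {zero}  d e A = refl
det-scale {suc n} d e A = trans (sum-cong-≗ term)
  (sym (*-distribˡ-sum (product d * product e) λ j → s j * A zero j * det (minor A j)))
  where
  s : Fin (suc n) → ℤ
  s j = -1ℤ ^ toℕ j
  ring : ∀ s d₀ a eⱼ d′ e′ m → s * (d₀ * a * eⱼ) * (d′ * e′ * m) ≡ d₀ * d′ * (eⱼ * e′) * (s * a * m)
  ring = solve-∀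
  term : ∀ j → s j * (d zero * A zero j * e j) *
      det (λ i k → d (suc i) * A (suc i) (punchIn j k) * e (punchIn j k))
    ≡ product d * product e * (s j * A zero j * det (minor A j))
  term j = begin
    s j * (d zero * A zero j * e j) * det (λ i k → d (suc i) * A (suc i) (punchIn j k) * e (punchIn j k))
      ≡⟨ cong (s j * (d zero * A zero j * e j) *_) (det-scale (d ∘ suc) (e ∘ punchIn j) (minor A j)) ⟩
    s j * (d zero * A zero j * e j) * (product (d ∘ suc) * product (e ∘ punchIn j) * det (minor A j))
      ≡⟨ ring (s j) (d zero) (A zero j) (e j) (product (d ∘ suc)) (product (e ∘ punchIn j)) (det (minor A j)) ⟩
    product d * (e j * product (e ∘ punchIn j)) * (s j * A zero j * det (minor A j))
      ≡⟨ cong (λ x → product d * x * (s j * A zero j * det (minor A j))) (Product.sum-remove {i = j} e) ⟨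
    product d * product e * (s j * A zero j * det (minor A j)) ∎

det-scalar : ∀ {n} a (A : Matrix n) → det (λ i j → a * A i j) ≡ a ^ n * det A
det-scalar {n} a A = begin
  det (λ i j → a * A i j)                          ≡⟨ det-cong (λ i j → sym (ℤ.*-identityʳ (a * A i j))) ⟩
  det (λ i j → a * A i j * 1ℤ)                     ≡⟨ det-scale (const a) (const 1ℤ) A ⟩
  product {n} (const a) * product {n} (const 1ℤ) * det A
    ≡⟨ cong₂ (λ x y → x * y * det A) (product-const n a) (trans (product-const n 1ℤ) (ℤ.^-zeroˡ n)) ⟩
  a ^ n * 1ℤ * det A                               ≡⟨ cong (_* det A) (ℤ.*-identityʳ (a ^ n)) ⟩
  a ^ n * det A                                    ∎

product-signs : ∀ {n} (d : Vector ℤ n) → (∀ i → d i * d i ≡ 1ℤ) → product d * product d ≡ 1ℤ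
product-signs {zero}  d d²≡1 = refl
product-signs {suc n} d d²≡1 = trans (ring (d zero) (product (d ∘ suc)))
  (cong₂ _*_ (d²≡1 zero) (product-signs (d ∘ suc) (d²≡1 ∘ suc)))
  where
  ring : ∀ a b → a * b * (a * b) ≡ a * a * (b * b)
  ring = solve-∀

-- With D = diag(d) and D² = I, one has xI - DAD = D(xI - A)D.
charPoly-switching : ∀ {n} (d : Vector ℤ n) → (∀ i → d i * d i ≡ 1ℤ) → (A : Matrix n) → ∀ x →
  charPoly (λ i j → d i * A i j * d j) x ≡ charPoly A x
charPoly-switching {n} d d²≡1 A x = begin
  det (λ i j → x * identity n i j - d i * A i j * d j)     ≡⟨ det-cong entry ⟩
  det (λ i j → d i * (x * identity n i j - A i j) * d j)   ≡⟨ det-scale d d (λ i j → x * identity n i j - A i j) ⟩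
  product d * product d * charPoly A x                     ≡⟨ cong (_* charPoly A x) (product-signs d d²≡1) ⟩
  1ℤ * charPoly A x                                        ≡⟨ ℤ.*-identityˡ (charPoly A x) ⟩
  charPoly A x                                             ∎
  where
  ring : ∀ d e x i a → d * (x * i - a) * e ≡ x * (d * e * i) - d * a * e
  ring = solve-∀
  entry : ∀ i j → x * identity n i j - d i * A i j * d j ≡ d i * (x * identity n i j - A i j) * d j
  entry i j = trans (cong (λ y → x * y - d i * A i j * d j) (sym conj))
    (sym (ring (d i) (d j) x (identity n i j) (A i j)))
    where
    conj : d i * d j * identity n i j ≡ identity n i j
    conj with i ≟ j
    ... | yes refl = trans (ℤ.*-identityʳ _) (d²≡1 i)
    ... | no  _    = ℤ.*-zeroʳ (d i * d j)

-- Congruences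

-- Weaker than being a polynomial function, but closed under sums and products, hence under
-- determinants, and enough to recover a value from values far away.
Congruent : (ℤ → ℤ) → Set
Congruent f = ∀ x y → ∃[ q ] f x ≡ f y + q * (x - y)

congruent-const : ∀ a → Congruent (const a)
congruent-const a x y = 0ℤ , sym (ℤ.+-identityʳ a)

congruent-id : Congruent λ x → x
congruent-id x y = 1ℤ , ring x y
  where
  ring : ∀ x y → x ≡ y + 1ℤ * (x - y)
  ring = solve-∀

congruent-+ : ∀ {f g} → Congruent f → Congruent g → Congruent λ x → f x + g x
congruent-+ {f} {g} F G x y with F x y | G x y
... | p , fx | q , gx = p + q , trans (cong₂ _+_ fx gx) (ring (f y) (g y) p q (x - y))
  where
  ring : ∀ a b p q d → (a + p * d) + (b + q * d) ≡ a + b + (p + q) * d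
  ring = solve-∀

congruent-* : ∀ {f g} → Congruent f → Congruent g → Congruent λ x → f x * g x
congruent-* {f} {g} F G x y with F x y | G x y
... | p , fx | q , gx =
  p * g y + f y * q + p * q * (x - y) , trans (cong₂ _*_ fx gx) (ring (f y) (g y) p q (x - y))
  where
  ring : ∀ a b p q d → (a + p * d) * (b + q * d) ≡ a * b + (p * b + a * q + p * q * d) * d
  ring = solve-∀

congruent-- : ∀ {f g} → Congruent f → Congruent g → Congruent λ x → f x - g x
congruent-- {f} {g} F G x y with F x y | G x y
... | p , fx | q , gx = p - q , trans (cong₂ _-_ fx gx) (ring (f y) (g y) p q (x - y))
  where
  ring : ∀ a b p q d → (a + p * d) - (b + q * d) ≡ a - b + (p - q) * d
  ring = solve-∀

congruent-^ : ∀ {f} m → Congruent f → Congruent λ x → f x ^ m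
congruent-^ zero    F = congruent-const 1ℤ
congruent-^ (suc m) F = congruent-* F (congruent-^ m F)

congruent-sum : ∀ {n} {f : Fin n → ℤ → ℤ} → (∀ i → Congruent (f i)) → Congruent λ x → sum λ i → f i x
congruent-sum {zero}  F = congruent-const 0ℤ
congruent-sum {suc n} F = congruent-+ (F zero) (congruent-sum (F ∘ suc))

congruent-det : ∀ {n} {M : ℤ → Matrix n} → (∀ i j → Congruent λ x → M x i j) → Congruent λ x → det (M x)
congruent-det {zero}  F = congruent-const 1ℤ
congruent-det {suc n} F = congruent-sum λ j →
  congruent-* (congruent-* (congruent-const (-1ℤ ^ toℕ j)) (F zero j))
    (congruent-det λ i k → F (suc i) (punchIn j k))

congruent-charPoly : ∀ {n} (A : Matrix n) → Congruent (charPoly A)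
congruent-charPoly {n} A = congruent-det λ i j →
  congruent-- (congruent-* congruent-id (congruent-const (identity n i j))) (congruent-const (A i j))

small-multiple : ∀ {a d} q → a ≡ q * d → ∣ a ∣ ℕ.< ∣ d ∣ → a ≡ 0ℤ
small-multiple {a} {d} q a≡qd a<d = quotient ∣ q ∣ refl
  where
  quotient : ∀ k → ∣ q ∣ ≡ k → a ≡ 0ℤ
  quotient zero    q≡0 = trans a≡qd (cong (_* d) (ℤ.∣i∣≡0⇒i≡0 {q} q≡0))
  quotient (suc k) q≡k = contradiction (ℕ.≤-trans (ℕ.m≤m+n ∣ d ∣ (k ℕ.* ∣ d ∣)) (ℕ.≤-reflexive (sym size))) (ℕ.<⇒≱ a<d)
    where
    size : ∣ a ∣ ≡ suc k ℕ.* ∣ d ∣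
    size = trans (cong ∣_∣ a≡qd) (trans (ℤ.abs-* q d) (cong (ℕ._* ∣ d ∣) q≡k))

-- f x - g x is divisible by x - y for arbitrarily distant y.
congruent-extend : ∀ {f g} → Congruent f → Congruent g → ∀ x →
  (∀ N → ∃[ y ] N ℕ.≤ ∣ x - y ∣ × f y ≡ g y) → f x ≡ g x
congruent-extend {f} {g} F G x agree with agree (suc ∣ f x - g x ∣)
... | y , far , fy≡gy with F x y | G x y
... | p , fx | q , gx = ℤ.i-j≡0⇒i≡j (f x) (g x) (small-multiple (p - q)
  (trans (cong₂ (λ a b → a - b) fx (trans gx (cong (_+ q * (x - y)) (sym fy≡gy))))
    (ring (f y) p q (x - y))) far)
  where
  ring : ∀ a p q d → (a + p * d) - (a + q * d) ≡ (p - q) * d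
  ring = solve-∀

-- Growth rates

-- The bound is asked only at positive integers: there powers grow with the exponent and a factor x
-- can be cancelled.
record O (d : ℕ) (f : ℤ → ℤ) : Set where
  constructor O-intro
  field
    constant : ℕ
    bounded  : ∀ k → ∣ f (ℤ.+ suc k) ∣ ℕ.≤ constant ℕ.* suc k ℕ.^ d

O-cong : ∀ {d f g} → (∀ x → f x ≡ g x) → O d f → O d g
O-cong f≡g (O-intro C f≤) = O-intro C λ k → ℕ.≤-trans (ℕ.≤-reflexive (cong ∣_∣ (sym (f≡g (ℤ.+ suc k))))) (f≤ k)

O-mono : ∀ {d e f} → d ℕ.≤ e → O d f → O e f
O-mono d≤e (O-intro C f≤) = O-intro C λ k → ℕ.≤-trans (f≤ k) (ℕ.*-monoʳ-≤ C (ℕ.^-monoʳ-≤ (suc k) d≤e))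

O-suc : ∀ {d f} → O d f → O (suc d) f
O-suc {d} = O-mono (ℕ.n≤1+n d)

O-+ : ∀ {d f g} → O d f → O d g → O d λ x → f x + g x
O-+ {d} {f} {g} (O-intro C f≤) (O-intro D g≤) = O-intro (C ℕ.+ D) λ k →
  ℕ.≤-trans (ℤ.∣i+j∣≤∣i∣+∣j∣ (f (ℤ.+ suc k)) (g (ℤ.+ suc k)))
    (ℕ.≤-trans (ℕ.+-mono-≤ (f≤ k) (g≤ k)) (ℕ.≤-reflexive (sym (ℕ.*-distribʳ-+ (suc k ℕ.^ d) C D))))

O-* : ∀ {d e f g} → O d f → O e g → O (d ℕ.+ e) λ x → f x * g x
O-* {d} {e} {f} {g} (O-intro C f≤) (O-intro D g≤) = O-intro (C ℕ.* D) λ k → ℕ.≤-trans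
  (ℕ.≤-reflexive (ℤ.abs-* (f (ℤ.+ suc k)) (g (ℤ.+ suc k))))
  (ℕ.≤-trans (ℕ.*-mono-≤ (f≤ k) (g≤ k)) (ℕ.≤-reflexive (begin
    C ℕ.* suc k ℕ.^ d ℕ.* (D ℕ.* suc k ℕ.^ e)    ≡⟨ ℕ.[m*n]*[o*p]≡[m*o]*[n*p] C (suc k ℕ.^ d) D (suc k ℕ.^ e) ⟩
    C ℕ.* D ℕ.* (suc k ℕ.^ d ℕ.* suc k ℕ.^ e)    ≡⟨ cong (C ℕ.* D ℕ.*_) (ℕ.^-distribˡ-+-* (suc k) d e) ⟨
    C ℕ.* D ℕ.* suc k ℕ.^ (d ℕ.+ e)              ∎)))

O-const : ∀ a → O 0 (const a)
O-const a = O-intro ∣ a ∣ λ k → ℕ.≤-reflexive (sym (ℕ.*-identityʳ ∣ a ∣))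

O-scale : ∀ {d f} a → O d f → O d λ x → a * f x
O-scale a = O-* (O-const a)

O-- : ∀ {d f g} → O d f → O d g → O d λ x → f x - g x
O-- {d} {f} {g} f≤ g≤ = O-cong (λ x → cong (f x +_) (ℤ.-1*i≡-i (g x))) (O-+ f≤ (O-scale -1ℤ g≤))

O-id : O 1 λ x → x
O-id = O-intro 1 λ k → ℕ.≤-reflexive (sym (trans (ℕ.*-identityˡ (suc k ℕ.^ 1)) (ℕ.^-identityʳ (suc k))))

O-^ : ∀ d → O d (_^ d)
O-^ zero    = O-const 1ℤ
O-^ (suc d) = O-* O-id (O-^ d)

O-sum : ∀ {n d} {f : Fin n → ℤ → ℤ} → (∀ i → O d (f i)) → O d λ x → sum λ i → f i x
O-sum {zero}  f≤ = O-mono ℕ.z≤n (O-const 0ℤ)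
O-sum {suc n} f≤ = O-+ (f≤ zero) (O-sum (f≤ ∘ suc))

O-cancel : ∀ {d f} → O (suc d) (λ x → x * f x) → O d f
O-cancel {d} {f} (O-intro C xf≤) = O-intro C λ k → ℕ.*-cancelˡ-≤ (suc k) (ℕ.≤-trans
  (ℕ.≤-reflexive (sym (ℤ.abs-* (ℤ.+ suc k) (f (ℤ.+ suc k)))))
  (ℕ.≤-trans (xf≤ k) (ℕ.≤-reflexive (ring C (suc k) (suc k ℕ.^ d)))))
  where
  ring : ∀ c k y → c ℕ.* (k ℕ.* y) ≡ k ℕ.* (c ℕ.* y)
  ring c k y = trans (sym (ℕ.*-assoc c k y)) (trans (cong (ℕ._* y) (ℕ.*-comm c k)) (ℕ.*-assoc k c y))

abs-^ : ∀ i m → ∣ i ^ m ∣ ≡ ∣ i ∣ ℕ.^ m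
abs-^ i zero    = refl
abs-^ i (suc m) = trans (ℤ.abs-* i (i ^ m)) (cong (∣ i ∣ ℕ.*_) (abs-^ i m))

-- At x = C + 1 the bound reads |a|(C + 1)^(d+1) ≤ C(C + 1)^d.
O-monomial : ∀ {d} a → O d (λ x → a * (x * x ^ d)) → a ≡ 0ℤ
O-monomial {d} a (O-intro C ax≤) = ℤ.∣i∣≡0⇒i≡0 (zero-coefficient ∣ a ∣ bound)
  where
  bound : ∣ a ∣ ℕ.* suc C ℕ.≤ C
  bound = ℕ.*-cancelʳ-≤ _ _ (suc C ℕ.^ d) ⦃ ℕ.m^n≢0 (suc C) d ⦄
    (ℕ.≤-trans (ℕ.≤-reflexive (sym (begin
      ∣ a * (ℤ.+ suc C * (ℤ.+ suc C) ^ d) ∣       ≡⟨ ℤ.abs-* a _ ⟩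
      ∣ a ∣ ℕ.* ∣ (ℤ.+ suc C) ^ suc d ∣           ≡⟨ cong (∣ a ∣ ℕ.*_) (abs-^ (ℤ.+ suc C) (suc d)) ⟩
      ∣ a ∣ ℕ.* (suc C ℕ.* suc C ℕ.^ d)           ≡⟨ ℕ.*-assoc ∣ a ∣ (suc C) (suc C ℕ.^ d) ⟨
      ∣ a ∣ ℕ.* suc C ℕ.* suc C ℕ.^ d             ∎))) (ax≤ C))
  zero-coefficient : ∀ m → m ℕ.* suc C ℕ.≤ C → m ≡ 0
  zero-coefficient zero    _ = refl
  zero-coefficient (suc m) p = contradiction (ℕ.≤-trans (ℕ.m≤m+n (suc C) (m ℕ.* suc C)) p) (ℕ.<⇒≱ ℕ.≤-refl)

O-det : ∀ {n} {M : ℤ → Matrix n} → (∀ i j → O 1 λ x → M x i j) → O n λ x → det (M x)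
O-det {zero}  M≤ = O-const 1ℤ
O-det {suc n} M≤ = O-sum λ j →
  O-* (O-scale (-1ℤ ^ toℕ j) (M≤ zero j)) (O-det λ i k → M≤ (suc i) (punchIn j k))

characteristic : ∀ {n} → Matrix n → ℤ → Matrix n
characteristic {n} A x i j = x * identity n i j - A i j

O-characteristic : ∀ {n} (A : Matrix n) i j → O 1 λ x → characteristic A x i j
O-characteristic {n} A i j = O-- (O-* O-id (O-const (identity n i j))) (O-suc (O-const (A i j)))

-- A constant row lowers the degree by one: scaled by x, its entries obey the same bound as those of
-- xI - A, and the extra factor x is cancelled from the bound for the whole determinant.
O-replaceRow : ∀ {n} (A : Matrix (suc n)) r v → O n λ x → det (replaceRow (characteristic A x) r v)
O-replaceRow A r v = O-cancel (O-cong (λ x → replaceRow-scale (characteristic A x) r x v) (O-det entry))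
  where
  entry : ∀ i j → O 1 λ x → replaceRow (characteristic A x) r (λ k → x * v k) i j
  entry i j with i ≟ r
  ... | yes refl = O-cong (λ x → sym (replaceRow-at (characteristic A x) r (λ k → x * v k) j))
    (O-* O-id (O-const (v j)))
  ... | no i≢r   = O-cong (λ x → sym (replaceRow-off (characteristic A x) (λ k → x * v k) i≢r j))
    (O-characteristic A i j)

-- f x = x^d + a x^(d-1) + b x^(d-2) + O(x^(d-3)), multiplied by x³ to keep the exponents natural.
record Expansion (d : ℕ) (a b : ℤ) (f : ℤ → ℤ) : Set where
  constructor expansion
  field
    remainder : O d λ x → x * x * x * f x - (x * x * x + a * (x * x) + b * x) * x ^ d

expansion-cong : ∀ {d a b f g} → (∀ x → f x ≡ g x) → Expansion d a b f → Expansion d a b g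
expansion-cong {d} {a} {b} f≡g (expansion e) = expansion
  (O-cong (λ x → cong (λ y → x * x * x * y - (x * x * x + a * (x * x) + b * x) * x ^ d) (f≡g x)) e)

expansion-one : Expansion 0 0ℤ 0ℤ (const 1ℤ)
expansion-one = expansion (O-cong ring (O-const 0ℤ))
  where
  ring : ∀ x → 0ℤ ≡ x * x * x * 1ℤ - (x * x * x + 0ℤ * (x * x) + 0ℤ * x) * 1ℤ
  ring = solve-∀

expansion-factor : ∀ {d a b f} θ → Expansion d a b f →
  Expansion (suc d) (a - θ) (b - θ * a) λ x → (x - θ) * f x
expansion-factor {d} {a} {b} {f} θ (expansion e) = expansion (O-cong (λ x → ring x θ a b (f x) (x ^ d))
  -- The product also contributes -θb to the next coefficient, which belongs to the remainder.
  (O-- (O-* (O-- O-id (O-suc (O-const θ))) e) (O-scale (θ * b) (O-^ (suc d)))))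
  where
  ring : ∀ x θ a b f y →
    (x - θ) * (x * x * x * f - (x * x * x + a * (x * x) + b * x) * y) - θ * b * (x * y) ≡
    x * x * x * ((x - θ) * f) - (x * x * x + (a - θ) * (x * x) + (b - θ * a) * x) * (x * y)
  ring = solve-∀

expansion-monic : ∀ {d a b f} → Expansion d a b f → O d λ x → x * f x - x * x ^ d
expansion-monic {d} {a} {b} {f} (expansion e) = O-cancel (O-cancel (O-cong (λ x → ring x a b (f x) (x ^ d))
  (O-+ (O-suc (O-suc e))
    (O-+ (O-scale a (O-^ (suc (suc d)))) (O-scale b (O-suc (O-^ (suc d))))))))
  where
  ring : ∀ x a b f y → x * x * x * f - (x * x * x + a * (x * x) + b * x) * y
    + (a * (x * (x * y)) + b * (x * y)) ≡ x * (x * (x * f - x * y))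
  ring = solve-∀

-- Otherwise the two leading terms would make x^(e+1) of order x^e.
expansion-degree-≥ : ∀ {d a b e a′ b′ f} → Expansion d a b f → Expansion e a′ b′ f → ¬ d ℕ.< e
expansion-degree-≥ {d} {e = e} {f = f} F F′ d<e = contradiction (O-monomial 1ℤ
    (O-cong (λ x → ring x (f x) (x ^ d) (x ^ e))
      (O-- (O-+ (O-mono (ℕ.<⇒≤ d<e) (expansion-monic F)) (O-mono d<e (O-^ (suc d)))) (expansion-monic F′))))
  λ ()
  where
  ring : ∀ x f y z → x * f - x * y + x * y - (x * f - x * z) ≡ 1ℤ * (x * z)
  ring = solve-∀

expansion-degree : ∀ {d a b e a′ b′ f} → Expansion d a b f → Expansion e a′ b′ f → d ≡ e
expansion-degree F F′ =
  ℕ.≤-antisym (ℕ.≮⇒≥ (expansion-degree-≥ F′ F)) (ℕ.≮⇒≥ (expansion-degree-≥ F F′))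

expansion-unique : ∀ {d a b a′ b′ f} → Expansion d a b f → Expansion d a′ b′ f → a ≡ a′ × b ≡ b′
expansion-unique {d} {a} {b} {a′} {b′} {f} (expansion F) (expansion F′) = a≡a′ , ℤ.i-j≡0⇒i≡j b b′ (O-monomial (b - b′) second)
  where
  ring : ∀ x a b a′ b′ f y → (x * x * x * f - (x * x * x + a′ * (x * x) + b′ * x) * y)
    - (x * x * x * f - (x * x * x + a * (x * x) + b * x) * y)
    ≡ x * ((a - a′) * (x * y) + (b - b′) * y)
  ring = solve-∀
  difference : O d λ x → x * ((a - a′) * (x * x ^ d) + (b - b′) * x ^ d)
  difference = O-cong (λ x → ring x a b a′ b′ (f x) (x ^ d)) (O-- F′ F)
  ring₁ : ∀ a b x y → a * (x * y) + b * y - b * y ≡ a * (x * y)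
  ring₁ = solve-∀
  a≡a′ : a ≡ a′
  a≡a′ = ℤ.i-j≡0⇒i≡j a a′ (O-monomial (a - a′)
    (O-cong (λ x → ring₁ (a - a′) (b - b′) x (x ^ d))
      (O-- (O-cancel (O-suc difference)) (O-scale (b - b′) (O-^ d)))))
  ring₂ : ∀ b x y → x * (0ℤ * (x * y) + b * y) ≡ b * (x * y)
  ring₂ = solve-∀
  second : O d λ x → (b - b′) * (x * x ^ d)
  second = O-cong (λ x → trans
      (cong (λ c → x * (c * (x * x ^ d) + (b - b′) * x ^ d)) (ℤ.i≡j⇒i-j≡0 a≡a′))
      (ring₂ (b - b′) x (x ^ d))) difference

-- Half the sum of the squares of the entries of a symmetric matrix with zero diagonal.
squaresAbove : ∀ {n} → Matrix n → ℤ
squaresAbove {zero}  A = 0ℤ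
squaresAbove {suc n} A =
  sum (λ j → A zero (suc j) * A (suc j) zero) + squaresAbove (λ i j → A (suc i) (suc j))

replaceRow-expand : ∀ {n} (A : Matrix n) r v →
  det (replaceRow A r v) ≡ sum λ k → v k * det (replaceRow A r (identity n k))
replaceRow-expand {n} A r v = trans
  (replaceRow-cong A r λ j → trans (sym (sum-identity j v)) (sum-cong-≗ λ k →
    trans (ℤ.*-comm (identity n j k) (v k)) (cong (v k *_) (identity-sym j k))))
  (replaceRow-sum A r v (identity n))

-- Let ℓ denote the cofactors of row zero of xI - A and p the characteristic polynomial. Row zero
-- gives p = xℓ₀ - Σ a₀ⱼℓⱼ; another row put in its place gives 0 = xℓᵣ - aᵣ₀ℓ₀ - Σ aᵣₖℓₖ.
-- Substituting the second relation into the first yields x²p = (x³ - degree·x)ℓ₀ + W, where ℓ₀ is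
-- the characteristic polynomial of the remaining block.
charPoly-expansion : ∀ {n} (A : Matrix n) → (∀ i → A i i ≡ 0ℤ) →
  Expansion n 0ℤ (- squaresAbove A) (charPoly A)
charPoly-expansion {zero}  A diagonal = expansion-one
charPoly-expansion {suc n} A diagonal = expansion (O-cong
  (λ x → ring x (charPoly A x) (W x) (ℓ zero x) degree (squaresAbove A′) (x ^ n) (relation x))
  (O-- (O-+ (O-* O-id W-small) (O-* O-id (Expansion.remainder A′-expansion)))
    (O-scale degree (O-* O-id (expansion-monic A′-expansion)))))
  where
  A′ : Matrix n
  A′ i j = A (suc i) (suc j)
  degree : ℤ
  degree = sum λ j → A zero (suc j) * A (suc j) zero
  ℓ : Fin (suc n) → ℤ → ℤ
  ℓ k x = det (replaceRow (characteristic A x) zero (identity (suc n) k))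
  ℓ-zero : ∀ x → charPoly A′ x ≡ ℓ zero x
  ℓ-zero x = sym (trans
    (sum-single zero {λ j → -1ℤ ^ toℕ j * identity (suc n) zero j * det (minor M j)} λ where
      zero    0≢0 → contradiction refl 0≢0
      (suc j) _   → cong (_* det (minor M (suc j))) (ℤ.*-zeroʳ (-1ℤ ^ toℕ (suc j))))
    (trans (ℤ.*-identityˡ _) (det-cong λ i j → cong (λ y → x * y - A′ i j) (identity-suc i j))))
    where
    M : Matrix (suc n)
    M = replaceRow (characteristic A x) zero (identity (suc n) zero)
  A′-expansion : Expansion n 0ℤ (- squaresAbove A′) (ℓ zero)
  A′-expansion = expansion-cong {f = charPoly A′} ℓ-zero (charPoly-expansion A′ (diagonal ∘ suc))
  others : Fin (suc n) → ℤ → ℤ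
  others i x = sum λ k → A i (suc k) * ℓ (suc k) x
  first : ∀ x → charPoly A x ≡ x * ℓ zero x - others zero x
  first x = begin
    charPoly A x
      ≡⟨ replaceRow-self (characteristic A x) zero ⟨
    det (replaceRow (characteristic A x) zero (characteristic A x zero))
      ≡⟨ replaceRow-expand (characteristic A x) zero (characteristic A x zero) ⟩
    (x * 1ℤ - A zero zero) * ℓ zero x + sum (λ k → (x * 0ℤ - A zero (suc k)) * ℓ (suc k) x)
      ≡⟨ cong₂ (λ a s → (x * 1ℤ - a) * ℓ zero x + s) (diagonal zero)
           (trans (sum-cong-≗ λ k → ring₁ x (A zero (suc k)) (ℓ (suc k) x))
             (sym (*-distribˡ-sum -1ℤ λ k → A zero (suc k) * ℓ (suc k) x))) ⟩
    (x * 1ℤ - 0ℤ) * ℓ zero x + -1ℤ * others zero x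
      ≡⟨ ring₂ x (ℓ zero x) (others zero x) ⟩
    x * ℓ zero x - others zero x ∎
    where
    ring₁ : ∀ x a l → (x * 0ℤ - a) * l ≡ -1ℤ * (a * l)
    ring₁ = solve-∀
    ring₂ : ∀ x l s → (x * 1ℤ - 0ℤ) * l + -1ℤ * s ≡ x * l - s
    ring₂ = solve-∀
  later : ∀ r x → x * ℓ (suc r) x ≡ A (suc r) zero * ℓ zero x + others (suc r) x
  later r x = ℤ.i-j≡0⇒i≡j (x * ℓ (suc r) x) (A (suc r) zero * ℓ zero x + others (suc r) x) (sym (begin
    0ℤ
      ≡⟨ replaceRow-other (characteristic A x) {zero} {suc r} (λ ()) ⟨
    det (replaceRow (characteristic A x) zero (characteristic A x (suc r)))
      ≡⟨ trans (replaceRow-expand (characteristic A x) zero (characteristic A x (suc r)))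
           (cong ((x * 0ℤ - A (suc r) zero) * ℓ zero x +_) (sum-cong-≗ λ k →
             cong (λ y → (x * y - A (suc r) (suc k)) * ℓ (suc k) x) (identity-suc r k))) ⟩
    (x * 0ℤ - A (suc r) zero) * ℓ zero x + sum (λ k → (x * identity n r k - A (suc r) (suc k)) * ℓ (suc k) x)
      ≡⟨ cong ((x * 0ℤ - A (suc r) zero) * ℓ zero x +_) (begin
           sum (λ k → (x * identity n r k - A (suc r) (suc k)) * ℓ (suc k) x)
             ≡⟨ sum-cong-≗ (λ k → ring₁ x (identity n r k) (A (suc r) (suc k)) (ℓ (suc k) x)) ⟩
           sum (λ k → x * (identity n r k * ℓ (suc k) x) + -1ℤ * (A (suc r) (suc k) * ℓ (suc k) x))
             ≡⟨ sum-linear x -1ℤ (λ k → identity n r k * ℓ (suc k) x) (λ k → A (suc r) (suc k) * ℓ (suc k) x) ⟩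
           x * sum (λ k → identity n r k * ℓ (suc k) x) + -1ℤ * others (suc r) x
             ≡⟨ cong (λ y → x * y + -1ℤ * others (suc r) x) (sum-identity r λ k → ℓ (suc k) x) ⟩
           x * ℓ (suc r) x + -1ℤ * others (suc r) x ∎) ⟩
    (x * 0ℤ - A (suc r) zero) * ℓ zero x + (x * ℓ (suc r) x + -1ℤ * others (suc r) x)
      ≡⟨ ring₂ x (A (suc r) zero) (ℓ zero x) (ℓ (suc r) x) (others (suc r) x) ⟩
    x * ℓ (suc r) x - (A (suc r) zero * ℓ zero x + others (suc r) x) ∎))
    where
    ring₁ : ∀ x i a l → (x * i - a) * l ≡ x * (i * l) + -1ℤ * (a * l)
    ring₁ = solve-∀
    ring₂ : ∀ x a l m s → (x * 0ℤ - a) * l + (x * m + -1ℤ * s) ≡ x * m - (a * l + s)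
    ring₂ = solve-∀
  xℓ-small : ∀ r → O n λ x → x * ℓ (suc r) x
  xℓ-small r = O-cong (λ x → sym (later r x))
    (O-+ (O-scale (A (suc r) zero) (O-replaceRow A zero (identity (suc n) zero)))
      (O-sum λ k → O-scale (A (suc r) (suc k)) (O-replaceRow A zero (identity (suc n) (suc k)))))
  -- Of order x^n, three orders below the leading term of x²p, so it does not reach the coefficients
  -- that are tracked.
  W : ℤ → ℤ
  W x = sum λ j → - A zero (suc j) * sum λ k → A (suc j) (suc k) * (x * ℓ (suc k) x)
  W-small : O n W
  W-small = O-sum λ j → O-scale (- A zero (suc j)) (O-sum λ k → O-scale (A (suc j) (suc k)) (xℓ-small k))
  relation : ∀ x → x * x * charPoly A x ≡ (x * x * x - degree * x) * ℓ zero x + W x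
  relation x = begin
    x * x * charPoly A x                        ≡⟨ cong (x * x *_) (first x) ⟩
    x * x * (x * ℓ zero x - others zero x)      ≡⟨ ring₁ x (ℓ zero x) (others zero x) ⟩
    x * x * x * ℓ zero x + - x * (x * others zero x)
      ≡⟨ cong (λ y → x * x * x * ℓ zero x + - x * y) (*-distribˡ-sum x λ j → A zero (suc j) * ℓ (suc j) x) ⟩
    x * x * x * ℓ zero x + - x * sum (λ j → x * (A zero (suc j) * ℓ (suc j) x))
      ≡⟨ cong (x * x * x * ℓ zero x +_) (*-distribˡ-sum (- x) λ j → x * (A zero (suc j) * ℓ (suc j) x)) ⟩
    x * x * x * ℓ zero x + sum (λ j → - x * (x * (A zero (suc j) * ℓ (suc j) x)))
      ≡⟨ cong (x * x * x * ℓ zero x +_) (sum-cong-≗ term) ⟩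
    x * x * x * ℓ zero x + sum (λ j → - (x * ℓ zero x) * (A zero (suc j) * A (suc j) zero) + 1ℤ * w j)
      ≡⟨ cong (x * x * x * ℓ zero x +_) (sum-linear (- (x * ℓ zero x)) 1ℤ (λ j → A zero (suc j) * A (suc j) zero) w) ⟩
    x * x * x * ℓ zero x + (- (x * ℓ zero x) * degree + 1ℤ * W x)
      ≡⟨ ring₂ x (ℓ zero x) degree (W x) ⟩
    (x * x * x - degree * x) * ℓ zero x + W x   ∎
    where
    w : Fin n → ℤ
    w j = - A zero (suc j) * sum λ k → A (suc j) (suc k) * (x * ℓ (suc k) x)
    ring₁ : ∀ x l s → x * x * (x * l - s) ≡ x * x * x * l + - x * (x * s)
    ring₁ = solve-∀
    ring₂ : ∀ x l d w → x * x * x * l + (- (x * l) * d + 1ℤ * w) ≡ (x * x * x - d * x) * l + w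
    ring₂ = solve-∀
    ring₃ : ∀ x a l → - x * (x * (a * l)) ≡ - x * a * (x * l)
    ring₃ = solve-∀
    ring₄ : ∀ x a b l s → - x * a * (b * l + s) ≡ - (x * l) * (a * b) + 1ℤ * (- a * (x * s))
    ring₄ = solve-∀
    ring₅ : ∀ x a l → x * (a * l) ≡ a * (x * l)
    ring₅ = solve-∀
    term : ∀ j → - x * (x * (A zero (suc j) * ℓ (suc j) x)) ≡
      - (x * ℓ zero x) * (A zero (suc j) * A (suc j) zero) + 1ℤ * w j
    term j = begin
      - x * (x * (A zero (suc j) * ℓ (suc j) x))    ≡⟨ ring₃ x (A zero (suc j)) (ℓ (suc j) x) ⟩
      - x * A zero (suc j) * (x * ℓ (suc j) x)      ≡⟨ cong (- x * A zero (suc j) *_) (later j x) ⟩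
      - x * A zero (suc j) * (A (suc j) zero * ℓ zero x + others (suc j) x)
        ≡⟨ ring₄ x (A zero (suc j)) (A (suc j) zero) (ℓ zero x) (others (suc j) x) ⟩
      - (x * ℓ zero x) * (A zero (suc j) * A (suc j) zero) + 1ℤ * (- A zero (suc j) * (x * others (suc j) x))
        ≡⟨ cong (λ y → - (x * ℓ zero x) * (A zero (suc j) * A (suc j) zero) + 1ℤ * (- A zero (suc j) * y))
             (trans (*-distribˡ-sum x λ k → A (suc j) (suc k) * ℓ (suc k) x)
               (sum-cong-≗ λ k → ring₅ x (A (suc j) (suc k)) (ℓ (suc k) x))) ⟩
      - (x * ℓ zero x) * (A zero (suc j) * A (suc j) zero) + 1ℤ * w j ∎
  ring : ∀ x p w l d e y → x * x * p ≡ (x * x * x - d * x) * l + w →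
    x * w + x * (x * x * x * l - (x * x * x + 0ℤ * (x * x) + - e * x) * y) - d * (x * (x * l - x * y)) ≡
    x * x * x * p - (x * x * x + 0ℤ * (x * x) + - (d + e) * x) * (x * y)
  ring x p w l d e y eq = trans (ring₆ x w l d e y)
    (trans (cong (λ z → x * z - (x * x * x + 0ℤ * (x * x) + - (d + e) * x) * (x * y)) (sym eq))
      (cong (_- (x * x * x + 0ℤ * (x * x) + - (d + e) * x) * (x * y)) (ring₇ x p)))
    where
    ring₆ : ∀ x w l d e y →
      x * w + x * (x * x * x * l - (x * x * x + 0ℤ * (x * x) + - e * x) * y) - d * (x * (x * l - x * y)) ≡
      x * ((x * x * x - d * x) * l + w) - (x * x * x + 0ℤ * (x * x) + - (d + e) * x) * (x * y)
    ring₆ = solve-∀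
    ring₇ : ∀ x p → x * (x * x * p) ≡ x * x * x * p
    ring₇ = solve-∀

-- Ordered sums and the inner product

sum-mono-≤ : ∀ {n} {f g : Vector ℤ n} → (∀ i → f i ℤ.≤ g i) → sum f ℤ.≤ sum g
sum-mono-≤ {zero}  f≤g = ℤ.≤-refl
sum-mono-≤ {suc n} f≤g = ℤ.+-mono-≤ (f≤g zero) (sum-mono-≤ (f≤g ∘ suc))

-- The equality case of a termwise bound: it turns a tight count into information on every
-- coordinate.
sum-mono-≡ : ∀ {n} {f g : Vector ℤ n} → (∀ i → f i ℤ.≤ g i) → sum g ℤ.≤ sum f → ∀ i → f i ≡ g i
sum-mono-≡ {suc n} {f} {g} f≤g g≤f = λ where
    zero    → ℤ.≤-antisym (f≤g zero) g₀≤f₀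
    (suc i) → sum-mono-≡ (f≤g ∘ suc) gₛ≤fₛ i
  where
  g₀≤f₀ : g zero ℤ.≤ f zero
  g₀≤f₀ = ℤ.≮⇒≥ λ f₀<g₀ → ℤ.<⇒≱ (ℤ.+-mono-<-≤ f₀<g₀ (sum-mono-≤ (f≤g ∘ suc))) g≤f
  gₛ≤fₛ : sum (g ∘ suc) ℤ.≤ sum (f ∘ suc)
  gₛ≤fₛ = ℤ.≮⇒≥ λ fₛ<gₛ → ℤ.<⇒≱ (ℤ.+-mono-≤-< (f≤g zero) fₛ<gₛ) g≤f

square-nonNegative : ∀ i → 0ℤ ℤ.≤ i * i
square-nonNegative (ℤ.+ n)    = subst (0ℤ ℤ.≤_) (ℤ.pos-* n n) (ℤ.+≤+ ℕ.z≤n)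
square-nonNegative (ℤ.-[1+ n ]) = ℤ.+≤+ ℕ.z≤n

dot : ∀ {n} → Vector ℤ n → Vector ℤ n → ℤ
dot u v = sum λ i → u i * v i

dot-nonNegative : ∀ {n} (v : Vector ℤ n) → 0ℤ ℤ.≤ dot v v
dot-nonNegative {n} v = subst (ℤ._≤ dot v v) (sum-zero {n} λ i → refl)
  (sum-mono-≤ {f = const 0ℤ} λ i → square-nonNegative (v i))

dot-definite : ∀ {n} (v : Vector ℤ n) → dot v v ≡ 0ℤ → ∀ i → v i ≡ 0ℤ
dot-definite {n} v v²≡0 i = zero-square (sym (sum-mono-≡ {f = const 0ℤ} (λ i → square-nonNegative (v i))
  (ℤ.≤-reflexive (trans v²≡0 (sym (sum-zero {n} λ i → refl)))) i))
  where
  zero-square : ∀ {a} → a * a ≡ 0ℤ → a ≡ 0ℤ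
  zero-square {a} a²≡0 with ℤ.i*j≡0⇒i≡0∨j≡0 a a²≡0
  ... | inj₁ a≡0 = a≡0
  ... | inj₂ a≡0 = a≡0

dot-comm : ∀ {n} (u v : Vector ℤ n) → dot u v ≡ dot v u
dot-comm u v = sum-cong-≗ λ i → ℤ.*-comm (u i) (v i)

dot-linear : ∀ {n} a b (u v w : Vector ℤ n) →
  dot (λ i → a * u i + b * v i) w ≡ a * dot u w + b * dot v w
dot-linear a b u v w = trans (sum-cong-≗ λ i → ring a b (u i) (v i) (w i))
  (sum-linear a b (λ i → u i * w i) λ i → v i * w i)
  where
  ring : ∀ a b u v w → (a * u + b * v) * w ≡ a * (u * w) + b * (v * w)
  ring = solve-∀

-- Polynomials in a matrix, acting on vectors

mul-linear : ∀ {n} (A : Matrix n) a b u v i →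
  mul A (λ j → a * u j + b * v j) i ≡ a * mul A u i + b * mul A v i
mul-linear A a b u v i = trans (sum-cong-≗ λ j → ring a b (A i j) (u j) (v j))
  (sum-linear a b (λ j → A i j * u j) λ j → A i j * v j)
  where
  ring : ∀ a b x u v → x * (a * u + b * v) ≡ a * (x * u) + b * (x * v)
  ring = solve-∀

mul-selfAdjoint : ∀ {n} {A : Matrix n} → Symmetric A → ∀ u v → dot (mul A u) v ≡ dot u (mul A v)
mul-selfAdjoint {n} {A} symmetric u v = begin
  sum (λ i → mul A u i * v i)                      ≡⟨ sum-cong-≗ (λ i → *-distribʳ-sum (v i) λ j → A i j * u j) ⟩
  sum (λ i → sum λ j → A i j * u j * v i)          ≡⟨ ∑-comm (λ i j → A i j * u j * v i) ⟩
  sum (λ j → sum λ i → A i j * u j * v i)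
    ≡⟨ sum-cong-≗ (λ j → sum-cong-≗ λ i → trans (cong (λ a → a * u j * v i) (symmetric i j)) (ring (A j i) (u j) (v i))) ⟩
  sum (λ j → sum λ i → u j * (A j i * v i))        ≡⟨ sum-cong-≗ (λ j → *-distribˡ-sum (u j) λ i → A j i * v i) ⟨
  sum (λ j → u j * mul A v j)                      ∎
  where
  ring : ∀ a u v → a * u * v ≡ u * (a * v)
  ring = solve-∀

shift : ∀ {n} → Matrix n → ℤ → Vector ℤ n → Vector ℤ n
shift A θ v i = mul A v i - θ * v i

shift-cong : ∀ {n} (A : Matrix n) θ {u v} → (∀ i → u i ≡ v i) → ∀ i → shift A θ u i ≡ shift A θ v i
shift-cong A θ u≡v i =
  cong₂ (λ x y → x - θ * y) (sum-cong-≗ λ j → cong (A i j *_) (u≡v j)) (u≡v i)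

shift-linear : ∀ {n} (A : Matrix n) θ a b u v i →
  shift A θ (λ j → a * u j + b * v j) i ≡ a * shift A θ u i + b * shift A θ v i
shift-linear A θ a b u v i = trans (cong (_- θ * (a * u i + b * v i)) (mul-linear A a b u v i))
  (ring θ a b (u i) (v i) (mul A u i) (mul A v i))
  where
  ring : ∀ θ a b u v x y → a * x + b * y - θ * (a * u + b * v) ≡ a * (x - θ * u) + b * (y - θ * v)
  ring = solve-∀

shift-zero : ∀ {n} (A : Matrix n) θ {v} → (∀ i → v i ≡ 0ℤ) → ∀ i → shift A θ v i ≡ 0ℤ
shift-zero A θ {v} v≡0 i = trans (shift-cong A θ {v} {λ j → 0ℤ * v j + 0ℤ * v j} (λ j → v≡0 j) i)
  (shift-linear A θ 0ℤ 0ℤ v v i)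

shift-comm : ∀ {n} (A : Matrix n) θ η v i → shift A θ (shift A η v) i ≡ shift A η (shift A θ v) i
shift-comm A θ η v i = trans (expand θ η)
  (trans (ring (mul A (mul A v) i) (mul A v i) (v i) θ η) (sym (expand η θ)))
  where
  ring : ∀ a b c θ η → 1ℤ * a + - η * b - θ * (b - η * c) ≡ 1ℤ * a + - θ * b - η * (b - θ * c)
  ring = solve-∀
  expand : ∀ θ η → shift A θ (shift A η v) i ≡
    1ℤ * mul A (mul A v) i + - η * mul A v i - θ * (mul A v i - η * v i)
  expand θ η = cong (_- θ * (mul A v i - η * v i)) (trans
    (sum-cong-≗ λ j → cong (A i j *_) (ring′ (mul A v j) η (v j)))
    (mul-linear A 1ℤ (- η) (mul A v) v i))
    where
    ring′ : ∀ a η c → a - η * c ≡ 1ℤ * a + - η * c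
    ring′ = solve-∀

shift-selfAdjoint : ∀ {n} {A : Matrix n} → Symmetric A → ∀ θ u v →
  dot (shift A θ u) v ≡ dot u (shift A θ v)
shift-selfAdjoint {A = A} symmetric θ u v = begin
  dot (shift A θ u) v
    ≡⟨ sum-cong-≗ (λ i → cong (_* v i) (ring (mul A u i) θ (u i))) ⟩
  dot (λ i → 1ℤ * mul A u i + - θ * u i) v      ≡⟨ dot-linear 1ℤ (- θ) (mul A u) u v ⟩
  1ℤ * dot (mul A u) v + - θ * dot u v
    ≡⟨ cong₂ (λ x y → 1ℤ * x + - θ * y) (trans (mul-selfAdjoint symmetric u v) (dot-comm u (mul A v))) (dot-comm u v) ⟩
  1ℤ * dot (mul A v) u + - θ * dot v u          ≡⟨ dot-linear 1ℤ (- θ) (mul A v) v u ⟨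
  dot (λ i → 1ℤ * mul A v i + - θ * v i) u
    ≡⟨ sum-cong-≗ (λ i → cong (_* u i) (ring (mul A v i) θ (v i))) ⟨
  dot (shift A θ v) u                           ≡⟨ dot-comm (shift A θ v) u ⟩
  dot u (shift A θ v)                           ∎
  where
  ring : ∀ a θ c → a - θ * c ≡ 1ℤ * a + - θ * c
  ring = solve-∀

shifts : ∀ {n} → Matrix n → ℤ → ℕ → Vector ℤ n → Vector ℤ n
shifts A θ zero    v = v
shifts A θ (suc m) v = shift A θ (shifts A θ m v)

evaluate : ∀ {n} → Matrix n → Spectrum → Vector ℤ n → Vector ℤ n
evaluate A σ v = foldr (λ (θ , m) u → shifts A θ m u) v σ

evaluateReduced : ∀ {n} → Matrix n → Spectrum → Vector ℤ n → Vector ℤ n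
evaluateReduced A σ v = foldr (λ (θ , _) u → shift A θ u) v σ

shifts-cong : ∀ {n} (A : Matrix n) θ m {u v} → (∀ i → u i ≡ v i) → ∀ i → shifts A θ m u i ≡ shifts A θ m v i
shifts-cong A θ zero    u≡v = u≡v
shifts-cong A θ (suc m) u≡v = shift-cong A θ (shifts-cong A θ m u≡v)

shifts-shift : ∀ {n} (A : Matrix n) θ m η v i → shifts A θ m (shift A η v) i ≡ shift A η (shifts A θ m v) i
shifts-shift A θ zero    η v i = refl
shifts-shift A θ (suc m) η v i =
  trans (shift-cong A θ (shifts-shift A θ m η v) i) (shift-comm A θ η (shifts A θ m v) i)

evaluate-shift : ∀ {n} (A : Matrix n) σ η v i → evaluate A σ (shift A η v) i ≡ shift A η (evaluate A σ v) i
evaluate-shift A []            η v i = refl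
evaluate-shift A ((θ , m) ∷ σ) η v i =
  trans (shifts-cong A θ m (evaluate-shift A σ η v) i) (shifts-shift A θ m η (evaluate A σ v) i)

evaluateReduced-shift : ∀ {n} (A : Matrix n) σ η v i →
  evaluateReduced A σ (shift A η v) i ≡ shift A η (evaluateReduced A σ v) i
evaluateReduced-shift A []            η v i = refl
evaluateReduced-shift A ((θ , _) ∷ σ) η v i = trans
  (shift-cong A θ (evaluateReduced-shift A σ η v) i) (shift-comm A θ η (evaluateReduced A σ v) i)

-- For symmetric A, |(A - θ)u|² = ⟨u, (A - θ)²u⟩, so (A - θ)²u = 0 forces (A - θ)u = 0 and the
-- exponent descends to one.
shifts-kernel : ∀ {n} {A : Matrix n} → Symmetric A → ∀ θ m v →
  (∀ i → shifts A θ m v i ≡ 0ℤ) → ∀ i → shift A θ v i ≡ 0ℤ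
shifts-kernel {A = A} symmetric θ zero          v v≡0 = shift-zero A θ v≡0
shifts-kernel {A = A} symmetric θ (suc zero)    v v≡0 = v≡0
shifts-kernel {A = A} symmetric θ (suc (suc m)) v v≡0 =
  shifts-kernel symmetric θ (suc m) v (dot-definite (shift A θ u) (begin
    dot (shift A θ u) (shift A θ u)   ≡⟨ shift-selfAdjoint symmetric θ u (shift A θ u) ⟩
    dot u (shift A θ (shift A θ u))   ≡⟨ sum-zero (λ i → trans (cong (u i *_) (v≡0 i)) (ℤ.*-zeroʳ (u i))) ⟩
    0ℤ                                ∎))
  where
  u = shifts A θ m v

-- Once the outermost power is reduced to a single factor, that factor commutes past the others onto
-- the vector, and the next power becomes outermost.
evaluate-kernel : ∀ {n} {A : Matrix n} → Symmetric A → ∀ σ v →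
  (∀ i → evaluate A σ v i ≡ 0ℤ) → ∀ i → evaluateReduced A σ v i ≡ 0ℤ
evaluate-kernel         symmetric []            v v≡0 = v≡0
evaluate-kernel {A = A} symmetric ((θ , m) ∷ σ) v v≡0 i = trans
  (sym (evaluateReduced-shift A σ θ v i))
  (evaluate-kernel symmetric σ (shift A θ v)
    (λ i → trans (evaluate-shift A σ θ v i) (shifts-kernel symmetric θ m (evaluate A σ v) v≡0 i)) i)

-- Cayley-Hamilton

spectralPolynomial : Spectrum → ℤ → ℤ
spectralPolynomial σ x = foldr (λ (θ , m) p → (x - θ) ^ m * p) 1ℤ σ

-- c v is congruent to u modulo the image of xI - A.
CongruentAt : ∀ {n} → Matrix n → ℤ → ℤ → Vector ℤ n → Vector ℤ n → Set
CongruentAt A x c v u = ∃[ w ] ∀ i → c * v i - u i ≡ - shift A x w i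

congruentAt-shift : ∀ {n} (A : Matrix n) x θ c v u →
  CongruentAt A x c v u → CongruentAt A x ((x - θ) * c) v (shift A θ u)
congruentAt-shift A x θ c v u (w , h) = (λ i → (x - θ) * w i + 1ℤ * u i) , λ i → begin
  (x - θ) * c * v i - shift A θ u i               ≡⟨ ring₁ x θ c (v i) (mul A u i) (u i) ⟩
  (x - θ) * (c * v i - u i) - shift A x u i       ≡⟨ cong (λ y → (x - θ) * y - shift A x u i) (h i) ⟩
  (x - θ) * - shift A x w i - shift A x u i       ≡⟨ ring₂ (x - θ) (shift A x w i) (shift A x u i) ⟩
  - ((x - θ) * shift A x w i + 1ℤ * shift A x u i) ≡⟨ cong -_ (shift-linear A x (x - θ) 1ℤ w u i) ⟨
  - shift A x (λ i → (x - θ) * w i + 1ℤ * u i) i   ∎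
  where
  ring₁ : ∀ x θ c v a u → (x - θ) * c * v - (a - θ * u) ≡ (x - θ) * (c * v - u) - (a - x * u)
  ring₁ = solve-∀
  ring₂ : ∀ y a b → y * - a - b ≡ - (y * a + 1ℤ * b)
  ring₂ = solve-∀

congruentAt-shifts : ∀ {n} (A : Matrix n) x θ m c v u →
  CongruentAt A x c v u → CongruentAt A x ((x - θ) ^ m * c) v (shifts A θ m u)
congruentAt-shifts A x θ zero    c v u h = proj₁ h , λ i →
  trans (cong (λ y → y * v i - u i) (ℤ.*-identityˡ c)) (proj₂ h i)
congruentAt-shifts A x θ (suc m) c v u h =
  subst (λ y → CongruentAt A x y v (shifts A θ (suc m) u)) (sym (ℤ.*-assoc (x - θ) ((x - θ) ^ m) c))
    (congruentAt-shift A x θ ((x - θ) ^ m * c) v (shifts A θ m u) (congruentAt-shifts A x θ m c v u h))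

congruentAt-evaluate : ∀ {n} (A : Matrix n) x σ v →
  CongruentAt A x (spectralPolynomial σ x) v (evaluate A σ v)
congruentAt-evaluate A x []            v = const 0ℤ , λ i → trans (ring (v i))
  (cong -_ (sym (shift-zero A x {const 0ℤ} (λ _ → refl) i)))
  where
  ring : ∀ v → 1ℤ * v - v ≡ - 0ℤ
  ring = solve-∀
congruentAt-evaluate A x ((θ , m) ∷ σ) v = congruentAt-shifts A x θ m (spectralPolynomial σ x) v
  (evaluate A σ v) (congruentAt-evaluate A x σ v)

mul-characteristic : ∀ {n} (A : Matrix n) x v i → mul (characteristic A x) v i ≡ - shift A x v i
mul-characteristic {n} A x v i = begin
  sum (λ j → (x * identity n i j - A i j) * v j)
    ≡⟨ sum-cong-≗ (λ j → ring x (identity n i j) (A i j) (v j)) ⟩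
  sum (λ j → x * (identity n i j * v j) + -1ℤ * (A i j * v j))
    ≡⟨ sum-linear x -1ℤ (λ j → identity n i j * v j) (λ j → A i j * v j) ⟩
  x * sum (λ j → identity n i j * v j) + -1ℤ * mul A v i
    ≡⟨ cong (λ y → x * y + -1ℤ * mul A v i) (sum-identity i v) ⟩
  x * v i + -1ℤ * mul A v i     ≡⟨ ring′ x (v i) (mul A v i) ⟩
  - shift A x v i               ∎
  where
  ring : ∀ x e a v → (x * e - a) * v ≡ x * (e * v) + -1ℤ * (a * v)
  ring = solve-∀
  ring′ : ∀ x v m → x * v + -1ℤ * m ≡ - (m - x * v)
  ring′ = solve-∀

characteristic-symmetric : ∀ {n} {A : Matrix n} → Symmetric A → ∀ x → Symmetric (characteristic A x)
characteristic-symmetric symmetric x i j = cong₂ (λ e a → x * e - a) (identity-sym i j) (symmetric i j)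

-- If |p| ≤ |f| at x, then x·x^(d+1) ≤ x|f| + |xp - x·x^(d+1)| ≤ (C + D)x^(d+1), hence x ≤ C + D.
eventually-smaller : ∀ {d} (f p : ℤ → ℤ) → O d f → O (suc d) (λ x → x * p x - x * x ^ suc d) →
  ∃[ K ] ∀ k → K ℕ.≤ k → ∣ f (ℤ.+ suc k) ∣ ℕ.< ∣ p (ℤ.+ suc k) ∣
eventually-smaller {d} f p (O-intro C f≤) (O-intro D p≥) = C ℕ.+ D , λ k C+D≤k →
  ℕ.≰⇒> {∣ p (ℤ.+ suc k) ∣} {∣ f (ℤ.+ suc k) ∣} λ p≤f → contradiction (bound k p≤f) (ℕ.<⇒≱ (ℕ.s≤s C+D≤k))
  where
  ring : ∀ a b → a ≡ b - (b - a)
  ring = solve-∀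
  bound : ∀ k → ∣ p (ℤ.+ suc k) ∣ ℕ.≤ ∣ f (ℤ.+ suc k) ∣ → suc k ℕ.≤ C ℕ.+ D
  bound k p≤f = ℕ.*-cancelʳ-≤ (suc k) (C ℕ.+ D) N ⦃ ℕ.m^n≢0 (suc k) (suc d) ⦄ (ℕ.≤-trans
    (ℕ.≤-reflexive split)
    (ℕ.≤-trans (ℤ.∣i-j∣≤∣i∣+∣j∣ (x * p x) (x * p x - x * x ^ suc d))
      (ℕ.≤-trans (ℕ.+-mono-≤ xp≤ (p≥ k)) (ℕ.≤-reflexive (sym (ℕ.*-distribʳ-+ N C D))))))
    where
    x = ℤ.+ suc k
    N = suc k ℕ.^ suc d
    split : suc k ℕ.* N ≡ ∣ x * p x - (x * p x - x * x ^ suc d) ∣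
    split = trans (sym (abs-^ x (suc (suc d)))) (cong ∣_∣ (ring (x * x ^ suc d) (x * p x)))
    regroup : suc k ℕ.* (C ℕ.* suc k ℕ.^ d) ≡ C ℕ.* N
    regroup = begin
      suc k ℕ.* (C ℕ.* suc k ℕ.^ d)      ≡⟨ ℕ.*-assoc (suc k) C (suc k ℕ.^ d) ⟨
      suc k ℕ.* C ℕ.* suc k ℕ.^ d        ≡⟨ cong (ℕ._* suc k ℕ.^ d) (ℕ.*-comm (suc k) C) ⟩
      C ℕ.* suc k ℕ.* suc k ℕ.^ d        ≡⟨ ℕ.*-assoc C (suc k) (suc k ℕ.^ d) ⟩
      C ℕ.* N                            ∎
    xp≤ : ∣ x * p x ∣ ℕ.≤ C ℕ.* N
    xp≤ = ℕ.≤-trans (ℕ.≤-reflexive (ℤ.abs-* x (p x)))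
      (ℕ.≤-trans (ℕ.*-monoʳ-≤ (suc k) (ℕ.≤-trans p≤f (f≤ k))) (ℕ.≤-reflexive regroup))

-- By Cramer's rule det B divides the determinant obtained from B = xI - A by replacing a row by
-- p(A)v; for fixed v the latter is of smaller degree in x, so it vanishes for large x.
module _ {n} {A : Matrix (suc n)} (symmetric : Symmetric A) (diagonal : ∀ i → A i i ≡ 0ℤ)
         {σ : Spectrum} (hasSpectrum : HasSpectrum A σ) where

  replaced : Vector ℤ (suc n) → Fin (suc n) → ℤ → ℤ
  replaced v i x = det (replaceRow (characteristic A x) i v)

  -- Write p(A)v = p(x)v - (xI - A)w. Cramer's rule turns the second part into a multiple of det(xI
  -- - A), and p(x) is that determinant itself by the assumption on the spectrum.
  evaluate-multiple : ∀ v i x → ∃[ q ] replaced (evaluate A σ v) i x ≡ q * charPoly A x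
  evaluate-multiple v i x with congruentAt-evaluate A x σ v
  ... | w , h = replaced v i x - w i , (begin
    replaced (evaluate A σ v) i x
      ≡⟨ replaceRow-linear (characteristic A x) i c -1ℤ {v} {mul (characteristic A x) w} row ⟩
    c * replaced v i x + -1ℤ * replaced (mul (characteristic A x) w) i x
      ≡⟨ cong (λ z → c * replaced v i x + -1ℤ * z) (cramer (characteristic-symmetric symmetric x) i w) ⟩
    c * replaced v i x + -1ℤ * (w i * charPoly A x)
      ≡⟨ cong (λ y → y * replaced v i x + -1ℤ * (w i * charPoly A x)) (hasSpectrum x) ⟨
    charPoly A x * replaced v i x + -1ℤ * (w i * charPoly A x)
      ≡⟨ ring′ (charPoly A x) (replaced v i x) (w i) ⟩
    (replaced v i x - w i) * charPoly A x ∎)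
    where
    c = spectralPolynomial σ x
    ring : ∀ c v u → u ≡ c * v + -1ℤ * (c * v - u)
    ring = solve-∀
    ring′ : ∀ p a b → p * a + -1ℤ * (b * p) ≡ (a - b) * p
    ring′ = solve-∀
    row : ∀ j → evaluate A σ v j ≡ c * v j + -1ℤ * mul (characteristic A x) w j
    row j = trans (ring c (v j) (evaluate A σ v j))
      (cong (λ y → c * v j + -1ℤ * y) (trans (h j) (sym (mul-characteristic A x w j))))

  charPoly-monic : O (suc n) λ x → x * charPoly A x - x * x ^ suc n
  charPoly-monic = expansion-monic (charPoly-expansion A diagonal)

  cayleyHamilton : ∀ v i → evaluate A σ v i ≡ 0ℤ
  cayleyHamilton v i = zero-factor (ℤ.i*j≡0⇒i≡0∨j≡0 (evaluate A σ v i) product≡0)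
    where
    small : ∀ u → ∃[ K ] ∀ k → K ℕ.≤ k →
      ∣ replaced (evaluate A σ u) i (ℤ.+ suc k) ∣ ℕ.< ∣ charPoly A (ℤ.+ suc k) ∣
    small u = eventually-smaller (replaced (evaluate A σ u) i) (charPoly A)
      (O-replaceRow A i (evaluate A σ u)) charPoly-monic
    -- One x has to serve for both v and Av, because (xI - A)p(A)v = x p(A)v - p(A)(Av); here Av is
    -- `shift A 0ℤ v`.
    K  = proj₁ (small v)
    K′ = proj₁ (small (shift A 0ℤ v))
    k  = K ℕ.⊔ K′
    x  = ℤ.+ suc k
    vanishes : ∀ u → ∣ replaced (evaluate A σ u) i x ∣ ℕ.< ∣ charPoly A x ∣ → replaced (evaluate A σ u) i x ≡ 0ℤ
    vanishes u = small-multiple (proj₁ (evaluate-multiple u i x)) (proj₂ (evaluate-multiple u i x))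
    ring : ∀ x m v s → s ≡ m - 0ℤ * v → - (m - x * v) ≡ x * v + -1ℤ * s
    ring x m v s refl = ring″ x m v
      where
      ring″ : ∀ x m v → - (m - x * v) ≡ x * v + -1ℤ * (m - 0ℤ * v)
      ring″ = solve-∀
    product≡0 : evaluate A σ v i * charPoly A x ≡ 0ℤ
    product≡0 = begin
      evaluate A σ v i * charPoly A x
        ≡⟨ cramer (characteristic-symmetric symmetric x) i (evaluate A σ v) ⟨
      replaced (mul (characteristic A x) (evaluate A σ v)) i x
        ≡⟨ replaceRow-linear (characteristic A x) i x -1ℤ {evaluate A σ v} {evaluate A σ (shift A 0ℤ v)}
             (λ j → trans (mul-characteristic A x (evaluate A σ v) j)
               (ring x (mul A (evaluate A σ v) j) (evaluate A σ v j) _ (evaluate-shift A σ 0ℤ v j))) ⟩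
      x * replaced (evaluate A σ v) i x + -1ℤ * replaced (evaluate A σ (shift A 0ℤ v)) i x
        ≡⟨ cong₂ (λ y z → x * y + -1ℤ * z) (vanishes v (proj₂ (small v) k (ℕ.m≤m⊔n K K′)))
             (vanishes (shift A 0ℤ v) (proj₂ (small (shift A 0ℤ v)) k (ℕ.m≤n⊔m K K′))) ⟩
      x * 0ℤ + -1ℤ * 0ℤ
        ≡⟨ cong (_+ -1ℤ * 0ℤ) (ℤ.*-zeroʳ x) ⟩
      0ℤ ∎
    zero-factor : evaluate A σ v i ≡ 0ℤ ⊎ charPoly A x ≡ 0ℤ → evaluate A σ v i ≡ 0ℤ
    zero-factor (inj₁ e≡0) = e≡0
    zero-factor (inj₂ p≡0) = contradiction (ℕ.<-≤-trans (proj₂ (small v) k (ℕ.m≤m⊔n K K′)) (ℕ.≤-reflexive (cong ∣_∣ p≡0))) ℕ.n≮0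

minimalPolynomial : ∀ {n} {A : Matrix n} → Symmetric A → (∀ i → A i i ≡ 0ℤ) →
  ∀ {σ} → HasSpectrum A σ → ∀ v i → evaluateReduced A σ v i ≡ 0ℤ
minimalPolynomial {suc n} {A} symmetric diagonal {σ} hasSpectrum v =
  evaluate-kernel symmetric σ v (cayleyHamilton symmetric diagonal {σ} hasSpectrum v)

-- Degree and the two coefficients after the leading one of a monic product. They evaluate, so the
-- numerical conditions on a concrete spectrum hold by `refl`.
Coefficients : Set
Coefficients = ℕ × ℤ × ℤ

multiplyByFactors : ℤ → ℕ → Coefficients → Coefficients
multiplyByFactors θ zero    c = c
multiplyByFactors θ (suc m) c with multiplyByFactors θ m c
... | d , a , b = suc d , a - θ , b - θ * a

coefficients : Spectrum → Coefficients
coefficients = foldr (λ (θ , m) → multiplyByFactors θ m) (0 , 0ℤ , 0ℤ)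

HasExpansion : Coefficients → (ℤ → ℤ) → Set
HasExpansion (d , a , b) = Expansion d a b

spectralPolynomial-expansion : ∀ σ → HasExpansion (coefficients σ) (spectralPolynomial σ)
spectralPolynomial-expansion []            = expansion-one
spectralPolynomial-expansion ((θ , m) ∷ σ) =
  factors m (coefficients σ) (spectralPolynomial σ) (spectralPolynomial-expansion σ)
  where
  factors : ∀ m c f → HasExpansion c f → HasExpansion (multiplyByFactors θ m c) λ x → (x - θ) ^ m * f x
  factors zero    c f e = expansion-cong (λ x → sym (ℤ.*-identityˡ (f x))) e
  factors (suc m) c f e with multiplyByFactors θ m c | factors m c f e
  ... | d , a , b | e′ = expansion-cong (λ x → sym (ℤ.*-assoc (x - θ) ((x - θ) ^ m) (f x))) (expansion-factor θ e′)

-- Determines the order of the matrix and, for a graph, the number of edges.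
spectrum-coefficients : ∀ {n} (A : Matrix n) → (∀ i → A i i ≡ 0ℤ) → ∀ {σ} → HasSpectrum A σ →
  ∀ {d a b} → coefficients σ ≡ (d , a , b) → n ≡ d × squaresAbove A ≡ - b
spectrum-coefficients {n} A diagonal {σ} hasSpectrum {d} {a} {b} c≡ = go (expansion-degree e e′)
  where
  e : Expansion n 0ℤ (- squaresAbove A) (charPoly A)
  e = charPoly-expansion A diagonal
  e′ : Expansion d a b (charPoly A)
  e′ = expansion-cong (λ x → sym (hasSpectrum x))
    (subst (λ c → HasExpansion c (spectralPolynomial σ)) c≡ (spectralPolynomial-expansion σ))
  go : n ≡ d → n ≡ d × squaresAbove A ≡ - b
  go refl = refl , trans (sym (ℤ.neg-involutive (squaresAbove A))) (cong -_ (proj₂ (expansion-unique e e′)))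

-- Regularity

squaresAbove-double : ∀ {n} (A : Matrix n) → Symmetric A → (∀ i → A i i ≡ 0ℤ) →
  sum (λ i → sum λ j → A i j * A i j) ≡ ℤ.+ 2 * squaresAbove A
squaresAbove-double {zero}  A symmetric diagonal = refl
squaresAbove-double {suc n} A symmetric diagonal = begin
  A zero zero * A zero zero + r + sum (λ i → A (suc i) zero * A (suc i) zero + sum (λ j → A (suc i) (suc j) * A (suc i) (suc j)))
    ≡⟨ cong₂ (λ x y → x * x + r + y) (diagonal zero)
         (∑-distrib-+ (λ i → A (suc i) zero * A (suc i) zero) λ i → sum λ j → A (suc i) (suc j) * A (suc i) (suc j)) ⟩
  0ℤ * 0ℤ + r + (sum (λ i → A (suc i) zero * A (suc i) zero) + sum (λ i → sum λ j → A (suc i) (suc j) * A (suc i) (suc j)))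
    ≡⟨ cong₂ (λ x y → 0ℤ * 0ℤ + r + (x + y))
         (sum-cong-≗ λ i → cong (_* A (suc i) zero) (symmetric (suc i) zero))
         (squaresAbove-double (λ i j → A (suc i) (suc j)) (λ i j → symmetric (suc i) (suc j)) (diagonal ∘ suc)) ⟩
  0ℤ * 0ℤ + r + (d + ℤ.+ 2 * squaresAbove (λ i j → A (suc i) (suc j)))
    ≡⟨ cong (λ x → 0ℤ * 0ℤ + x + (d + ℤ.+ 2 * squaresAbove (λ i j → A (suc i) (suc j))))
         (sum-cong-≗ λ j → cong (A zero (suc j) *_) (symmetric zero (suc j))) ⟩
  0ℤ * 0ℤ + d + (d + ℤ.+ 2 * squaresAbove (λ i j → A (suc i) (suc j)))
    ≡⟨ ring d (squaresAbove λ i j → A (suc i) (suc j)) ⟩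
  ℤ.+ 2 * (d + squaresAbove (λ i j → A (suc i) (suc j))) ∎
  where
  r d : ℤ
  r = sum λ j → A zero (suc j) * A zero (suc j)
  d = sum λ j → A zero (suc j) * A (suc j) zero
  ring : ∀ d e → 0ℤ * 0ℤ + d + (d + ℤ.+ 2 * e) ≡ ℤ.+ 2 * (d + e)
  ring = solve-∀

sum-nonNegative-zero : ∀ a b c → 0ℤ ℤ.≤ a → 0ℤ ℤ.≤ b → 0ℤ ℤ.< c → a + c * b ≡ 0ℤ → b ≡ 0ℤ
sum-nonNegative-zero (ℤ.+ a) (ℤ.+ zero)  (ℤ.+ c)     _ _ _ eq = refl
sum-nonNegative-zero (ℤ.+ a) (ℤ.+ suc b) (ℤ.+ suc c) _ _ _ eq =
  contradiction (ℕ.m+n≡0⇒n≡0 a (ℤ.+-injective eq)) λ ()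
sum-nonNegative-zero (ℤ.+ a) (ℤ.+ suc b) (ℤ.+ zero)  _ _ (ℤ.+<+ ()) eq

-- With z = (A - k)u and (y - θ₁)(y - θ₂)(y - θ₃) = (y - k)(y² + αy + β) + ν, orthogonality of z to u
-- gives 0 = 4⟨z, (A² + αA + β)z⟩ = |(2A + α)z|² + (4β - α²)|z|².
eigenvector-of-mean : ∀ {n} {A : Matrix n} → Symmetric A → ∀ k θ₁ θ₂ θ₃ u →
  let α = k - (θ₁ + θ₂ + θ₃)
      β = k * α + (θ₁ * θ₂ + θ₁ * θ₃ + θ₂ * θ₃)
  in
  0ℤ ℤ.< ℤ.+ 4 * β - α * α →
  (∀ i → shift A k (shift A θ₁ (shift A θ₂ (shift A θ₃ u))) i ≡ 0ℤ) →
  dot u (shift A k u) ≡ 0ℤ → ∀ i → shift A k u i ≡ 0ℤ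
eigenvector-of-mean {n} {A} symmetric k θ₁ θ₂ θ₃ u positive annihilated mean =
  dot-definite z (sum-nonNegative-zero (dot h h) (dot z z) (ℤ.+ 4 * β - α * α)
    (dot-nonNegative h) (dot-nonNegative z) positive squares)
  where
  α β ν : ℤ
  α = k - (θ₁ + θ₂ + θ₃)
  β = k * α + (θ₁ * θ₂ + θ₁ * θ₃ + θ₂ * θ₃)
  ν = k * β - θ₁ * θ₂ * θ₃
  z a b g h : Vector ℤ n
  z = shift A k u
  a = shift A 0ℤ z
  b = shift A 0ℤ a
  g i = 1ℤ * b i + 1ℤ * (α * a i + β * z i)
  h i = ℤ.+ 2 * a i + α * z i
  shift≡ : ∀ θ v i → shift A θ v i ≡ 1ℤ * shift A 0ℤ v i + - θ * v i
  shift≡ θ v i = ring (mul A v i) θ (v i)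
    where
    ring : ∀ m θ x → m - θ * x ≡ 1ℤ * (m - 0ℤ * x) + - θ * x
    ring = solve-∀
  shiftz : ∀ θ i → shift A θ z i ≡ 1ℤ * a i + - θ * z i
  shiftz θ i = shift≡ θ z i
  -- The left side is (A - θ₁)(A - θ₂)(A - θ₃)z with the cubic divided by y - k; it vanishes because
  -- z supplies the factor A - k.
  cubic : ∀ i → shift A k g i + ν * z i ≡ 0ℤ
  cubic i = begin
    shift A k g i + ν * z i
      ≡⟨ cong (_+ ν * z i) (trans (shift≡ k g i) (cong (λ y → 1ℤ * y + - k * g i) shiftg)) ⟩
    1ℤ * (1ℤ * c + 1ℤ * (α * b i + β * a i)) + - k * g i + ν * z i
      ≡⟨ ring k θ₁ θ₂ θ₃ (z i) (a i) (b i) c ⟩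
    1ℤ * (1ℤ * (1ℤ * c + - θ₃ * b i) + - θ₂ * (1ℤ * b i + - θ₃ * a i))
      + - θ₁ * (1ℤ * (1ℤ * b i + - θ₃ * a i) + - θ₂ * (1ℤ * a i + - θ₃ * z i))
      ≡⟨ expand ⟨
    shift A θ₁ (shift A θ₂ (shift A θ₃ z)) i
      ≡⟨ commute ⟩
    0ℤ ∎
    where
    c : ℤ
    c = shift A 0ℤ b i
    ring : ∀ k θ₁ θ₂ θ₃ z a b c →
      1ℤ * (1ℤ * c + 1ℤ * ((k - (θ₁ + θ₂ + θ₃)) * b + (k * (k - (θ₁ + θ₂ + θ₃)) + (θ₁ * θ₂ + θ₁ * θ₃ + θ₂ * θ₃)) * a))
      + - k * (1ℤ * b + 1ℤ * ((k - (θ₁ + θ₂ + θ₃)) * a + (k * (k - (θ₁ + θ₂ + θ₃)) + (θ₁ * θ₂ + θ₁ * θ₃ + θ₂ * θ₃)) * z))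
      + (k * (k * (k - (θ₁ + θ₂ + θ₃)) + (θ₁ * θ₂ + θ₁ * θ₃ + θ₂ * θ₃)) - θ₁ * θ₂ * θ₃) * z ≡
      1ℤ * (1ℤ * (1ℤ * c + - θ₃ * b) + - θ₂ * (1ℤ * b + - θ₃ * a))
      + - θ₁ * (1ℤ * (1ℤ * b + - θ₃ * a) + - θ₂ * (1ℤ * a + - θ₃ * z))
    ring = solve-∀
    shiftg : shift A 0ℤ g i ≡ 1ℤ * c + 1ℤ * (α * b i + β * a i)
    shiftg = trans (shift-linear A 0ℤ 1ℤ 1ℤ b (λ j → α * a j + β * z j) i)
      (cong (λ y → 1ℤ * c + 1ℤ * y) (shift-linear A 0ℤ α β a z i))
    twice : ∀ j → shift A 0ℤ (shift A θ₃ z) j ≡ 1ℤ * b j + - θ₃ * a j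
    twice j = trans (shift-cong A 0ℤ (shiftz θ₃) j) (shift-linear A 0ℤ 1ℤ (- θ₃) a z j)
    second : ∀ j → shift A θ₂ (shift A θ₃ z) j ≡
      1ℤ * (1ℤ * b j + - θ₃ * a j) + - θ₂ * (1ℤ * a j + - θ₃ * z j)
    second j = trans (shift≡ θ₂ (shift A θ₃ z) j)
      (cong₂ (λ x y → 1ℤ * x + - θ₂ * y) (twice j) (shiftz θ₃ j))
    expand : shift A θ₁ (shift A θ₂ (shift A θ₃ z)) i ≡
      1ℤ * (1ℤ * (1ℤ * c + - θ₃ * b i) + - θ₂ * (1ℤ * b i + - θ₃ * a i))
      + - θ₁ * (1ℤ * (1ℤ * b i + - θ₃ * a i) + - θ₂ * (1ℤ * a i + - θ₃ * z i))
    expand = trans (shift≡ θ₁ (shift A θ₂ (shift A θ₃ z)) i)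
      (cong₂ (λ x y → 1ℤ * x + - θ₁ * y)
        (trans (shift-cong A 0ℤ second i)
          (trans (shift-linear A 0ℤ 1ℤ (- θ₂) (λ j → 1ℤ * b j + - θ₃ * a j) (λ j → 1ℤ * a j + - θ₃ * z j) i)
            (cong₂ (λ x y → 1ℤ * x + - θ₂ * y)
              (shift-linear A 0ℤ 1ℤ (- θ₃) b a i) (shift-linear A 0ℤ 1ℤ (- θ₃) a z i))))
        (second i))
    commute : shift A θ₁ (shift A θ₂ (shift A θ₃ z)) i ≡ 0ℤ
    commute = begin
      shift A θ₁ (shift A θ₂ (shift A θ₃ (shift A k u))) i
        ≡⟨ shift-cong A θ₁ (shift-cong A θ₂ (shift-comm A θ₃ k u)) i ⟩
      shift A θ₁ (shift A θ₂ (shift A k (shift A θ₃ u))) i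
        ≡⟨ shift-cong A θ₁ (shift-comm A θ₂ k (shift A θ₃ u)) i ⟩
      shift A θ₁ (shift A k (shift A θ₂ (shift A θ₃ u))) i
        ≡⟨ shift-comm A θ₁ k (shift A θ₂ (shift A θ₃ u)) i ⟩
      shift A k (shift A θ₁ (shift A θ₂ (shift A θ₃ u))) i
        ≡⟨ annihilated i ⟩
      0ℤ ∎
  -- Moving A - k from z = (A - k)u over to g leaves -ν⟨z, u⟩, which the mean condition makes zero.
  zg≡0 : dot g z ≡ 0ℤ
  zg≡0 = begin
    dot g z                                        ≡⟨ shift-selfAdjoint symmetric k g u ⟨
    dot (shift A k g) u
      ≡⟨ ring (dot (shift A k g) u) ν ⟩
    1ℤ * dot (shift A k g) u + ν * 0ℤ
      ≡⟨ cong (λ y → 1ℤ * dot (shift A k g) u + ν * y) (trans (dot-comm z u) mean) ⟨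
    1ℤ * dot (shift A k g) u + ν * dot z u         ≡⟨ dot-linear 1ℤ ν (shift A k g) z u ⟨
    dot (λ i → 1ℤ * shift A k g i + ν * z i) u
      ≡⟨ sum-zero (λ i → cong (_* u i) (trans (cong (_+ ν * z i) (ℤ.*-identityˡ (shift A k g i))) (cubic i))) ⟩
    0ℤ ∎
    where
    ring : ∀ x y → x ≡ 1ℤ * x + y * 0ℤ
    ring = solve-∀
  squares : dot h h + (ℤ.+ 4 * β - α * α) * dot z z ≡ 0ℤ
  squares = begin
    dot h h + γ * dot z z
      ≡⟨ cong (_+ γ * dot z z) hh ⟩
    ℤ.+ 2 * (ℤ.+ 2 * dot a a + α * dot a z) + α * (ℤ.+ 2 * dot a z + α * dot z z) + γ * dot z z
      ≡⟨ ring α β (dot a a) (dot a z) (dot z z) ⟩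
    ℤ.+ 4 * (1ℤ * dot a a + 1ℤ * (α * dot a z + β * dot z z))
      ≡⟨ cong (ℤ.+ 4 *_) gz ⟨
    ℤ.+ 4 * dot g z
      ≡⟨ cong (ℤ.+ 4 *_) zg≡0 ⟩
    0ℤ ∎
    where
    γ : ℤ
    γ = ℤ.+ 4 * β - α * α
    ring : ∀ α β p q r → ℤ.+ 2 * (ℤ.+ 2 * p + α * q) + α * (ℤ.+ 2 * q + α * r) + (ℤ.+ 4 * β - α * α) * r
      ≡ ℤ.+ 4 * (1ℤ * p + 1ℤ * (α * q + β * r))
    ring = solve-∀
    hh : dot h h ≡ ℤ.+ 2 * (ℤ.+ 2 * dot a a + α * dot a z) + α * (ℤ.+ 2 * dot a z + α * dot z z)
    hh = trans (dot-linear (ℤ.+ 2) α a z h) (cong₂ (λ x y → ℤ.+ 2 * x + α * y)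
      (trans (dot-comm a h) (trans (dot-linear (ℤ.+ 2) α a z a)
        (cong (λ y → ℤ.+ 2 * dot a a + α * y) (dot-comm z a))))
      (trans (dot-comm z h) (dot-linear (ℤ.+ 2) α a z z)))
    gz : dot g z ≡ 1ℤ * dot a a + 1ℤ * (α * dot a z + β * dot z z)
    gz = trans (dot-linear 1ℤ 1ℤ b (λ i → α * a i + β * z i) z) (cong₂ (λ x y → 1ℤ * x + 1ℤ * y)
      (shift-selfAdjoint symmetric 0ℤ a z) (dot-linear α β a z z))

-- Transfer between the two characteristic polynomials

*-distribʳ-^ : ∀ a b m → (a * b) ^ m ≡ a ^ m * b ^ m
*-distribʳ-^ a b zero    = refl
*-distribʳ-^ a b (suc m) = trans (cong (a * b *_) (*-distribʳ-^ a b m)) (ring a b (a ^ m) (b ^ m))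
  where
  ring : ∀ a b p q → a * b * (p * q) ≡ a * p * (b * q)
  ring = solve-∀

^-nonZero : ∀ a .⦃ _ : ℤ.NonZero a ⦄ m → ℤ.NonZero (a ^ m)
^-nonZero a zero    = _
^-nonZero a (suc m) = ℤ.i*j≢0 a (a ^ m) where instance _ = ^-nonZero a m

-- For y = -2x - 1 and S = J - I - 2A one has (S - yI) - J = 2(xI - A). The column sums of S - yI
-- are 2(x - κ), and subtracting n leaves 2(x - k), so `det-minusAllOnes` gives the relation up to
-- powers of -1 and 2.
charPoly-transfer : ∀ {n} (S A : Matrix n) k κ → Symmetric S →
  (∀ i j → S i j + ℤ.+ 2 * A i j ≡ 1ℤ - identity n i j) →
  (∀ i → sum (S i) ≡ -1ℤ - ℤ.+ 2 * κ) → ℤ.+ n ≡ ℤ.+ 2 * (k - κ) → ∀ x →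
  (x - κ) * ((ℤ.- ℤ.+ 2) ^ n * charPoly A x) ≡ (x - k) * charPoly S (- (ℤ.+ 2 * x) - 1ℤ)
charPoly-transfer {n} S A k κ symmetric S+2A rowSums n≡ x =
  ℤ.*-cancelˡ-≡ (ℤ.+ 2) ((x - κ) * ((ℤ.- ℤ.+ 2) ^ n * charPoly A x)) ((x - k) * charPoly S y) (begin
    ℤ.+ 2 * ((x - κ) * ((ℤ.- ℤ.+ 2) ^ n * charPoly A x))
      ≡⟨ cong (λ p → ℤ.+ 2 * ((x - κ) * (p * charPoly A x))) (*-distribʳ-^ -1ℤ (ℤ.+ 2) n) ⟩
    ℤ.+ 2 * ((x - κ) * (-1ℤ ^ n * (ℤ.+ 2) ^ n * charPoly A x))
      ≡⟨ ring₁ x κ (-1ℤ ^ n) ((ℤ.+ 2) ^ n) (charPoly A x) ⟩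
    -1ℤ ^ n * (β * ((ℤ.+ 2) ^ n * charPoly A x))
      ≡⟨ cong (λ d → -1ℤ ^ n * (β * d)) B-J-det ⟨
    -1ℤ ^ n * (β * det (λ i j → B i j - 1ℤ))
      ≡⟨ cong (-1ℤ ^ n *_) (det-minusAllOnes B β columnSums) ⟩
    -1ℤ ^ n * ((β - ℤ.+ n) * det B)
      ≡⟨ cong₂ (λ m d → -1ℤ ^ n * ((β - m) * d)) n≡ B-det ⟩
    -1ℤ ^ n * ((β - ℤ.+ 2 * (k - κ)) * (-1ℤ ^ n * charPoly S y))
      ≡⟨ ring₂ x k κ (-1ℤ ^ n) (charPoly S y) ⟩
    -1ℤ ^ n * -1ℤ ^ n * (ℤ.+ 2 * ((x - k) * charPoly S y))
      ≡⟨ cong (_* (ℤ.+ 2 * ((x - k) * charPoly S y)))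
           (trans (sym (*-distribʳ-^ -1ℤ -1ℤ n)) (ℤ.^-zeroˡ n)) ⟩
    1ℤ * (ℤ.+ 2 * ((x - k) * charPoly S y))
      ≡⟨ ℤ.*-identityˡ (ℤ.+ 2 * ((x - k) * charPoly S y)) ⟩
    ℤ.+ 2 * ((x - k) * charPoly S y) ∎)
  where
  y β : ℤ
  y = - (ℤ.+ 2 * x) - 1ℤ
  β = ℤ.+ 2 * (x - κ)
  B : Matrix n
  B i j = -1ℤ * (y * identity n i j - S i j)
  ring₁ : ∀ x κ s p c → ℤ.+ 2 * ((x - κ) * (s * p * c)) ≡ s * (ℤ.+ 2 * (x - κ) * (p * c))
  ring₁ = solve-∀
  ring₂ : ∀ x k κ s c → s * ((ℤ.+ 2 * (x - κ) - ℤ.+ 2 * (k - κ)) * (s * c)) ≡ s * s * (ℤ.+ 2 * ((x - k) * c))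
  ring₂ = solve-∀
  B-det : det B ≡ -1ℤ ^ n * charPoly S y
  B-det = det-scalar -1ℤ (λ i j → y * identity n i j - S i j)
  B-J-det : det (λ i j → B i j - 1ℤ) ≡ (ℤ.+ 2) ^ n * charPoly A x
  B-J-det = trans (det-cong λ i j → entry (S i j) (A i j) (identity n i j) (S+2A i j))
    (det-scalar (ℤ.+ 2) (λ i j → x * identity n i j - A i j))
    where
    entry : ∀ s a e → s + ℤ.+ 2 * a ≡ 1ℤ - e → -1ℤ * (y * e - s) - 1ℤ ≡ ℤ.+ 2 * (x * e - a)
    entry s a e eq = trans (ring₃ x s a e) (trans (cong (λ z → z + (ℤ.+ 2 * x * e + e - 1ℤ - ℤ.+ 2 * a)) eq) (ring₄ x a e))
      where
      ring₃ : ∀ x s a e → -1ℤ * ((- (ℤ.+ 2 * x) - 1ℤ) * e - s) - 1ℤ ≡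
        s + ℤ.+ 2 * a + (ℤ.+ 2 * x * e + e - 1ℤ - ℤ.+ 2 * a)
      ring₃ = solve-∀
      ring₄ : ∀ x a e → 1ℤ - e + (ℤ.+ 2 * x * e + e - 1ℤ - ℤ.+ 2 * a) ≡ ℤ.+ 2 * (x * e - a)
      ring₄ = solve-∀
  columnSums : ∀ j → sum (λ i → B i j) ≡ β
  columnSums j = begin
    sum (λ i → -1ℤ * (y * identity n i j - S i j))
      ≡⟨ sum-cong-≗ (λ i → trans (cong₂ (λ e s → -1ℤ * (y * e - s)) (identity-sym i j) (symmetric i j))
           (ring₅ y (identity n j i) (S j i))) ⟩
    sum (λ i → - y * (identity n j i * 1ℤ) + 1ℤ * S j i)
      ≡⟨ sum-linear (- y) 1ℤ (λ i → identity n j i * 1ℤ) (S j) ⟩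
    - y * sum (λ i → identity n j i * 1ℤ) + 1ℤ * sum (S j)
      ≡⟨ cong₂ (λ p q → - y * p + 1ℤ * q) (sum-identity j (const 1ℤ)) (rowSums j) ⟩
    - y * 1ℤ + 1ℤ * (-1ℤ - ℤ.+ 2 * κ)
      ≡⟨ ring₆ x κ ⟩
    β ∎
    where
    ring₅ : ∀ y e s → -1ℤ * (y * e - s) ≡ - y * (e * 1ℤ) + 1ℤ * s
    ring₅ = solve-∀
    ring₆ : ∀ x κ → - (- (ℤ.+ 2 * x) - 1ℤ) * 1ℤ + 1ℤ * (-1ℤ - ℤ.+ 2 * κ) ≡ ℤ.+ 2 * (x - κ)
    ring₆ = solve-∀

-- A progression with one parameter left out still has points arbitrarily far from `x`. The
-- parameter chosen exceeds |c|, which keeps it away from `c`, and outweighs the offset of `x` from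
-- `b`.
congruent-extendAffine : ∀ {f g} → Congruent f → Congruent g → ∀ a b → a ≢ 0ℤ → ∀ c →
  (∀ t → t ≢ c → f (a * t + b) ≡ g (a * t + b)) → ∀ x → f x ≡ g x
congruent-extendAffine {f} {g} F G a b a≢0 c agree x = congruent-extend F G x λ N →
  let m = N ℕ.+ ∣ x - b ∣ ℕ.+ ∣ c ∣
      t = ℤ.+ suc m
      t≢c : t ≢ c
      t≢c t≡c = ℕ.<⇒≢ (ℕ.s≤s (ℕ.m≤n+m ∣ c ∣ (N ℕ.+ ∣ x - b ∣))) (sym (cong ∣_∣ t≡c))
      far : N ℕ.+ ∣ x - b ∣ ℕ.≤ ∣ x - (a * t + b) ∣ ℕ.+ ∣ x - b ∣
      far = ℕ.≤-trans (ℕ.≤-trans (ℕ.m≤m+n (N ℕ.+ ∣ x - b ∣) ∣ c ∣) (ℕ.n≤1+n m))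
        (ℕ.≤-trans (ℕ.m≤n*m (suc m) ∣ a ∣ ⦃ ℤ.≢-nonZero a≢0 ⦄)
          (ℕ.≤-trans (ℕ.≤-reflexive (sym (trans (ℤ.∣i-j∣≡∣j-i∣ (x - b) (x - (a * t + b)))
              (trans (cong ∣_∣ (ring x a t b)) (trans (ℤ.∣-i∣≡∣i∣ (a * t)) (ℤ.abs-* a t))))))
            (ℕ.≤-trans (ℤ.∣i-j∣≤∣i∣+∣j∣ (x - b) (x - (a * t + b)))
              (ℕ.≤-reflexive (ℕ.+-comm (∣ x - b ∣) (∣ x - (a * t + b) ∣))))))
  in a * t + b , ℕ.+-cancelʳ-≤ (∣ x - b ∣) N (∣ x - (a * t + b) ∣) far , agree t t≢c
  where
  ring : ∀ x a t b → x - (a * t + b) - (x - b) ≡ - (a * t)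
  ring = solve-∀

congruent-spectralPolynomial : ∀ σ → Congruent (spectralPolynomial σ)
congruent-spectralPolynomial []            = congruent-const 1ℤ
congruent-spectralPolynomial ((θ , m) ∷ σ) = congruent-*
  (congruent-^ m (congruent-- congruent-id (congruent-const θ))) (congruent-spectralPolynomial σ)

-- On eigenvectors orthogonal to the all-ones vector, θ for A becomes -1 - 2θ for S; thus 2 becomes
-- -5. The all-ones vector has k for A and -1 - 2κ for S, hence `m₂` on the graph side and `suc m₂`
-- on the Seidel side.
module Transfer (m₁ m₂ m₃ : ℕ) (k κ μ : ℤ) where

  graphSpectrum seidelSpectrum : Spectrum
  graphSpectrum  = [ k ]^ 1 ∷ [ ℤ.+ 2 ]^ m₁ ∷ [ κ ]^ m₂ ∷ [ μ ]^ m₃ ∷ []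
  seidelSpectrum = [ - ℤ.+ 5 ]^ m₁ ∷ [ -1ℤ - ℤ.+ 2 * κ ]^ suc m₂ ∷ [ -1ℤ - ℤ.+ 2 * μ ]^ m₃ ∷ []

  common : ℤ → ℤ
  common x = (x - ℤ.+ 2) ^ m₁ * ((x - κ) ^ m₂ * ((x - μ) ^ m₃ * 1ℤ))

  seidelPolynomial-substitute : ∀ x → spectralPolynomial seidelSpectrum (- (ℤ.+ 2 * x) - 1ℤ) ≡
    (- ℤ.+ 2) ^ (m₁ ℕ.+ suc m₂ ℕ.+ m₃) * ((x - κ) * common x)
  seidelPolynomial-substitute x = begin
    (y - - ℤ.+ 5) ^ m₁ * ((y - (-1ℤ - ℤ.+ 2 * κ)) ^ suc m₂ * ((y - (-1ℤ - ℤ.+ 2 * μ)) ^ m₃ * 1ℤ))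
      ≡⟨ cong₂ (λ p q → p ^ m₁ * q) (ring₁ x) (cong₂ (λ p q → p ^ suc m₂ * (q ^ m₃ * 1ℤ)) (ring₂ x κ) (ring₂ x μ)) ⟩
    (- ℤ.+ 2 * (x - ℤ.+ 2)) ^ m₁ * ((- ℤ.+ 2 * (x - κ)) ^ suc m₂ * ((- ℤ.+ 2 * (x - μ)) ^ m₃ * 1ℤ))
      ≡⟨ cong₂ _*_ (*-distribʳ-^ (- ℤ.+ 2) (x - ℤ.+ 2) m₁)
           (cong₂ (λ p q → p * (q * 1ℤ)) (*-distribʳ-^ (- ℤ.+ 2) (x - κ) (suc m₂)) (*-distribʳ-^ (- ℤ.+ 2) (x - μ) m₃)) ⟩
    p₁ * a * (p₂ * ((x - κ) * b) * (p₃ * c * 1ℤ))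
      ≡⟨ ring₃ p₁ p₂ p₃ (x - κ) a b c ⟩
    p₁ * p₂ * p₃ * ((x - κ) * (a * (b * (c * 1ℤ))))
      ≡⟨ cong (_* ((x - κ) * common x)) (trans (ℤ.^-distribˡ-+-* (- ℤ.+ 2) (m₁ ℕ.+ suc m₂) m₃)
           (cong (_* p₃) (ℤ.^-distribˡ-+-* (- ℤ.+ 2) m₁ (suc m₂)))) ⟨
    (- ℤ.+ 2) ^ (m₁ ℕ.+ suc m₂ ℕ.+ m₃) * ((x - κ) * common x) ∎
    where
    y p₁ p₂ p₃ a b c : ℤ
    y = - (ℤ.+ 2 * x) - 1ℤ
    p₁ = (- ℤ.+ 2) ^ m₁
    p₂ = (- ℤ.+ 2) ^ suc m₂
    p₃ = (- ℤ.+ 2) ^ m₃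
    a = (x - ℤ.+ 2) ^ m₁
    b = (x - κ) ^ m₂
    c = (x - μ) ^ m₃
    ring₁ : ∀ x → - (ℤ.+ 2 * x) - 1ℤ - - ℤ.+ 5 ≡ - ℤ.+ 2 * (x - ℤ.+ 2)
    ring₁ = solve-∀
    ring₂ : ∀ x κ → - (ℤ.+ 2 * x) - 1ℤ - (-1ℤ - ℤ.+ 2 * κ) ≡ - ℤ.+ 2 * (x - κ)
    ring₂ = solve-∀
    ring₃ : ∀ p q r k a b c → p * a * (q * (k * b) * (r * c * 1ℤ)) ≡ p * q * r * (k * (a * (b * (c * 1ℤ))))
    ring₃ = solve-∀

  graphPolynomial : ∀ x → spectralPolynomial graphSpectrum x ≡ (x - k) * common x
  graphPolynomial x = cong (_* common x) (ℤ.^-identityʳ (x - k))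

  module _ {n} {S A : Matrix n} (symmetric : Symmetric S)
    (S+2A : ∀ i j → S i j + ℤ.+ 2 * A i j ≡ 1ℤ - identity n i j)
    (rowSums : ∀ i → sum (S i) ≡ -1ℤ - ℤ.+ 2 * κ) (n≡ : ℤ.+ n ≡ ℤ.+ 2 * (k - κ))
    (n≡Σ : n ≡ m₁ ℕ.+ suc m₂ ℕ.+ m₃) where

    transfer : ∀ x → (x - κ) * ((- ℤ.+ 2) ^ n * charPoly A x) ≡ (x - k) * charPoly S (- (ℤ.+ 2 * x) - 1ℤ)
    transfer = charPoly-transfer S A k κ symmetric S+2A rowSums n≡

    substitute : ∀ x → spectralPolynomial seidelSpectrum (- (ℤ.+ 2 * x) - 1ℤ) ≡ (- ℤ.+ 2) ^ n * ((x - κ) * common x)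
    substitute x = trans (seidelPolynomial-substitute x)
      (cong (λ m → (- ℤ.+ 2) ^ m * ((x - κ) * common x)) (sym n≡Σ))

    x-a≢0 : ∀ {x a} → x ≢ a → x - a ≢ 0ℤ
    x-a≢0 {x} {a} x≢a x-a≡0 = x≢a (ℤ.i-j≡0⇒i≡j x a x-a≡0)

    seidelSpectrum⇒graphSpectrum : HasSpectrum S seidelSpectrum → HasSpectrum A graphSpectrum
    seidelSpectrum⇒graphSpectrum hasSpectrum x = trans
      (congruent-extendAffine (congruent-charPoly A)
        (congruent-* (congruent-- congruent-id (congruent-const k)) congruent-common)
        1ℤ 0ℤ (λ ()) κ (λ t t≢κ → subst (λ x → charPoly A x ≡ (x - k) * common x) (ring t) (agree t t≢κ)) x)
      (sym (graphPolynomial x))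
      where
      congruent-common : Congruent common
      congruent-common = congruent-spectralPolynomial ([ ℤ.+ 2 ]^ m₁ ∷ [ κ ]^ m₂ ∷ [ μ ]^ m₃ ∷ [])
      ring : ∀ t → t ≡ 1ℤ * t + 0ℤ
      ring = solve-∀
      -- At x = κ the transfer relation reads 0 = 0 and nothing can be cancelled.
      agree : ∀ x → x ≢ κ → charPoly A x ≡ (x - k) * common x
      agree x x≢κ = ℤ.*-cancelˡ-≡ ((x - κ) * p) (charPoly A x) ((x - k) * common x)
        ⦃ ℤ.i*j≢0 (x - κ) p ⦃ ℤ.≢-nonZero (x-a≢0 x≢κ) ⦄ ⦃ ^-nonZero (- ℤ.+ 2) n ⦄ ⦄ (begin
          (x - κ) * p * charPoly A x                        ≡⟨ ℤ.*-assoc (x - κ) p (charPoly A x) ⟩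
          (x - κ) * (p * charPoly A x)                      ≡⟨ transfer x ⟩
          (x - k) * charPoly S (- (ℤ.+ 2 * x) - 1ℤ)
            ≡⟨ cong ((x - k) *_) (trans (hasSpectrum (- (ℤ.+ 2 * x) - 1ℤ)) (substitute x)) ⟩
          (x - k) * (p * ((x - κ) * common x))              ≡⟨ ring′ (x - k) p (x - κ) (common x) ⟩
          (x - κ) * p * ((x - k) * common x)                ∎)
        where
        p : ℤ
        p = (- ℤ.+ 2) ^ n
        ring′ : ∀ a p b c → a * (p * (b * c)) ≡ b * p * (a * c)
        ring′ = solve-∀

    graphSpectrum⇒seidelSpectrum : HasSpectrum A graphSpectrum → HasSpectrum S seidelSpectrum
    -- The argument -2t - 1 is always odd; congruence supplies the even points as well as the one
    -- excluded by t = k.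
    graphSpectrum⇒seidelSpectrum hasSpectrum = congruent-extendAffine (congruent-charPoly S)
      (congruent-spectralPolynomial seidelSpectrum) (- ℤ.+ 2) -1ℤ (λ ()) k
      λ t t≢k → subst (λ x → charPoly S x ≡ spectralPolynomial seidelSpectrum x) (ring t) (agree t t≢k)
      where
      ring : ∀ t → - (ℤ.+ 2 * t) - 1ℤ ≡ - ℤ.+ 2 * t + -1ℤ
      ring = solve-∀
      agree : ∀ x → x ≢ k → charPoly S (- (ℤ.+ 2 * x) - 1ℤ) ≡ spectralPolynomial seidelSpectrum (- (ℤ.+ 2 * x) - 1ℤ)
      agree x x≢k = ℤ.*-cancelˡ-≡ (x - k) (charPoly S (- (ℤ.+ 2 * x) - 1ℤ))
        (spectralPolynomial seidelSpectrum (- (ℤ.+ 2 * x) - 1ℤ)) ⦃ ℤ.≢-nonZero (x-a≢0 x≢k) ⦄ (begin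
          (x - k) * charPoly S (- (ℤ.+ 2 * x) - 1ℤ)          ≡⟨ transfer x ⟨
          (x - κ) * (p * charPoly A x)
            ≡⟨ cong (λ c → (x - κ) * (p * c)) (trans (hasSpectrum x) (graphPolynomial x)) ⟩
          (x - κ) * (p * ((x - k) * common x))               ≡⟨ ring′ (x - κ) p (x - k) (common x) ⟩
          (x - k) * (p * ((x - κ) * common x))               ≡⟨ cong ((x - k) *_) (substitute x) ⟨
          (x - k) * spectralPolynomial seidelSpectrum (- (ℤ.+ 2 * x) - 1ℤ) ∎)
        where
        p : ℤ
        p = (- ℤ.+ 2) ^ n
        ring′ : ∀ a p b c → a * (p * (b * c)) ≡ b * (p * (a * c))
        ring′ = solve-∀

-- Tight frames

-- For c > 0 the rows divided by the square root of c form a tight frame whose Gram matrix is `P`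
-- itself.
record Frame {n} (P : Matrix n) (t c : ℤ) : Set where
  field
    diagonal  : ∀ i → P i i ≡ t
    gram      : ∀ i j → dot (P i) (P j) ≡ c * P i j
    parity    : Σ[ d ∈ Vector ℤ n ] Σ[ e ∈ Matrix n ] ∀ i j → P i j ≡ t + d i + d j + ℤ.+ 2 * e i j

data Span {n} (P : Matrix n) : Vector ℤ n → Set where
  row     : ∀ i → Span P (P i)
  combine : ∀ a b {u v} → Span P u → Span P v → Span P (λ k → a * u k + b * v k)

-- Integer combinations of rows produce a multiple `r` of the sign vector; the factor cancels in the
-- eigenvector equation.
SignVector : ∀ {n} → Matrix n → Set
SignVector {n} P = Σ[ x ∈ Vector ℤ n ] (∀ i → x i * x i ≡ 1ℤ) ×
  ∃[ r ] r ≢ 0ℤ × Σ[ v ∈ Vector ℤ n ] Span P v × ∀ k → v k ≡ r * x k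

square-roots : ∀ {a r} → a * a ≡ r * r → a ≡ r ⊎ a ≡ - r
square-roots {a} {r} a²≡r² with ℤ.i*j≡0⇒i≡0∨j≡0 (a - r) (trans (ring a r) (ℤ.i≡j⇒i-j≡0 a²≡r²))
  where
  ring : ∀ a r → (a - r) * (a + r) ≡ a * a - r * r
  ring = solve-∀
... | inj₁ a-r≡0 = inj₁ (ℤ.i-j≡0⇒i≡j a r a-r≡0)
... | inj₂ a+r≡0 = inj₂ (ℤ.i-j≡0⇒i≡j a (- r) (trans (cong (a +_) (ℤ.neg-involutive r)) a+r≡0))

signVector : ∀ {n} {P : Matrix n} r → r ≢ 0ℤ → ∀ {v} → Span P v → (∀ k → v k * v k ≡ r * r) → SignVector P
signVector r r≢0 {v} span squares = (λ k → proj₁ (sign k)) , (λ k → proj₁ (proj₂ (sign k))) ,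
  r , r≢0 , v , span , λ k → proj₂ (proj₂ (sign k))
  where
  sign : ∀ k → ∃[ s ] s * s ≡ 1ℤ × v k ≡ r * s
  sign k with square-roots {v k} {r} (squares k)
  ... | inj₁ v≡r  = 1ℤ , refl , trans v≡r (sym (ℤ.*-identityʳ r))
  ... | inj₂ v≡-r = -1ℤ , refl , trans v≡-r (ring r)
    where
    ring : ∀ r → - r ≡ r * -1ℤ
    ring = solve-∀

even : ∀ {a} q → a ≡ ℤ.+ 2 * q → ∣ a ∣ ℕ.% 2 ≡ 0
even q refl = trans (cong (ℕ._% 2) (trans (ℤ.abs-* (ℤ.+ 2) q) (ℕ.*-comm 2 ∣ q ∣))) (m*n%n≡0 ∣ q ∣ 2)

-- Inner products in units of `c`, so that rows i and j have inner product `P i j`. As a record, its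
-- arguments can be read off from the type.
record Inner {n} (c : ℤ) (u v : Vector ℤ n) (q : ℤ) : Set where
  constructor inner
  field
    value : dot u v ≡ c * q

inner-comm : ∀ {n c} {u v : Vector ℤ n} {q} → Inner c u v q → Inner c v u q
inner-comm {u = u} {v} (inner uv) = inner (trans (dot-comm v u) uv)

inner-combine : ∀ {n c} a b {u v w : Vector ℤ n} {p q} → Inner c u w p → Inner c v w q →
  Inner c (λ k → a * u k + b * v k) w (a * p + b * q)
inner-combine {c = c} a b {u} {v} {w} {p} {q} (inner uw) (inner vw) = inner
  (trans (dot-linear a b u v w) (trans (cong₂ (λ x y → a * x + b * y) uw vw) (ring a b c p q)))
  where
  ring : ∀ a b c p q → a * (c * p) + b * (c * q) ≡ c * (a * p + b * q)
  ring = solve-∀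

norm-combine : ∀ {n c} a b {u v : Vector ℤ n} {p q r} → Inner c u u p → Inner c u v q → Inner c v v r →
  Inner c (λ k → a * u k + b * v k) (λ k → a * u k + b * v k) (a * (a * p + b * q) + b * (a * q + b * r))
norm-combine a b uu uv vv = inner-combine a b
  (inner-comm (inner-combine a b uu (inner-comm uv)))
  (inner-comm (inner-combine a b uv vv))

module FrameProperties {n} {P : Matrix n} {t c : ℤ} (frame : Frame P t c)
  (0<t : 0ℤ ℤ.< t) (0<c : 0ℤ ℤ.< c) where

  open Frame frame

  triple-parity : ∀ i j k → ∣ P i j + P i k + P j k - t ∣ ℕ.% 2 ≡ 0
  triple-parity i j k with parity
  ... | d , e , P≡ = even (t + (d i + d j + d k) + (e i j + e i k + e j k)) (trans
    (cong₂ (λ x y → x + y - t) (cong₂ _+_ (P≡ i j) (P≡ i k)) (P≡ j k))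
    (ring t (d i) (d j) (d k) (e i j) (e i k) (e j k)))
    where
    ring : ∀ t a b c x y z → (t + a + b + ℤ.+ 2 * x) + (t + a + c + ℤ.+ 2 * y) + (t + b + c + ℤ.+ 2 * z) - t
      ≡ ℤ.+ 2 * (t + (a + b + c) + (x + y + z))
    ring = solve-∀

  -- `P` is `c` times a projection, so pairing with row `k` reads off coordinate `k`.
  reproducing : ∀ {u} → Span P u → ∀ k → Inner c u (P k) (u k)
  reproducing (row i)             k = inner (gram i k)
  reproducing (combine a b su sv) k = inner-combine a b (reproducing su k) (reproducing sv k)

  norm-row : ∀ i → Inner c (P i) (P i) t
  norm-row i = inner (trans (gram i i) (cong (c *_) (diagonal i)))

  -- A coordinate is an inner product with a row of norm t. The bound is the nonnegative norm of t·u
  -- - uₖ·Pₖ, divided by ct.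
  cauchy : ∀ {u q} → Span P u → Inner c u u q → ∀ k → u k * u k ℤ.≤ t * q
  cauchy {u} {q} span norm k = ℤ.0≤i-j⇒j≤i (ℤ.*-cancelˡ-≤-pos 0ℤ (t * q - u k * u k) (c * t) bound)
    where
    instance
      positive : ℤ.Positive (c * t)
      positive = ℤ.positive (subst (ℤ._< c * t) (ℤ.*-zeroʳ c) (ℤ.*-monoˡ-<-pos c ⦃ ℤ.positive 0<c ⦄ 0<t))
    ring : ∀ c t q u → c * (t * (t * q + - u * u) + - u * (t * u + - u * t)) ≡ c * t * (t * q - u * u)
    ring = solve-∀
    bound : c * t * 0ℤ ℤ.≤ c * t * (t * q - u k * u k)
    bound = subst₂ ℤ._≤_ (sym (ℤ.*-zeroʳ (c * t)))
      (trans (Inner.value (norm-combine t (- u k) norm (reproducing span k) (norm-row k))) (ring c t q (u k)))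
      (dot-nonNegative λ j → t * u j + - u k * P k j)

  -- Since s² = 1, `e` is the inner product of row i with s times row j.
  norm-difference : ∀ i j s e → s * s ≡ 1ℤ → P i j ≡ s * e →
    let w = λ k → 1ℤ * P i k + - s * P j k in Inner c w w (ℤ.+ 2 * (t - e))
  norm-difference i j s e s²≡1 Pij≡ = subst (Inner c w w)
    (trans (cong (λ p → 1ℤ * (1ℤ * t + - s * p) + - s * (1ℤ * p + - s * t)) Pij≡)
      (trans (ring s e t) (trans (cong (λ y → t + y * (t - ℤ.+ 2 * e)) s²≡1) (ring′ e t))))
    (norm-combine 1ℤ (- s) (norm-row i) (inner (gram i j)) (norm-row j))
    where
    w : Vector ℤ n
    w k = 1ℤ * P i k + - s * P j k
    ring : ∀ s e t → 1ℤ * (1ℤ * t + - s * (s * e)) + - s * (1ℤ * (s * e) + - s * t) ≡ t + s * s * (t - ℤ.+ 2 * e)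
    ring = solve-∀
    ring′ : ∀ e t → t + 1ℤ * (t - ℤ.+ 2 * e) ≡ ℤ.+ 2 * (t - e)
    ring′ = solve-∀

  span-difference : ∀ i j s → Span P (λ k → 1ℤ * P i k + - s * P j k)
  span-difference i j s = combine 1ℤ (- s) (row i) (row j)

  bounded : ∀ i j → P i j * P i j ℤ.≤ t * t
  bounded i = cauchy (row i) (norm-row i)

sum-all : ∀ {n N} {f : Vector ℤ n} a → ℤ.+ n ≡ N → (∀ k → f k ≡ a) → sum f ≡ N * a
sum-all {n} a n≡N f≡a = trans (sum-cong-≗ f≡a) (trans (sum-const n a) (cong (_* a) n≡N))

inhabitant : ∀ {n} N → ℤ.+ n ≡ ℤ.+ suc N → Fin n
inhabitant {suc n} N _ = zero

-- Finite checks on the entries of a frame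

-- The integers from -3 to 3, the possible entries of a frame with t ≤ 3; the claims on entries are
-- decided by exhausting them.
val : Fin 7 → ℤ
val f = ℤ.+ toℕ f - ℤ.+ 3

4+n-large : ∀ n → ¬ (ℤ.+ (4 ℕ.+ n)) * (ℤ.+ (4 ℕ.+ n)) ℤ.≤ ℤ.+ 9
4+n-large n (ℤ.+≤+ le) = ℕ.<⇒≱ (ℕ.m≤m+n 10 6) (ℕ.≤-trans (ℕ.*-mono-≤ (ℕ.m≤m+n 4 n) (ℕ.m≤m+n 4 n)) le)

square-≤9 : ∀ p → p * p ℤ.≤ ℤ.+ 9 → ∃[ f ] p ≡ val f
square-≤9 (ℤ.+ 0) _ = suc (suc (suc zero)) , refl
square-≤9 (ℤ.+ 1) _ = suc (suc (suc (suc zero))) , refl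
square-≤9 (ℤ.+ 2) _ = suc (suc (suc (suc (suc zero)))) , refl
square-≤9 (ℤ.+ 3) _ = suc (suc (suc (suc (suc (suc zero))))) , refl
square-≤9 (ℤ.+ suc (suc (suc (suc n)))) p²≤9 = contradiction p²≤9 (4+n-large n)
square-≤9 ℤ.-[1+ 0 ] _ = suc (suc zero) , refl
square-≤9 ℤ.-[1+ 1 ] _ = suc zero , refl
square-≤9 ℤ.-[1+ 2 ] _ = zero , refl
square-≤9 ℤ.-[1+ suc (suc (suc n)) ] p²≤9 = contradiction p²≤9 (4+n-large n)

oddVal : Fin 4 → ℤ
oddVal f = ℤ.+ 2 * ℤ.+ toℕ f - ℤ.+ 3

Odd : ℤ → Set
Odd p = p * p ≡ 1ℤ ⊎ p * p ≡ ℤ.+ 9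

odd-value : ∀ {p} → Odd p → ∃[ f ] p ≡ oddVal f
odd-value {p} (inj₁ p²≡1) with square-roots {p} {1ℤ} p²≡1
... | inj₁ p≡1  = suc (suc zero) , p≡1
... | inj₂ p≡-1 = suc zero , p≡-1
odd-value {p} (inj₂ p²≡9) with square-roots {p} {ℤ.+ 3} p²≡9
... | inj₁ p≡3  = suc (suc (suc zero)) , p≡3
... | inj₂ p≡-3 = zero , p≡-3

-- By parity a - sb is odd, and its square is at most 4.
norm2-adjacent : ∀ s a b → s * s ≡ 1ℤ → s * s ℤ.≤ ℤ.+ 9 → a * a ℤ.≤ ℤ.+ 9 → b * b ℤ.≤ ℤ.+ 9 →
  ∣ s + a + b - ℤ.+ 2 ∣ ℕ.% 2 ≡ 0 → (1ℤ * a + - s * b) * (1ℤ * a + - s * b) ℤ.≤ ℤ.+ 4 →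
  (1ℤ * a + - s * b) * (1ℤ * a + - s * b) ≡ 1ℤ
norm2-adjacent s a b s²≡1 s≤ a≤ b≤ with square-≤9 s s≤ | square-≤9 a a≤ | square-≤9 b b≤
... | f , refl | g , refl | h , refl = check f g h s²≡1
  where
  check : ∀ f g h → let s = val f ; a = val g ; b = val h in s * s ≡ 1ℤ →
    ∣ s + a + b - ℤ.+ 2 ∣ ℕ.% 2 ≡ 0 → (1ℤ * a + - s * b) * (1ℤ * a + - s * b) ℤ.≤ ℤ.+ 4 →
    (1ℤ * a + - s * b) * (1ℤ * a + - s * b) ≡ 1ℤ
  check = toWitness {a? = all? λ f → all? λ g → all? λ h → (_ ℤ.≟ _) →-dec (_ ℕ.≟ _) →-dec (_ ℤ.≤? _) →-dec (_ ℤ.≟ _)} _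

norm2-entry : ∀ a → a * a ℤ.≤ ℤ.+ 4 → a * a ≢ 1ℤ → a ≢ 0ℤ → a * a ≡ ℤ.+ 4
norm2-entry a a≤ with square-≤9 a (ℤ.≤-trans a≤ (ℤ.+≤+ (ℕ.m≤m+n 4 5)))
... | f , refl = check f a≤
  where
  check : ∀ f → val f * val f ℤ.≤ ℤ.+ 4 → val f * val f ≢ 1ℤ → val f ≢ 0ℤ → val f * val f ≡ ℤ.+ 4
  check = toWitness {a? = all? λ f → (_ ℤ.≤? _) →-dec ¬? (_ ℤ.≟ _) →-dec ¬? (_ ℤ.≟ _) →-dec (_ ℤ.≟ _)} _

-- The three numbers are 0 or ±2, so their sum is even, and an even square up to 12 is at most 4.
norm2-sum : ∀ a b c → a * a ℤ.≤ ℤ.+ 4 → b * b ℤ.≤ ℤ.+ 4 → c * c ℤ.≤ ℤ.+ 4 →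
  a * a ≢ 1ℤ → b * b ≢ 1ℤ → c * c ≢ 1ℤ →
  (1ℤ * a + 1ℤ * (1ℤ * b + 1ℤ * c)) * (1ℤ * a + 1ℤ * (1ℤ * b + 1ℤ * c)) ℤ.≤ ℤ.+ 12 →
  (1ℤ * a + 1ℤ * (1ℤ * b + 1ℤ * c)) * (1ℤ * a + 1ℤ * (1ℤ * b + 1ℤ * c)) ℤ.≤ ℤ.+ 4
norm2-sum a b c a≤ b≤ c≤ with square-≤9 a (ℤ.≤-trans a≤ (ℤ.+≤+ (ℕ.m≤m+n 4 5)))
  | square-≤9 b (ℤ.≤-trans b≤ (ℤ.+≤+ (ℕ.m≤m+n 4 5))) | square-≤9 c (ℤ.≤-trans c≤ (ℤ.+≤+ (ℕ.m≤m+n 4 5)))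
... | f , refl | g , refl | h , refl = check f g h a≤ b≤ c≤
  where
  check : ∀ f g h → let a = val f ; b = val g ; c = val h in
    a * a ℤ.≤ ℤ.+ 4 → b * b ℤ.≤ ℤ.+ 4 → c * c ℤ.≤ ℤ.+ 4 → a * a ≢ 1ℤ → b * b ≢ 1ℤ → c * c ≢ 1ℤ →
    (1ℤ * a + 1ℤ * (1ℤ * b + 1ℤ * c)) * (1ℤ * a + 1ℤ * (1ℤ * b + 1ℤ * c)) ℤ.≤ ℤ.+ 12 →
    (1ℤ * a + 1ℤ * (1ℤ * b + 1ℤ * c)) * (1ℤ * a + 1ℤ * (1ℤ * b + 1ℤ * c)) ℤ.≤ ℤ.+ 4
  check = toWitness {a? = all? λ f → all? λ g → all? λ h →
    (_ ℤ.≤? _) →-dec (_ ℤ.≤? _) →-dec (_ ℤ.≤? _) →-dec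
    ¬? (_ ℤ.≟ _) →-dec ¬? (_ ℤ.≟ _) →-dec ¬? (_ ℤ.≟ _) →-dec (_ ℤ.≤? _) →-dec (_ ℤ.≤? _)} _

-- The inner product 2s is even, so a and b have opposite parity and a - sb is odd with square at
-- most 6.
norm3-even : ∀ s a b → s * s ≡ 1ℤ → s * s ℤ.≤ ℤ.+ 9 → a * a ℤ.≤ ℤ.+ 9 → b * b ℤ.≤ ℤ.+ 9 →
  ∣ ℤ.+ 2 * s + a + b - ℤ.+ 3 ∣ ℕ.% 2 ≡ 0 → (1ℤ * a + - s * b) * (1ℤ * a + - s * b) ℤ.≤ ℤ.+ 6 →
  (1ℤ * a + - s * b) * (1ℤ * a + - s * b) ≡ 1ℤ
norm3-even s a b s²≡1 s≤ a≤ b≤ with square-≤9 s s≤ | square-≤9 a a≤ | square-≤9 b b≤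
... | f , refl | g , refl | h , refl = check f g h s²≡1
  where
  check : ∀ f g h → let s = val f ; a = val g ; b = val h in s * s ≡ 1ℤ →
    ∣ ℤ.+ 2 * s + a + b - ℤ.+ 3 ∣ ℕ.% 2 ≡ 0 → (1ℤ * a + - s * b) * (1ℤ * a + - s * b) ℤ.≤ ℤ.+ 6 →
    (1ℤ * a + - s * b) * (1ℤ * a + - s * b) ≡ 1ℤ
  check = toWitness {a? = all? λ f → all? λ g → all? λ h → (_ ℤ.≟ _) →-dec (_ ℕ.≟ _) →-dec (_ ℤ.≤? _) →-dec (_ ℤ.≟ _)} _

-- Here a and b have equal parity, so a - sb is even with square at most 12.
norm3-odd : ∀ s a b → s * s ≡ 1ℤ → s * s ℤ.≤ ℤ.+ 9 → a * a ℤ.≤ ℤ.+ 9 → b * b ℤ.≤ ℤ.+ 9 →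
  ∣ s + a + b - ℤ.+ 3 ∣ ℕ.% 2 ≡ 0 → (1ℤ * a + - s * b) * (1ℤ * a + - s * b) ℤ.≤ ℤ.+ 12 →
  (1ℤ * a + - s * b) * (1ℤ * a + - s * b) ℤ.≤ ℤ.+ 4
norm3-odd s a b s²≡1 s≤ a≤ b≤ with square-≤9 s s≤ | square-≤9 a a≤ | square-≤9 b b≤
... | f , refl | g , refl | h , refl = check f g h s²≡1
  where
  check : ∀ f g h → let s = val f ; a = val g ; b = val h in s * s ≡ 1ℤ →
    ∣ s + a + b - ℤ.+ 3 ∣ ℕ.% 2 ≡ 0 → (1ℤ * a + - s * b) * (1ℤ * a + - s * b) ℤ.≤ ℤ.+ 12 →
    (1ℤ * a + - s * b) * (1ℤ * a + - s * b) ℤ.≤ ℤ.+ 4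
  check = toWitness {a? = all? λ f → all? λ g → all? λ h → (_ ℤ.≟ _) →-dec (_ ℕ.≟ _) →-dec (_ ℤ.≤? _) →-dec (_ ℤ.≤? _)} _

-- Only 0 and ±3 remain, and a + b is odd, so exactly one of the two is ±3.
norm3-orthogonal : ∀ a b → a * a ℤ.≤ ℤ.+ 9 → b * b ℤ.≤ ℤ.+ 9 → ∣ 0ℤ + a + b - ℤ.+ 3 ∣ ℕ.% 2 ≡ 0 →
  a * a ≢ 1ℤ → b * b ≢ 1ℤ → a * a ≢ ℤ.+ 4 → b * b ≢ ℤ.+ 4 → a * a + b * b ≡ ℤ.+ 9
norm3-orthogonal a b a≤ b≤ with square-≤9 a a≤ | square-≤9 b b≤
... | f , refl | g , refl = check f g
  where
  check : ∀ f g → let a = val f ; b = val g in ∣ 0ℤ + a + b - ℤ.+ 3 ∣ ℕ.% 2 ≡ 0 →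
    a * a ≢ 1ℤ → b * b ≢ 1ℤ → a * a ≢ ℤ.+ 4 → b * b ≢ ℤ.+ 4 → a * a + b * b ≡ ℤ.+ 9
  check = toWitness {a? = all? λ f → all? λ g → (_ ℕ.≟ _) →-dec ¬? (_ ℤ.≟ _) →-dec ¬? (_ ℤ.≟ _) →-dec
    ¬? (_ ℤ.≟ _) →-dec ¬? (_ ℤ.≟ _) →-dec (_ ℤ.≟ _)} _

norm3-entry : ∀ a → a * a ℤ.≤ ℤ.+ 9 → a * a ≢ 1ℤ → a * a ≢ ℤ.+ 4 → a ≢ 0ℤ → a * a ≡ ℤ.+ 9
norm3-entry a a≤ with square-≤9 a a≤
... | f , refl = check f
  where
  check : ∀ f → val f * val f ≢ 1ℤ → val f * val f ≢ ℤ.+ 4 → val f ≢ 0ℤ → val f * val f ≡ ℤ.+ 9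
  check = toWitness {a? = all? λ f → ¬? (_ ℤ.≟ _) →-dec ¬? (_ ℤ.≟ _) →-dec ¬? (_ ℤ.≟ _) →-dec (_ ℤ.≟ _)} _

norm3-parity : ∀ a → a * a ℤ.≤ ℤ.+ 9 → ∣ a ∣ ℕ.% 2 ≢ 0 → Odd a
norm3-parity a a≤ with square-≤9 a a≤
... | f , refl = check f
  where
  check : ∀ f → ∣ val f ∣ ℕ.% 2 ≢ 0 → Odd (val f)
  check = toWitness {a? = all? λ f → ¬? (_ ℕ.≟ _) →-dec ((_ ℤ.≟ _) ⊎-dec (_ ℤ.≟ _))} _

-- Exactly one of a and b is odd, and squares are 1 or 0 modulo 4 accordingly. The quotient is below
-- 4 because a² + b² ≤ 9 + 4.
norm3-squares : ∀ s a b → s * s ℤ.≤ ℤ.+ 9 → a * a ℤ.≤ ℤ.+ 9 → b * b ℤ.≤ ℤ.+ 9 →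
  ∣ s ∣ ℕ.% 2 ≡ 0 → ∣ s + a + b - ℤ.+ 3 ∣ ℕ.% 2 ≡ 0 →
  Σ[ q ∈ Fin 4 ] a * a + b * b ≡ 1ℤ + ℤ.+ 4 * ℤ.+ toℕ q
norm3-squares s a b s≤ a≤ b≤ with square-≤9 s s≤ | square-≤9 a a≤ | square-≤9 b b≤
... | f , refl | g , refl | h , refl = check f g h
  where
  check : ∀ f g h → let s = val f ; a = val g ; b = val h in
    ∣ s ∣ ℕ.% 2 ≡ 0 → ∣ s + a + b - ℤ.+ 3 ∣ ℕ.% 2 ≡ 0 →
    Σ[ q ∈ Fin 4 ] a * a + b * b ≡ 1ℤ + ℤ.+ 4 * ℤ.+ toℕ q
  check = toWitness {a? = all? λ f → all? λ g → all? λ h → (_ ℕ.≟ _) →-dec (_ ℕ.≟ _) →-dec (any? λ q → _ ℤ.≟ _)} _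

-- 2p² + 2q² - (p + q)² = (p - q)² is at least 4 for distinct odd numbers; p = q = ±3 violates the
-- bound 24.
odd-pair : ∀ {p q} → Odd p → Odd q → ¬ (p * p ≡ 1ℤ × q ≡ p) →
  (1ℤ * p + 1ℤ * q) * (1ℤ * p + 1ℤ * q) ℤ.≤ ℤ.+ 24 →
  (1ℤ * p + 1ℤ * q) * (1ℤ * p + 1ℤ * q) ℤ.≤ ℤ.+ 2 * (p * p) + (ℤ.+ 2 * (q * q) - ℤ.+ 4)
odd-pair {p} {q} p-odd q-odd with odd-value {p} p-odd | odd-value {q} q-odd
... | f , refl | g , refl = check f g
  where
  check : ∀ f g → let p = oddVal f ; q = oddVal g in ¬ (p * p ≡ 1ℤ × q ≡ p) →
    (1ℤ * p + 1ℤ * q) * (1ℤ * p + 1ℤ * q) ℤ.≤ ℤ.+ 24 →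
    (1ℤ * p + 1ℤ * q) * (1ℤ * p + 1ℤ * q) ℤ.≤ ℤ.+ 2 * (p * p) + (ℤ.+ 2 * (q * q) - ℤ.+ 4)
  check = toWitness {a? = all? λ f → all? λ g → ¬? ((_ ℤ.≟ _) ×-dec (_ ℤ.≟ _)) →-dec (_ ℤ.≤? _) →-dec (_ ℤ.≤? _)} _

-- 3(p² + q² + r²) - s² is the sum of the three squared differences. Unless all three numbers agree,
-- two of these are at least 4; three equal values ±3 violate the bound 45.
odd-triple : ∀ {p q r} → Odd p → Odd q → Odd r → ¬ (p * p ≡ 1ℤ × q ≡ p × r ≡ p) →
  let s = 1ℤ * p + 1ℤ * (1ℤ * q + 1ℤ * r) in s * s ℤ.≤ ℤ.+ 45 →
  s * s ℤ.≤ ℤ.+ 3 * (p * p) + (ℤ.+ 3 * (q * q) + (ℤ.+ 3 * (r * r) - ℤ.+ 8))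
odd-triple {p} {q} {r} p-odd q-odd r-odd with odd-value {p} p-odd | odd-value {q} q-odd | odd-value {r} r-odd
... | f , refl | g , refl | h , refl = check f g h
  where
  check : ∀ f g h → let p = oddVal f ; q = oddVal g ; r = oddVal h in ¬ (p * p ≡ 1ℤ × q ≡ p × r ≡ p) →
    let s = 1ℤ * p + 1ℤ * (1ℤ * q + 1ℤ * r) in s * s ℤ.≤ ℤ.+ 45 →
    s * s ℤ.≤ ℤ.+ 3 * (p * p) + (ℤ.+ 3 * (q * q) + (ℤ.+ 3 * (r * r) - ℤ.+ 8))
  check = toWitness {a? = all? λ f → all? λ g → all? λ h →
    ¬? ((_ ℤ.≟ _) ×-dec (_ ℤ.≟ _) ×-dec (_ ℤ.≟ _)) →-dec (_ ℤ.≤? _) →-dec (_ ℤ.≤? _)} _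

-- What the Cauchy-Schwarz inequality gives for the inner products p and q of a vector of norm 3
-- with two vectors of norm 3 and inner product 1.
Near : ℤ → ℤ → Set
Near p q = (1ℤ * p + 1ℤ * q) * (1ℤ * p + 1ℤ * q) ℤ.≤ ℤ.+ 24 × (1ℤ * p + -1ℤ * q) * (1ℤ * p + -1ℤ * q) ℤ.≤ ℤ.+ 12

near? : ∀ p q → Dec (Near p q)
near? p q = (_ ℤ.≤? _) ×-dec (_ ℤ.≤? _)

quadrupleSum : ℤ → ℤ → ℤ → ℤ → ℤ
quadrupleSum p q r o = 1ℤ * p + 1ℤ * (1ℤ * q + 1ℤ * (1ℤ * r + 1ℤ * o))

quadrupleBound : ℤ → ℤ → ℤ → ℤ → ℤ
quadrupleBound p q r o =
  ℤ.+ 9 * (p * p) + (ℤ.+ 9 * (q * q) + (ℤ.+ 9 * (r * r) + (ℤ.+ 9 * (o * o) - ℤ.+ 36)))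

-- `Near` allows at most one ±3, and then the others are ±1 of the same sign. Up to sign and order,
-- equality holds only for (3, 1, 1, 1) with s = 6 and (1, 1, -1, -1) with s = 0.
odd-quadruple : ∀ {p q r o} → Odd p → Odd q → Odd r → Odd o →
  Near p q → Near p r → Near p o → Near q r → Near q o → Near r o →
  let s = quadrupleSum p q r o in
  quadrupleBound p q r o ℤ.≤ ℤ.+ 2 * (s * s) ×
  (quadrupleBound p q r o ≡ ℤ.+ 2 * (s * s) → (ℤ.+ 3 * p + -1ℤ * s) * (ℤ.+ 3 * p + -1ℤ * s) ≡ ℤ.+ 9)
odd-quadruple {p} {q} {r} {o} p-odd q-odd r-odd o-odd with odd-value {p} p-odd | odd-value {q} q-odd | odd-value {r} r-odd | odd-value {o} o-odd
... | f , refl | g , refl | h , refl | l , refl = check f g h l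
  where
  check : ∀ f g h l → let p = oddVal f ; q = oddVal g ; r = oddVal h ; o = oddVal l in
    Near p q → Near p r → Near p o → Near q r → Near q o → Near r o →
    let s = quadrupleSum p q r o in
    quadrupleBound p q r o ℤ.≤ ℤ.+ 2 * (s * s) ×
    (quadrupleBound p q r o ≡ ℤ.+ 2 * (s * s) → (ℤ.+ 3 * p + -1ℤ * s) * (ℤ.+ 3 * p + -1ℤ * s) ≡ ℤ.+ 9)
  check = toWitness {a? = all? λ f → all? λ g → all? λ h → all? λ l →
    near? (oddVal f) (oddVal g) →-dec near? (oddVal f) (oddVal h) →-dec near? (oddVal f) (oddVal l) →-dec
    near? (oddVal g) (oddVal h) →-dec near? (oddVal g) (oddVal l) →-dec near? (oddVal h) (oddVal l) →-dec
    ((_ ℤ.≤? _) ×-dec ((_ ℤ.≟ _) →-dec (_ ℤ.≟ _)))} _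

-- Two rows with inner product s = ±1 would have Pᵢ - sPⱼ with all entries ±1, of norm 60 instead of 80.
-- So any two rows are parallel or orthogonal, and three orthogonal ones add up to entries ±2.
signVector-norm2 : ∀ {n} {P : Matrix n} → Frame P (ℤ.+ 2) (ℤ.+ 40) → ℤ.+ n ≡ ℤ.+ 60 → SignVector P
signVector-norm2 {n} {P} frame n≡60 = orthogonal (any? λ j → P a j ℤ.≟ 0ℤ)
  where
  open Frame frame
  open FrameProperties frame (ℤ.+<+ (ℕ.s≤s ℕ.z≤n)) (ℤ.+<+ (ℕ.s≤s ℕ.z≤n))
  a : Fin n
  a = inhabitant 59 n≡60
  ≤9 : ∀ i j → P i j * P i j ℤ.≤ ℤ.+ 9
  ≤9 i j = ℤ.≤-trans (bounded i j) (ℤ.+≤+ (ℕ.m≤m+n 4 5))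
  no-unit : ∀ i j → P i j * P i j ≢ 1ℤ
  no-unit i j unit = contradiction
    (trans (sym (sum-all 1ℤ n≡60 λ k → norm2-adjacent (P i j) (P i k) (P j k) unit (≤9 i j) (≤9 i k) (≤9 j k)
        (triple-parity i j k) (cauchy (span-difference i j (P i j)) norm k)))
      (Inner.value norm))
    λ ()
    where
    norm : let w = λ k → 1ℤ * P i k + - P i j * P j k in Inner (ℤ.+ 40) w w (ℤ.+ 2)
    norm = norm-difference i j (P i j) 1ℤ unit (sym (ℤ.*-identityʳ (P i j)))
  finish : ∀ b c → P a b ≡ 0ℤ → P a c ≡ 0ℤ → P b c ≡ 0ℤ → SignVector P
  -- The sum of squares is 6 · 40 = 4 · 60, so the bound 4 is attained in every column.
  finish b c ab ac bc = signVector (ℤ.+ 2) (λ ()) span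
    (sum-mono-≡ {g = const (ℤ.+ 4)}
      (λ k → norm2-sum (P a k) (P b k) (P c k) (bounded a k) (bounded b k) (bounded c k)
        (no-unit a k) (no-unit b k) (no-unit c k) (cauchy span norm k))
      (ℤ.≤-reflexive (trans (sum-all (ℤ.+ 4) n≡60 λ k → refl) (sym (Inner.value norm)))))
    where
    u : Vector ℤ n
    u k = 1ℤ * P a k + 1ℤ * (1ℤ * P b k + 1ℤ * P c k)
    span : Span P u
    span = combine 1ℤ 1ℤ (row a) (combine 1ℤ 1ℤ (row b) (row c))
    orthogonal-rows : ∀ i j → P i j ≡ 0ℤ → Inner (ℤ.+ 40) (P i) (P j) 0ℤ
    orthogonal-rows i j ij = inner (trans (gram i j) (cong (ℤ.+ 40 *_) ij))
    norm : Inner (ℤ.+ 40) u u (ℤ.+ 6)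
    norm = norm-combine 1ℤ 1ℤ (norm-row a)
      (inner-comm (inner-combine 1ℤ 1ℤ (inner-comm (orthogonal-rows a b ab)) (inner-comm (orthogonal-rows a c ac))))
      (norm-combine 1ℤ 1ℤ (norm-row b) (orthogonal-rows b c bc) (norm-row c))
  orthogonalPair : ∀ b → P a b ≡ 0ℤ → Dec (∃[ c ] P a c ≡ 0ℤ × P b c ≡ 0ℤ) → SignVector P
  orthogonalPair b ab (yes (c , ac , bc)) = finish b c ab ac bc
  -- Every column would have an entry ±2 in row a or row b, giving 4 · 60 ≤ 80 + 80.
  orthogonalPair b ab (no none) = contradiction
    (subst₂ ℤ._≤_ (sum-all (ℤ.+ 4) n≡60 λ k → refl) sums (sum-mono-≤ {f = const (ℤ.+ 4)} large))
    λ { (ℤ.+≤+ le) → ℕ.<⇒≱ (ℕ.m≤m+n 161 79) le }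
    where
    sums : sum (λ k → P a k * P a k + P b k * P b k) ≡ ℤ.+ 160
    sums = trans (∑-distrib-+ (λ k → P a k * P a k) λ k → P b k * P b k)
      (cong₂ _+_ (Inner.value (norm-row a)) (Inner.value (norm-row b)))
    large : ∀ k → ℤ.+ 4 ℤ.≤ P a k * P a k + P b k * P b k
    large k = nonZero (P a k ℤ.≟ 0ℤ) (P b k ℤ.≟ 0ℤ)
      where
      nonZero : Dec (P a k ≡ 0ℤ) → Dec (P b k ≡ 0ℤ) → ℤ.+ 4 ℤ.≤ P a k * P a k + P b k * P b k
      nonZero (yes ak) (yes bk) = contradiction (k , ak , bk) none
      nonZero (no ak)  _        = ℤ.+-mono-≤ (ℤ.≤-reflexive (sym (norm2-entry (P a k) (bounded a k) (no-unit a k) ak)))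
        (square-nonNegative (P b k))
      nonZero _        (no bk)  = ℤ.+-mono-≤ (square-nonNegative (P a k))
        (ℤ.≤-reflexive (sym (norm2-entry (P b k) (bounded b k) (no-unit b k) bk)))
  orthogonal : Dec (∃[ j ] P a j ≡ 0ℤ) → SignVector P
  orthogonal (yes (b , ab)) = orthogonalPair b ab (any? λ c → (P a c ℤ.≟ 0ℤ) ×-dec (P b c ℤ.≟ 0ℤ))
  orthogonal (no none) = contradiction
    (trans (sym (sum-all (ℤ.+ 4) n≡60 λ k → norm2-entry (P a k) (bounded a k) (no-unit a k) λ ak → none (k , ak)))
      (Inner.value (norm-row a)))
    λ ()

-- Rows with inner product 2s = ±2 would have Pᵢ - sPⱼ with all entries ±1, of norm 72 instead of 144.
-- If some inner product is s = ±1, then Pᵢ - sPⱼ has entries 0 and ±2 and norm 288 = 4 · 72, so no entry is 0.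
-- Otherwise two orthogonal rows would have supports partitioning the columns.
signVector-norm3 : ∀ {n} {P : Matrix n} → Frame P (ℤ.+ 3) (ℤ.+ 72) → ℤ.+ n ≡ ℤ.+ 72 → SignVector P
signVector-norm3 {n} {P} frame n≡72 = decide (any? λ i → any? λ j → P i j * P i j ℤ.≟ 1ℤ)
  where
  open Frame frame
  open FrameProperties frame (ℤ.+<+ (ℕ.s≤s ℕ.z≤n)) (ℤ.+<+ (ℕ.s≤s ℕ.z≤n))
  a : Fin n
  a = inhabitant 71 n≡72
  no-two : ∀ i j s → s * s ≡ 1ℤ → P i j ≢ ℤ.+ 2 * s
  no-two i j s s²≡1 Pij≡ = contradiction
    (trans (sym (sum-all 1ℤ n≡72 λ k → norm3-even s (P i k) (P j k) s²≡1
        (subst (ℤ._≤ ℤ.+ 9) (sym s²≡1) (ℤ.+≤+ (ℕ.m≤m+n 1 8))) (bounded i k) (bounded j k)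
        (subst (λ p → ∣ p + P i k + P j k - ℤ.+ 3 ∣ ℕ.% 2 ≡ 0) Pij≡ (triple-parity i j k))
        (cauchy (span-difference i j s) norm k)))
      (Inner.value norm))
    λ ()
    where
    norm : let w = λ k → 1ℤ * P i k + - s * P j k in Inner (ℤ.+ 72) w w (ℤ.+ 2)
    norm = norm-difference i j s (ℤ.+ 2) s²≡1 (trans Pij≡ (ℤ.*-comm (ℤ.+ 2) s))
  not-four : ∀ i j → P i j * P i j ≢ ℤ.+ 4
  not-four i j four with square-roots {P i j} {ℤ.+ 2} four
  ... | inj₁ two  = no-two i j 1ℤ refl two
  ... | inj₂ -two = no-two i j -1ℤ refl -two
  decide : Dec (∃[ i ] ∃[ j ] P i j * P i j ≡ 1ℤ) → SignVector P
  decide (yes (i , j , unit)) = signVector (ℤ.+ 2) (λ ()) span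
    (sum-mono-≡ {g = const (ℤ.+ 4)}
      (λ k → norm3-odd (P i j) (P i k) (P j k) unit (bounded i j) (bounded i k) (bounded j k)
        (triple-parity i j k) (cauchy span norm k))
      (ℤ.≤-reflexive (trans (sum-all (ℤ.+ 4) n≡72 λ k → refl) (sym (Inner.value norm)))))
    where
    span = span-difference i j (P i j)
    norm : let w = λ k → 1ℤ * P i k + - P i j * P j k in Inner (ℤ.+ 72) w w (ℤ.+ 4)
    norm = norm-difference i j (P i j) 1ℤ unit (sym (ℤ.*-identityʳ (P i j)))
  decide (no none) = orthogonal (any? λ j → P a j ℤ.≟ 0ℤ)
    where
    no-unit : ∀ i j → P i j * P i j ≢ 1ℤ
    no-unit i j unit = none (i , j , unit)
    orthogonal : Dec (∃[ j ] P a j ≡ 0ℤ) → SignVector P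
    -- Entries ±3 throughout would give 9 · 72 instead of 3 · 72; with an orthogonal row b, the two
    -- rows together would give 9 · 72 instead of 6 · 72.
    orthogonal (no none) = contradiction
      (trans (sym (sum-all (ℤ.+ 9) n≡72 λ k →
          norm3-entry (P a k) (bounded a k) (no-unit a k) (not-four a k) λ ak → none (k , ak)))
        (Inner.value (norm-row a)))
      λ ()
    orthogonal (yes (b , ab)) = contradiction
      (trans (sym (sum-all (ℤ.+ 9) n≡72 λ k → norm3-orthogonal (P a k) (P b k) (bounded a k) (bounded b k)
          (subst (λ p → ∣ p + P a k + P b k - ℤ.+ 3 ∣ ℕ.% 2 ≡ 0) ab (triple-parity a b k))
          (no-unit a k) (no-unit b k) (not-four a k) (not-four b k)))
        (trans (∑-distrib-+ (λ k → P a k * P a k) λ k → P b k * P b k)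
          (cong₂ _+_ (Inner.value (norm-row a)) (Inner.value (norm-row b)))))
      λ ()

-- Up to sign there are four rows with all mutual inner products 1. The entries at their own multiples
-- exhaust the norm of their sum s, so 3u - s has entries ±3 for any one u of the four.
signVector-norm3′ : ∀ {n} {P : Matrix n} → Frame P (ℤ.+ 3) (ℤ.+ 54) → ℤ.+ n ≡ ℤ.+ 90 → SignVector P
signVector-norm3′ {n} {P} frame n≡90 = second (any? λ j → P a j * P a j ℤ.≟ 1ℤ)
  where
  open Frame frame
  open FrameProperties frame (ℤ.+<+ (ℕ.s≤s ℕ.z≤n)) (ℤ.+<+ (ℕ.s≤s ℕ.z≤n))
  a : Fin n
  a = inhabitant 89 n≡90

  -- With an even entry, every column of rows i and j would contribute 1 modulo 4, making 2 · 3 · 54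
  -- = 324 congruent to 90 modulo 4.
  entry-odd : ∀ i j → Odd (P i j)
  entry-odd i j = norm3-parity (P i j) (bounded i j) λ even-ij →
    let q : ∀ k → Σ[ q ∈ Fin 4 ] P i k * P i k + P j k * P j k ≡ 1ℤ + ℤ.+ 4 * ℤ.+ toℕ q
        q k = norm3-squares (P i j) (P i k) (P j k) (bounded i j) (bounded i k) (bounded j k)
          even-ij (triple-parity i j k)
        Q = sum λ k → ℤ.+ toℕ (proj₁ (q k))
        total : ℤ.+ 324 ≡ ℤ.+ 90 * 1ℤ + ℤ.+ 4 * Q
        total = begin
          ℤ.+ 324
            ≡⟨ cong₂ _+_ (Inner.value (norm-row i)) (Inner.value (norm-row j)) ⟨
          dot (P i) (P i) + dot (P j) (P j)
            ≡⟨ ∑-distrib-+ (λ k → P i k * P i k) (λ k → P j k * P j k) ⟨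
          sum (λ k → P i k * P i k + P j k * P j k)
            ≡⟨ sum-cong-≗ (λ k → proj₂ (q k)) ⟩
          sum (λ k → 1ℤ + ℤ.+ 4 * ℤ.+ toℕ (proj₁ (q k)))
            ≡⟨ ∑-distrib-+ (const 1ℤ) (λ k → ℤ.+ 4 * ℤ.+ toℕ (proj₁ (q k))) ⟩
          sum {n} (const 1ℤ) + sum (λ k → ℤ.+ 4 * ℤ.+ toℕ (proj₁ (q k)))
            ≡⟨ cong₂ _+_ (sum-all 1ℤ n≡90 λ k → refl) (sym (*-distribˡ-sum (ℤ.+ 4) λ k → ℤ.+ toℕ (proj₁ (q k)))) ⟩
          ℤ.+ 90 * 1ℤ + ℤ.+ 4 * Q ∎
    in contradiction (cong (ℕ._% 4) (trans (cong (λ y → ∣ y - ℤ.+ 90 ∣) total) (trans (cong ∣_∣ (ring Q)) (ℤ.abs-* Q (ℤ.+ 4)))))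
         λ eq → contradiction (trans eq (m*n%n≡0 ∣ Q ∣ 4)) λ ()
    where
    ring : ∀ Q → ℤ.+ 90 * 1ℤ + ℤ.+ 4 * Q - ℤ.+ 90 ≡ Q * ℤ.+ 4
    ring = solve-∀

  square-scale : ∀ {s} p → s * s ≡ 1ℤ → s * p * (s * p) ≡ p * p
  square-scale {s} p s²≡1 = trans (ring s p) (trans (cong (_* (p * p)) s²≡1) (ℤ.*-identityˡ (p * p)))
    where
    ring : ∀ s p → s * p * (s * p) ≡ s * s * (p * p)
    ring = solve-∀

  record SignedRow (u : Vector ℤ n) : Set where
    field
      span  : Span P u
      norm  : Inner (ℤ.+ 54) u u (ℤ.+ 3)
      odd   : ∀ k → Odd (u k)

  unsignedRow : ∀ i → SignedRow (P i)
  unsignedRow i = record { span = row i ; norm = norm-row i ; odd = entry-odd i }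

  -- The summand with coefficient 0 gives the vector the shape produced by `combine`.
  signed : ℤ → Fin n → Vector ℤ n
  signed s i k = s * P i k + 0ℤ * P i k

  signed≡ : ∀ s i k → signed s i k ≡ s * P i k
  signed≡ s i k = ℤ.+-identityʳ (s * P i k)

  signedRow : ∀ s i → s * s ≡ 1ℤ → SignedRow (signed s i)
  signedRow s i s²≡1 = record
    { span = combine s 0ℤ (row i) (row i)
    ; norm = subst (Inner (ℤ.+ 54) (signed s i) (signed s i)) (trans (ring s) (cong (_* ℤ.+ 3) s²≡1))
        (norm-combine s 0ℤ (norm-row i) (norm-row i) (norm-row i))
    ; odd  = λ k → subst Odd (sym (signed≡ s i k)) (odd-scale (P i k) (entry-odd i k))
    }
    where
    ring : ∀ s → s * (s * ℤ.+ 3 + 0ℤ * ℤ.+ 3) + 0ℤ * (s * ℤ.+ 3 + 0ℤ * ℤ.+ 3) ≡ s * s * ℤ.+ 3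
    ring = solve-∀
    odd-scale : ∀ p → Odd p → Odd (s * p)
    odd-scale p (inj₁ p²≡1) = inj₁ (trans (square-scale {s} p s²≡1) p²≡1)
    odd-scale p (inj₂ p²≡9) = inj₂ (trans (square-scale {s} p s²≡1) p²≡9)

  -- Pairing `u` with row `i` gives `u i`, so the sign `u i` normalises it to (u i)² = 1. A column
  -- in which several vectors share one unit entry thus extends all of them at once.
  signed-inner : ∀ {u} → SignedRow u → ∀ i → u i * u i ≡ 1ℤ → Inner (ℤ.+ 54) u (signed (u i) i) 1ℤ
  signed-inner {u} line i unit = subst (Inner (ℤ.+ 54) u (signed (u i) i))
    (trans (ℤ.+-identityʳ (u i * u i)) unit)
    (inner-comm (inner-combine (u i) 0ℤ (inner-comm (reproducing (SignedRow.span line) i))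
      (inner-comm (reproducing (SignedRow.span line) i))))

  near : ∀ {u v} → SignedRow u → SignedRow v → Inner (ℤ.+ 54) u v 1ℤ → ∀ k → Near (u k) (v k)
  near U V uv k =
    cauchy (combine 1ℤ 1ℤ (SignedRow.span U) (SignedRow.span V)) (norm-combine 1ℤ 1ℤ (SignedRow.norm U) uv (SignedRow.norm V)) k ,
    cauchy (combine 1ℤ -1ℤ (SignedRow.span U) (SignedRow.span V)) (norm-combine 1ℤ -1ℤ (SignedRow.norm U) uv (SignedRow.norm V)) k

  squares-sum : ∀ {u} → SignedRow u → ∀ m (f : Vector ℤ n) {s} → sum f ≡ s →
    sum (λ k → m * (u k * u k) + f k) ≡ m * ℤ.+ 162 + s
  squares-sum {u} line m f f≡ = trans (∑-distrib-+ (λ k → m * (u k * u k)) f)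
    (cong₂ _+_ (trans (sym (*-distribˡ-sum m λ k → u k * u k)) (cong (m *_) (Inner.value (SignedRow.norm line)))) f≡)

  squares-last : ∀ {u} → SignedRow u → ∀ m e → sum (λ k → m * (u k * u k) - e) ≡ m * ℤ.+ 162 - ℤ.+ 90 * e
  squares-last {u} line m e = trans (sum-- (λ k → m * (u k * u k)) (const e))
    (cong₂ _-_ (trans (sym (*-distribˡ-sum m λ k → u k * u k)) (cong (m *_) (Inner.value (SignedRow.norm line))))
      (sum-all e n≡90 λ k → refl))

  finish : ∀ {u v w y} → SignedRow u → SignedRow v → SignedRow w → SignedRow y →
    Inner (ℤ.+ 54) u v 1ℤ → Inner (ℤ.+ 54) u w 1ℤ → Inner (ℤ.+ 54) u y 1ℤ →
    Inner (ℤ.+ 54) v w 1ℤ → Inner (ℤ.+ 54) v y 1ℤ → Inner (ℤ.+ 54) w y 1ℤ → SignVector P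
  finish {u} {v} {w} {y} U V W Y uv uw uy vw vy wy = signVector (ℤ.+ 3) (λ ())
    (combine (ℤ.+ 3) -1ℤ (SignedRow.span U) span)
    λ k → proj₂ (check k) (tight k)
    where
    s : Vector ℤ n
    s k = quadrupleSum (u k) (v k) (w k) (y k)
    span : Span P s
    span = combine 1ℤ 1ℤ (SignedRow.span U) (combine 1ℤ 1ℤ (SignedRow.span V) (combine 1ℤ 1ℤ (SignedRow.span W) (SignedRow.span Y)))
    pair : ∀ {u v w q r} → Inner (ℤ.+ 54) u v q → Inner (ℤ.+ 54) u w r →
      Inner (ℤ.+ 54) u (λ k → 1ℤ * v k + 1ℤ * w k) (1ℤ * q + 1ℤ * r)
    pair uv uw = inner-comm (inner-combine 1ℤ 1ℤ (inner-comm uv) (inner-comm uw))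
    norm : Inner (ℤ.+ 54) s s (ℤ.+ 24)
    norm = norm-combine 1ℤ 1ℤ (SignedRow.norm U) (pair uv (pair uw uy))
      (norm-combine 1ℤ 1ℤ (SignedRow.norm V) (pair vw vy) (norm-combine 1ℤ 1ℤ (SignedRow.norm W) wy (SignedRow.norm Y)))
    bound : Vector ℤ n
    bound k = quadrupleBound (u k) (v k) (w k) (y k)
    check : ∀ k → bound k ℤ.≤ ℤ.+ 2 * (s k * s k) ×
      (bound k ≡ ℤ.+ 2 * (s k * s k) → (ℤ.+ 3 * u k + -1ℤ * s k) * (ℤ.+ 3 * u k + -1ℤ * s k) ≡ ℤ.+ 9)
    check k = odd-quadruple {u k} {v k} {w k} {y k} (SignedRow.odd U k) (SignedRow.odd V k) (SignedRow.odd W k) (SignedRow.odd Y k)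
      (near U V uv k) (near U W uw k) (near U Y uy k) (near V W vw k) (near V Y vy k) (near W Y wy k)
    tight : ∀ k → bound k ≡ ℤ.+ 2 * (s k * s k)
    -- Both totals are 2592: 2 · 24 · 54 on one side, 9 · 4 · 162 - 36 · 90 on the other.
    tight = sum-mono-≡ (λ k → proj₁ (check k)) (ℤ.≤-reflexive (trans
      (trans (sym (*-distribˡ-sum (ℤ.+ 2) λ k → s k * s k)) (cong (ℤ.+ 2 *_) (Inner.value norm)))
      (sym (squares-sum U (ℤ.+ 9) (λ k → ℤ.+ 9 * (v k * v k) + (ℤ.+ 9 * (w k * w k) + (ℤ.+ 9 * (y k * y k) - ℤ.+ 36)))
        (squares-sum V (ℤ.+ 9) (λ k → ℤ.+ 9 * (w k * w k) + (ℤ.+ 9 * (y k * y k) - ℤ.+ 36))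
          (squares-sum W (ℤ.+ 9) (λ k → ℤ.+ 9 * (y k * y k) - ℤ.+ 36) (squares-last Y (ℤ.+ 9) (ℤ.+ 36))))))))

  fourth : ∀ {u v w} → SignedRow u → SignedRow v → SignedRow w →
    Inner (ℤ.+ 54) u v 1ℤ → Inner (ℤ.+ 54) u w 1ℤ → Inner (ℤ.+ 54) v w 1ℤ →
    Dec (∃[ d ] u d * u d ≡ 1ℤ × v d ≡ u d × w d ≡ u d) → SignVector P
  fourth {u} {v} {w} U V W uv uw vw (yes (d , unit , vd≡ud , wd≡ud)) =
    finish U V W (signedRow (u d) d unit) uv uw (signed-inner U d unit) vw
      (subst (λ x → Inner (ℤ.+ 54) v (signed x d) 1ℤ) vd≡ud (signed-inner V d (trans (cong (λ x → x * x) vd≡ud) unit)))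
      (subst (λ x → Inner (ℤ.+ 54) w (signed x d) 1ℤ) wd≡ud (signed-inner W d (trans (cong (λ x → x * x) wd≡ud) unit)))
  -- Otherwise 15 · 54 = 810 would be at most 9 · 162 - 8 · 90 = 738.
  fourth {u} {v} {w} U V W uv uw vw (no none) = contradiction
    (subst₂ ℤ._≤_ (Inner.value norm)
      (squares-sum U (ℤ.+ 3) (λ k → ℤ.+ 3 * (v k * v k) + (ℤ.+ 3 * (w k * w k) - ℤ.+ 8))
        (squares-sum V (ℤ.+ 3) (λ k → ℤ.+ 3 * (w k * w k) - ℤ.+ 8) (squares-last W (ℤ.+ 3) (ℤ.+ 8))))
      (sum-mono-≤ λ k → odd-triple {u k} {v k} {w k} (SignedRow.odd U k) (SignedRow.odd V k) (SignedRow.odd W k) (λ agree → none (k , agree))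
        (cauchy span norm k)))
    λ { (ℤ.+≤+ le) → ℕ.<⇒≱ (ℕ.m≤m+n 739 71) le }
    where
    span : Span P (λ k → 1ℤ * u k + 1ℤ * (1ℤ * v k + 1ℤ * w k))
    span = combine 1ℤ 1ℤ (SignedRow.span U) (combine 1ℤ 1ℤ (SignedRow.span V) (SignedRow.span W))
    norm : let s = λ k → 1ℤ * u k + 1ℤ * (1ℤ * v k + 1ℤ * w k) in Inner (ℤ.+ 54) s s (ℤ.+ 15)
    norm = norm-combine 1ℤ 1ℤ (SignedRow.norm U)
      (inner-comm (inner-combine 1ℤ 1ℤ (inner-comm uv) (inner-comm uw)))
      (norm-combine 1ℤ 1ℤ (SignedRow.norm V) vw (SignedRow.norm W))

  third : ∀ {u v} → SignedRow u → SignedRow v → Inner (ℤ.+ 54) u v 1ℤ →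
    Dec (∃[ c ] u c * u c ≡ 1ℤ × v c ≡ u c) → SignVector P
  third {u} {v} U V uv (yes (c , unit , vc≡uc)) =
    fourth U V W uv (signed-inner U c unit)
      (subst (λ x → Inner (ℤ.+ 54) v (signed x c) 1ℤ) vc≡uc (signed-inner V c (trans (cong (λ x → x * x) vc≡uc) unit)))
      (any? λ d → (u d * u d ℤ.≟ 1ℤ) ×-dec (v d ℤ.≟ u d) ×-dec (signed (u c) c d ℤ.≟ u d))
    where
    W : SignedRow (signed (u c) c)
    W = signedRow (u c) c unit
  -- Otherwise 8 · 54 = 432 would be at most 4 · 162 - 4 · 90 = 288.
  third {u} {v} U V uv (no none) = contradiction
    (subst₂ ℤ._≤_ (Inner.value norm)
      (squares-sum U (ℤ.+ 2) (λ k → ℤ.+ 2 * (v k * v k) - ℤ.+ 4) (squares-last V (ℤ.+ 2) (ℤ.+ 4)))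
      (sum-mono-≤ λ k → odd-pair {u k} {v k} (SignedRow.odd U k) (SignedRow.odd V k) (λ agree → none (k , agree))
        (cauchy (combine 1ℤ 1ℤ (SignedRow.span U) (SignedRow.span V)) norm k)))
    λ { (ℤ.+≤+ le) → ℕ.<⇒≱ (ℕ.m≤m+n 289 143) le }
    where
    norm : let s = λ k → 1ℤ * u k + 1ℤ * v k in Inner (ℤ.+ 54) s s (ℤ.+ 8)
    norm = norm-combine 1ℤ 1ℤ (SignedRow.norm U) uv (SignedRow.norm V)

  second : Dec (∃[ j ] P a j * P a j ≡ 1ℤ) → SignVector P
  second (yes (b , unit)) = third (unsignedRow a) (signedRow (P a b) b unit) (signed-inner (unsignedRow a) b unit)
    (any? λ c → (P a c * P a c ℤ.≟ 1ℤ) ×-dec (signed (P a b) b c ℤ.≟ P a c))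
  second (no none) = contradiction
    (trans (sym (sum-all (ℤ.+ 9) n≡90 λ k → nine k (entry-odd a k))) (Inner.value (norm-row a))) λ ()
    where
    nine : ∀ k → Odd (P a k) → P a k * P a k ≡ ℤ.+ 9
    nine k (inj₁ unit) = contradiction (k , unit) none
    nine k (inj₂ p²≡9) = p²≡9

-- The frame of a Seidel matrix

module SeidelFrame {n} {S A : Matrix n} (S-symmetric : Symmetric S) (A-symmetric : Symmetric A)
  (A-idempotent : ∀ i j → A i j * A i j ≡ A i j) (A-diagonal : ∀ i → A i i ≡ 0ℤ)
  (S+2A : ∀ i j → S i j + ℤ.+ 2 * A i j ≡ 1ℤ - identity n i j)
  (k κ μ ε : ℤ) (ε²≡1 : ε * ε ≡ 1ℤ) (n≡ : ℤ.+ n ≡ ℤ.+ 2 * (k - κ))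
  (annihilated : ∀ v i →
    shift S (- ℤ.+ 5) (shift S (-1ℤ - ℤ.+ 2 * κ) (shift S (-1ℤ - ℤ.+ 2 * μ) v)) i ≡ 0ℤ) where

  σ τ t c : ℤ
  σ = -1ℤ - ℤ.+ 2 * κ
  τ = -1ℤ - ℤ.+ 2 * μ
  t = ε * (k - κ + ℤ.+ 2 + ℤ.+ 5 * μ)
  c = ε * (ℤ.+ 2 * ((ℤ.+ 2 - κ) * (μ - κ)))

  degree : Vector ℤ n
  degree i = sum (A i)

  common : Matrix n
  common i j = sum λ l → A i l * A j l

  -- The entries of (S + 5)(S - τ)/2 for S = J - I - 2A. Halving stays integral because J²
  -- contributes the even number n = 2(k - κ). Outside the factor 2, i and j enter only through
  -- their degrees, whence the parity rule.
  half : Matrix n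
  half i j = k - κ + ℤ.+ 2 + μ - degree i - degree j +
    ℤ.+ 2 * (common i j - (ℤ.+ 2 + μ) * A i j + ℤ.+ 2 * μ * identity n i j)

  P : Matrix n
  P i j = ε * half i j

  -- M j is column j of (S + 5)(S - τ), and P is ε/2 times that matrix.
  M : Matrix n
  M j = shift S (- ℤ.+ 5) (shift S τ (identity n j))

  S≡ : ∀ i j → S i j ≡ 1ℤ - identity n i j - ℤ.+ 2 * A i j
  S≡ i j = trans (ring (S i j) (A i j)) (cong (_- ℤ.+ 2 * A i j) (S+2A i j))
    where
    ring : ∀ s a → s ≡ s + ℤ.+ 2 * a - ℤ.+ 2 * a
    ring = solve-∀

  M≡ : ∀ j i → M j i ≡ ℤ.+ 2 * half j i
  M≡ j i = begin
    mul S (shift S τ (identity n j)) i - - ℤ.+ 5 * shift S τ (identity n j) i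
      ≡⟨ cong₂ (λ x y → x - - ℤ.+ 5 * y) (sum-cong-≗ λ l → cong₂ _*_ (S≡ i l) (inside l)) (inside i) ⟩
    sum (λ l → (1ℤ - identity n i l - ℤ.+ 2 * A i l) * r l) - - ℤ.+ 5 * r i
      ≡⟨ cong (_- - ℤ.+ 5 * r i) expand ⟩
    1ℤ * (ℤ.+ 2 * (k - κ)) + 1ℤ * (ℤ.+ 2 * μ * 1ℤ + 1ℤ * (- ℤ.+ 2 * degree j + 1ℤ * (-1ℤ * r i + 1ℤ * (- ℤ.+ 2 * degree i
      + 1ℤ * (- ℤ.+ 4 * μ * A i j + ℤ.+ 4 * common i j))))) - - ℤ.+ 5 * r i
      ≡⟨ cong₂ (λ a c → 1ℤ * (ℤ.+ 2 * (k - κ)) + 1ℤ * (ℤ.+ 2 * μ * 1ℤ + 1ℤ * (- ℤ.+ 2 * degree j + 1ℤ * (-1ℤ * r i + 1ℤ * (- ℤ.+ 2 * degree i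
           + 1ℤ * (- ℤ.+ 4 * μ * a + ℤ.+ 4 * c))))) - - ℤ.+ 5 * r i)
           (A-symmetric i j) (sum-cong-≗ λ l → ℤ.*-comm (A i l) (A j l)) ⟩
    1ℤ * (ℤ.+ 2 * (k - κ)) + 1ℤ * (ℤ.+ 2 * μ * 1ℤ + 1ℤ * (- ℤ.+ 2 * degree j + 1ℤ * (-1ℤ * r i + 1ℤ * (- ℤ.+ 2 * degree i
      + 1ℤ * (- ℤ.+ 4 * μ * A j i + ℤ.+ 4 * common j i))))) - - ℤ.+ 5 * r i
      ≡⟨ ring k κ μ (degree i) (degree j) (A j i) (common j i) (identity n j i) ⟩
    ℤ.+ 2 * half j i ∎
    where
    r : Vector ℤ n
    r l = 1ℤ + ℤ.+ 2 * μ * identity n j l - ℤ.+ 2 * A j l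
    inside : ∀ l → shift S τ (identity n j) l ≡ r l
    inside l = begin
      sum (λ m → S l m * identity n j m) - τ * identity n j l
        ≡⟨ cong (_- τ * identity n j l) (trans (sum-cong-≗ λ m → ℤ.*-comm (S l m) (identity n j m)) (sum-identity j (S l))) ⟩
      S l j - τ * identity n j l
        ≡⟨ cong (_- τ * identity n j l) (trans (S-symmetric l j) (S≡ j l)) ⟩
      1ℤ - identity n j l - ℤ.+ 2 * A j l - τ * identity n j l
        ≡⟨ ring₁ μ (identity n j l) (A j l) ⟩
      r l ∎
      where
      ring₁ : ∀ μ e a → 1ℤ - e - ℤ.+ 2 * a - (-1ℤ - ℤ.+ 2 * μ) * e ≡ 1ℤ + ℤ.+ 2 * μ * e - ℤ.+ 2 * a
      ring₁ = solve-∀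
    ring : ∀ k κ μ p q a c e →
      1ℤ * (ℤ.+ 2 * (k - κ)) + 1ℤ * (ℤ.+ 2 * μ * 1ℤ + 1ℤ * (- ℤ.+ 2 * q + 1ℤ * (-1ℤ * (1ℤ + ℤ.+ 2 * μ * e - ℤ.+ 2 * a) + 1ℤ * (- ℤ.+ 2 * p
      + 1ℤ * (- ℤ.+ 4 * μ * a + ℤ.+ 4 * c))))) - - ℤ.+ 5 * (1ℤ + ℤ.+ 2 * μ * e - ℤ.+ 2 * a)
      ≡ ℤ.+ 2 * (k - κ + ℤ.+ 2 + μ - q - p + ℤ.+ 2 * (c - (ℤ.+ 2 + μ) * a + ℤ.+ 2 * μ * e))
    ring = solve-∀
    expand : sum (λ l → (1ℤ - identity n i l - ℤ.+ 2 * A i l) * r l) ≡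
      1ℤ * (ℤ.+ 2 * (k - κ)) + 1ℤ * (ℤ.+ 2 * μ * 1ℤ + 1ℤ * (- ℤ.+ 2 * degree j + 1ℤ * (-1ℤ * r i + 1ℤ * (- ℤ.+ 2 * degree i
      + 1ℤ * (- ℤ.+ 4 * μ * A i j + ℤ.+ 4 * common i j)))))
    expand = trans (sum-cong-≗ λ l → ring₂ μ (identity n i l) (A i l) (identity n j l) (A j l))
      (linear 1ℤ 1ℤ (trans (sum-all 1ℤ n≡ λ l → refl) (ℤ.*-identityʳ (ℤ.+ 2 * (k - κ))))
        (linear (ℤ.+ 2 * μ) 1ℤ (sum-identity j (const 1ℤ))
        (linear (- ℤ.+ 2) 1ℤ {f = A j} refl
        (linear -1ℤ 1ℤ (sum-identity i r)
        (linear (- ℤ.+ 2) 1ℤ {f = A i} refl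
        (linear (- ℤ.+ 4 * μ) (ℤ.+ 4) (sum-identity j (A i)) {g = λ l → A i l * A j l} refl))))))
      where
      linear : ∀ a b {f : Vector ℤ n} {x} → sum f ≡ x → ∀ {g : Vector ℤ n} {y} → sum g ≡ y →
        sum (λ l → a * f l + b * g l) ≡ a * x + b * y
      linear a b {f} f≡ {g} g≡ = trans (sum-linear a b f g) (cong₂ (λ x y → a * x + b * y) f≡ g≡)
      ring₂ : ∀ μ e a e′ a′ → (1ℤ - e - ℤ.+ 2 * a) * (1ℤ + ℤ.+ 2 * μ * e′ - ℤ.+ 2 * a′) ≡
        1ℤ * 1ℤ + 1ℤ * (ℤ.+ 2 * μ * (e′ * 1ℤ) + 1ℤ * (- ℤ.+ 2 * a′
          + 1ℤ * (-1ℤ * (e * (1ℤ + ℤ.+ 2 * μ * e′ - ℤ.+ 2 * a′))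
          + 1ℤ * (- ℤ.+ 2 * a + 1ℤ * (- ℤ.+ 4 * μ * (e′ * a) + ℤ.+ 4 * (a * a′))))))
      ring₂ = solve-∀

  half-symmetric : Symmetric half
  half-symmetric i j = trans
    (cong₂ (λ c x → k - κ + ℤ.+ 2 + μ - degree i - degree j + ℤ.+ 2 * (c + x))
      (cong₂ (λ c a → c - (ℤ.+ 2 + μ) * a) (sum-cong-≗ λ l → ℤ.*-comm (A i l) (A j l)) (A-symmetric i j))
      (cong (ℤ.+ 2 * μ *_) (identity-sym i j)))
    (ring (k - κ + ℤ.+ 2 + μ) (degree i) (degree j)
      (ℤ.+ 2 * (common j i - (ℤ.+ 2 + μ) * A j i + ℤ.+ 2 * μ * identity n j i)))
    where
    ring : ∀ x p q y → x - p - q + y ≡ x - q - p + y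
    ring = solve-∀

  P-diagonal : ∀ i → P i i ≡ t
  P-diagonal i = trans
    (cong₂ (λ c x → ε * (k - κ + ℤ.+ 2 + μ - degree i - degree i + ℤ.+ 2 * (c + x)))
      (cong₂ (λ c a → c - (ℤ.+ 2 + μ) * a) (sum-cong-≗ λ l → A-idempotent i l) (A-diagonal i))
      (cong (ℤ.+ 2 * μ *_) (identity-diagonal i)))
    (ring ε k κ μ (degree i))
    where
    ring : ∀ ε k κ μ d →
      ε * (k - κ + ℤ.+ 2 + μ - d - d + ℤ.+ 2 * (d - (ℤ.+ 2 + μ) * 0ℤ + ℤ.+ 2 * μ * 1ℤ))
      ≡ ε * (k - κ + ℤ.+ 2 + ℤ.+ 5 * μ)
    ring = solve-∀

  -- The factor S - σ completes the annihilating product.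
  M-eigenvector : ∀ j i → shift S σ (M j) i ≡ 0ℤ
  M-eigenvector j i = trans (shift-comm S σ (- ℤ.+ 5) (shift S τ (identity n j)) i) (annihilated (identity n j) i)

  M-shift : ∀ θ j i → shift S θ (M j) i ≡ (σ - θ) * M j i
  M-shift θ j i = trans (ring (mul S (M j) i) σ θ (M j i))
    (trans (cong (_+ (σ - θ) * M j i) (M-eigenvector j i)) (ℤ.+-identityˡ ((σ - θ) * M j i)))
    where
    ring : ∀ m σ θ x → m - θ * x ≡ m - σ * x + (σ - θ) * x
    ring = solve-∀

  -- By self-adjointness both factors of `M i` move over to `M j`, a σ-eigenvector on which they act
  -- as scalars.
  M-gram : ∀ i j → dot (M i) (M j) ≡ (σ - τ) * (σ - - ℤ.+ 5) * M j i
  M-gram i j = begin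
    dot (M i) (M j)
      ≡⟨ shift-selfAdjoint S-symmetric (- ℤ.+ 5) (shift S τ (identity n i)) (M j) ⟩
    dot (shift S τ (identity n i)) (shift S (- ℤ.+ 5) (M j))
      ≡⟨ shift-selfAdjoint S-symmetric τ (identity n i) (shift S (- ℤ.+ 5) (M j)) ⟩
    dot (identity n i) (shift S τ (shift S (- ℤ.+ 5) (M j)))
      ≡⟨ sum-identity i (shift S τ (shift S (- ℤ.+ 5) (M j))) ⟩
    shift S τ (shift S (- ℤ.+ 5) (M j)) i
      ≡⟨ shift-comm S τ (- ℤ.+ 5) (M j) i ⟩
    shift S (- ℤ.+ 5) (shift S τ (M j)) i
      ≡⟨ trans (shift-cong S (- ℤ.+ 5) (λ l → trans (M-shift τ j l) (ring (σ - τ) (M j l))) i)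
           (shift-linear S (- ℤ.+ 5) (σ - τ) 0ℤ (M j) (M j) i) ⟩
    (σ - τ) * shift S (- ℤ.+ 5) (M j) i + 0ℤ * shift S (- ℤ.+ 5) (M j) i
      ≡⟨ trans (ℤ.+-identityʳ ((σ - τ) * shift S (- ℤ.+ 5) (M j) i)) (cong ((σ - τ) *_) (M-shift (- ℤ.+ 5) j i)) ⟩
    (σ - τ) * ((σ - - ℤ.+ 5) * M j i)
      ≡⟨ ℤ.*-assoc (σ - τ) (σ - - ℤ.+ 5) (M j i) ⟨
    (σ - τ) * (σ - - ℤ.+ 5) * M j i ∎
    where
    ring : ∀ a m → a * m ≡ a * m + 0ℤ * m
    ring = solve-∀

  half-gram : ∀ i j → dot (half i) (half j) ≡ ℤ.+ 2 * ((ℤ.+ 2 - κ) * (μ - κ)) * half i j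
  half-gram i j = ℤ.*-cancelˡ-≡ (ℤ.+ 4) (dot (half i) (half j)) (ℤ.+ 2 * ((ℤ.+ 2 - κ) * (μ - κ)) * half i j) (begin
    ℤ.+ 4 * dot (half i) (half j)
      ≡⟨ *-distribˡ-sum (ℤ.+ 4) (λ l → half i l * half j l) ⟩
    sum (λ l → ℤ.+ 4 * (half i l * half j l))
      ≡⟨ sum-cong-≗ (λ l → trans (ring (half i l) (half j l)) (sym (cong₂ _*_ (M≡ i l) (M≡ j l)))) ⟩
    dot (M i) (M j)
      ≡⟨ M-gram i j ⟩
    (σ - τ) * (σ - - ℤ.+ 5) * M j i
      ≡⟨ cong ((σ - τ) * (σ - - ℤ.+ 5) *_) (trans (M≡ j i) (cong (ℤ.+ 2 *_) (half-symmetric j i))) ⟩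
    (σ - τ) * (σ - - ℤ.+ 5) * (ℤ.+ 2 * half i j)
      ≡⟨ ring′ κ μ (half i j) ⟩
    ℤ.+ 4 * (ℤ.+ 2 * ((ℤ.+ 2 - κ) * (μ - κ)) * half i j) ∎)
    where
    ring : ∀ a b → ℤ.+ 4 * (a * b) ≡ ℤ.+ 2 * a * (ℤ.+ 2 * b)
    ring = solve-∀
    ring′ : ∀ κ μ h → (-1ℤ - ℤ.+ 2 * κ - (-1ℤ - ℤ.+ 2 * μ)) * (-1ℤ - ℤ.+ 2 * κ - - ℤ.+ 5) * (ℤ.+ 2 * h)
      ≡ ℤ.+ 4 * (ℤ.+ 2 * ((ℤ.+ 2 - κ) * (μ - κ)) * h)
    ring′ = solve-∀

  P-gram : ∀ i j → dot (P i) (P j) ≡ c * P i j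
  P-gram i j = begin
    sum (λ l → ε * half i l * (ε * half j l))
      ≡⟨ sum-cong-≗ (λ l → ring ε (half i l) (half j l)) ⟩
    sum (λ l → ε * ε * (half i l * half j l))
      ≡⟨ *-distribˡ-sum (ε * ε) (λ l → half i l * half j l) ⟨
    ε * ε * dot (half i) (half j)
      ≡⟨ cong (ε * ε *_) (half-gram i j) ⟩
    ε * ε * (ℤ.+ 2 * ((ℤ.+ 2 - κ) * (μ - κ)) * half i j)
      ≡⟨ ring ε (ℤ.+ 2 * ((ℤ.+ 2 - κ) * (μ - κ))) (half i j) ⟨
    c * P i j ∎
    where
    ring : ∀ e a b → e * a * (e * b) ≡ e * e * (a * b)
    ring = solve-∀

  P-frame : Frame P t c
  P-frame = record
    { diagonal  = P-diagonal
    ; gram      = P-gram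
    ; parity    = (λ i → - ε * degree i) ,
        (λ i j → ε * (common i j - (ℤ.+ 2 + μ) * A i j + ℤ.+ 2 * μ * identity n i j) - ℤ.+ 2 * ε * μ) ,
        λ i j → ring ε k κ μ (degree i) (degree j)
          (common i j - (ℤ.+ 2 + μ) * A i j + ℤ.+ 2 * μ * identity n i j)
    }
    where
    ring : ∀ ε k κ μ p q x → ε * (k - κ + ℤ.+ 2 + μ - p - q + ℤ.+ 2 * x) ≡
      ε * (k - κ + ℤ.+ 2 + ℤ.+ 5 * μ) + - ε * p + - ε * q + ℤ.+ 2 * (ε * x - ℤ.+ 2 * ε * μ)
    ring = solve-∀

  half-eigenvector : ∀ j i → shift S σ (half j) i ≡ 0ℤ
  half-eigenvector j i = ℤ.*-cancelˡ-≡ (ℤ.+ 2) (shift S σ (half j) i) 0ℤ (begin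
    ℤ.+ 2 * shift S σ (half j) i                                 ≡⟨ ring (shift S σ (half j) i) ⟩
    ℤ.+ 2 * shift S σ (half j) i + 0ℤ * shift S σ (half j) i     ≡⟨ shift-linear S σ (ℤ.+ 2) 0ℤ (half j) (half j) i ⟨
    shift S σ (λ l → ℤ.+ 2 * half j l + 0ℤ * half j l) i
      ≡⟨ shift-cong S σ (λ l → trans (M≡ j l) (ring (half j l))) i ⟨
    shift S σ (M j) i                                            ≡⟨ M-eigenvector j i ⟩
    0ℤ                                                           ∎)
    where
    ring : ∀ a → ℤ.+ 2 * a ≡ ℤ.+ 2 * a + 0ℤ * a
    ring = solve-∀

  span-eigenvector : ∀ {v} → Span P v → ∀ i → shift S σ v i ≡ 0ℤ
  span-eigenvector (row j) i = trans
    (trans (shift-cong S σ (λ l → ring ε (half j l)) i) (shift-linear S σ ε 0ℤ (half j) (half j) i))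
    (cong₂ _+_ (trans (cong (ε *_) (half-eigenvector j i)) (ℤ.*-zeroʳ ε)) refl)
    where
    ring : ∀ e a → e * a ≡ e * a + 0ℤ * a
    ring = solve-∀
  span-eigenvector (combine a b {u} {v} U V) i = trans (shift-linear S σ a b u v i)
    (cong₂ _+_ (trans (cong (a *_) (span-eigenvector U i)) (ℤ.*-zeroʳ a))
      (trans (cong (b *_) (span-eigenvector V i)) (ℤ.*-zeroʳ b)))

  signEigenvector : SignVector P → Σ[ x ∈ Vector ℤ n ] (∀ i → x i * x i ≡ 1ℤ) × ∀ i → mul S x i ≡ σ * x i
  signEigenvector (x , x²≡1 , r , r≢0 , v , span , v≡rx) = x , x²≡1 , λ i →
    ℤ.i-j≡0⇒i≡j (mul S x i) (σ * x i) (ℤ.*-cancelˡ-≡ r (shift S σ x i) 0ℤ ⦃ ℤ.≢-nonZero r≢0 ⦄ (begin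
      r * shift S σ x i                              ≡⟨ ring r (shift S σ x i) ⟩
      r * shift S σ x i + 0ℤ * shift S σ x i         ≡⟨ shift-linear S σ r 0ℤ x x i ⟨
      shift S σ (λ l → r * x l + 0ℤ * x l) i         ≡⟨ shift-cong S σ (λ l → trans (v≡rx l) (ring r (x l))) i ⟨
      shift S σ v i                                  ≡⟨ span-eigenvector span i ⟩
      0ℤ                                             ≡⟨ ℤ.*-zeroʳ r ⟨
      r * 0ℤ                                         ∎))
    where
    ring : ∀ r a → r * a ≡ r * a + 0ℤ * a
    ring = solve-∀

-- Seidel matrices and graphs

adjacency-symmetric : ∀ {n} (G : Graph n) → Symmetric (adjacencyMatrix G)
adjacency-symmetric G i j = cong (if_then 1ℤ else 0ℤ) (Graph.symmetric G i j)

adjacency-diagonal : ∀ {n} (G : Graph n) i → adjacencyMatrix G i i ≡ 0ℤ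
adjacency-diagonal G i = cong (if_then 1ℤ else 0ℤ) (Graph.irreflexive G i)

adjacency-idempotent : ∀ {n} (G : Graph n) i j → adjacencyMatrix G i j * adjacencyMatrix G i j ≡ adjacencyMatrix G i j
adjacency-idempotent G i j with Graph.adjacent G i j
... | true  = refl
... | false = refl

isMinusOne : ℤ → Bool
isMinusOne s = ⌊ s ℤ.≟ -1ℤ ⌋

graphOf : ∀ {n} → SeidelMatrix n → Graph n
graphOf S = record
  { adjacent    = λ i j → isMinusOne (matrix i j)
  ; symmetric   = λ i j → cong isMinusOne (symmetric i j)
  ; irreflexive = λ i → cong isMinusOne (diagonal i)
  }
  where open SeidelMatrix S

graphOf-matrix : ∀ {n} (S : SeidelMatrix n) i j →
  SeidelMatrix.matrix S i j + ℤ.+ 2 * adjacencyMatrix (graphOf S) i j ≡ 1ℤ - identity n i j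
graphOf-matrix {n} S i j = entry (i ≟ j) (entries i j)
  where
  open SeidelMatrix S
  value : ∀ {s e} → s + ℤ.+ 2 * (if isMinusOne s then 1ℤ else 0ℤ) ≡ 1ℤ - e → matrix i j ≡ s → identity n i j ≡ e →
    matrix i j + ℤ.+ 2 * adjacencyMatrix (graphOf S) i j ≡ 1ℤ - identity n i j
  value {s} {e} eq m≡s i≡e = trans (cong (λ s → s + ℤ.+ 2 * (if isMinusOne s then 1ℤ else 0ℤ)) m≡s)
    (trans eq (cong (λ e → 1ℤ - e) (sym i≡e)))
  entry : Dec (i ≡ j) → matrix i j ≡ 0ℤ ⊎ matrix i j ≡ 1ℤ ⊎ matrix i j ≡ -1ℤ →
    matrix i j + ℤ.+ 2 * adjacencyMatrix (graphOf S) i j ≡ 1ℤ - identity n i j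
  entry (yes refl) _                = value refl (diagonal i) (identity-diagonal i)
  entry (no i≢j) (inj₁ s≡0)         = contradiction s≡0 (offDiagonal i j i≢j)
  entry (no i≢j) (inj₂ (inj₁ s≡1))  = value refl s≡1 (identity-off i≢j)
  entry (no i≢j) (inj₂ (inj₂ s≡-1)) = value refl s≡-1 (identity-off i≢j)

seidelOf : ∀ {n} → Graph n → SeidelMatrix n
seidelOf {n} G = record
  { matrix      = S
  ; entries     = entries
  ; symmetric   = λ i j → cong₂ (λ e a → 1ℤ - e - ℤ.+ 2 * a) (identity-sym i j) (adjacency-symmetric G i j)
  ; diagonal    = λ i → cong₂ (λ e a → 1ℤ - e - ℤ.+ 2 * a) (identity-diagonal i) (adjacency-diagonal G i)
  ; offDiagonal = offDiagonal
  }
  where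
  S : Matrix n
  S i j = 1ℤ - identity n i j - ℤ.+ 2 * adjacencyMatrix G i j
  off : ∀ {i j} → i ≢ j → S i j ≡ 1ℤ ⊎ S i j ≡ -1ℤ
  off {i} {j} i≢j = sign (Graph.adjacent G i j) refl
    where
    sign : ∀ b → Graph.adjacent G i j ≡ b → S i j ≡ 1ℤ ⊎ S i j ≡ -1ℤ
    sign false adj = inj₁ (cong₂ (λ e b → 1ℤ - e - ℤ.+ 2 * (if b then 1ℤ else 0ℤ)) (identity-off i≢j) adj)
    sign true  adj = inj₂ (cong₂ (λ e b → 1ℤ - e - ℤ.+ 2 * (if b then 1ℤ else 0ℤ)) (identity-off i≢j) adj)
  entries : ∀ i j → S i j ≡ 0ℤ ⊎ S i j ≡ 1ℤ ⊎ S i j ≡ -1ℤ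
  entries i j = entry (i ≟ j)
    where
    entry : Dec (i ≡ j) → S i j ≡ 0ℤ ⊎ S i j ≡ 1ℤ ⊎ S i j ≡ -1ℤ
    entry (yes refl) = inj₁ (cong₂ (λ e a → 1ℤ - e - ℤ.+ 2 * a) (identity-diagonal i) (adjacency-diagonal G i))
    entry (no i≢j)   = inj₂ (off i≢j)
  offDiagonal : ∀ i j → i ≢ j → S i j ≢ 0ℤ
  offDiagonal i j i≢j s≡0 with off i≢j
  ... | inj₁ s≡1  = contradiction (trans (sym s≡0) s≡1) λ ()
  ... | inj₂ s≡-1 = contradiction (trans (sym s≡0) s≡-1) λ ()

switch : ∀ {n} (S : SeidelMatrix n) (x : Vector ℤ n) → (∀ i → x i * x i ≡ 1ℤ) → SeidelMatrix n
switch {n} S x x²≡1 = record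
  { matrix      = λ i j → x i * matrix i j * x j
  ; entries     = λ i j → signed (entries i j) (square-roots {x i} {1ℤ} (x²≡1 i)) (square-roots {x j} {1ℤ} (x²≡1 j))
  ; symmetric   = λ i j → trans (cong (λ s → x i * s * x j) (symmetric i j)) (ring (x i) (x j) (matrix j i))
  ; diagonal    = λ i → trans (cong (λ s → x i * s * x i) (diagonal i)) (cong (_* x i) (ℤ.*-zeroʳ (x i)))
  ; offDiagonal = λ i j i≢j s≡0 → offDiagonal i j i≢j (trans (sym (unswitch i j))
      (trans (cong (λ s → x i * s * x j) s≡0) (cong (_* x j) (ℤ.*-zeroʳ (x i)))))
  }
  where
  open SeidelMatrix S
  ring : ∀ a b s → a * s * b ≡ b * s * a
  ring = solve-∀
  ring′ : ∀ a b s → a * (a * s * b) * b ≡ a * a * (b * b) * s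
  ring′ = solve-∀
  unswitch : ∀ i j → x i * (x i * matrix i j * x j) * x j ≡ matrix i j
  unswitch i j = trans (ring′ (x i) (x j) (matrix i j))
    (trans (cong₂ (λ a b → a * b * matrix i j) (x²≡1 i) (x²≡1 j)) (ℤ.*-identityˡ (matrix i j)))
  signed : ∀ {a s b} → s ≡ 0ℤ ⊎ s ≡ 1ℤ ⊎ s ≡ -1ℤ → a ≡ 1ℤ ⊎ a ≡ -1ℤ → b ≡ 1ℤ ⊎ b ≡ -1ℤ →
    a * s * b ≡ 0ℤ ⊎ a * s * b ≡ 1ℤ ⊎ a * s * b ≡ -1ℤ
  signed (inj₁ refl)        (inj₁ refl) (inj₁ refl) = inj₁ refl
  signed (inj₁ refl)        (inj₁ refl) (inj₂ refl) = inj₁ refl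
  signed (inj₁ refl)        (inj₂ refl) (inj₁ refl) = inj₁ refl
  signed (inj₁ refl)        (inj₂ refl) (inj₂ refl) = inj₁ refl
  signed (inj₂ (inj₁ refl)) (inj₁ refl) (inj₁ refl) = inj₂ (inj₁ refl)
  signed (inj₂ (inj₁ refl)) (inj₁ refl) (inj₂ refl) = inj₂ (inj₂ refl)
  signed (inj₂ (inj₁ refl)) (inj₂ refl) (inj₁ refl) = inj₂ (inj₂ refl)
  signed (inj₂ (inj₁ refl)) (inj₂ refl) (inj₂ refl) = inj₂ (inj₁ refl)
  signed (inj₂ (inj₂ refl)) (inj₁ refl) (inj₁ refl) = inj₂ (inj₂ refl)
  signed (inj₂ (inj₂ refl)) (inj₁ refl) (inj₂ refl) = inj₂ (inj₁ refl)
  signed (inj₂ (inj₂ refl)) (inj₂ refl) (inj₁ refl) = inj₂ (inj₁ refl)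
  signed (inj₂ (inj₂ refl)) (inj₂ refl) (inj₂ refl) = inj₂ (inj₂ refl)

SeidelExists GraphExists : Spectrum → Set
SeidelExists σ = ∃[ n ] Σ[ S ∈ SeidelMatrix n ] SeidelMatrixHasSpectrum S σ
GraphExists  σ = ∃[ n ] Σ[ G ∈ Graph n ] GraphHasSpectrum G σ

module Equivalence (m₁ m₂ m₃ : ℕ) (k κ μ ε : ℤ) where

  open Transfer m₁ m₂ m₃ k κ μ public

  order : ℕ
  order = m₁ ℕ.+ suc m₂ ℕ.+ m₃

  seidel⇒graph : ∀ {a b} → coefficients seidelSpectrum ≡ (order , a , b) →
    ℤ.+ order ≡ ℤ.+ 2 * (k - κ) → ε * ε ≡ 1ℤ →
    (∀ {n} {P : Matrix n} → Frame P (ε * (k - κ + ℤ.+ 2 + ℤ.+ 5 * μ)) (ε * (ℤ.+ 2 * ((ℤ.+ 2 - κ) * (μ - κ)))) →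
      ℤ.+ n ≡ ℤ.+ order → SignVector P) →
    SeidelExists seidelSpectrum → GraphExists graphSpectrum
  seidel⇒graph coefficients≡ order≡ ε²≡1 findSigns (n , S , hasSpectrum) =
    n , graphOf S′ , seidelSpectrum⇒graphSpectrum {S = SeidelMatrix.matrix S′} {adjacencyMatrix (graphOf S′)} (SeidelMatrix.symmetric S′) (graphOf-matrix S′) rowSums
      n≡ n≡order λ y → trans (charPoly-switching x (proj₁ (proj₂ signs)) matrix y) (hasSpectrum y)
    where
    open SeidelMatrix S
    n≡order : n ≡ order
    n≡order = proj₁ (spectrum-coefficients matrix diagonal {seidelSpectrum} hasSpectrum coefficients≡)
    n≡ : ℤ.+ n ≡ ℤ.+ 2 * (k - κ)
    n≡ = trans (cong ℤ.+_ n≡order) order≡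
    open SeidelFrame {S = matrix} {adjacencyMatrix (graphOf S)} symmetric (adjacency-symmetric (graphOf S)) (adjacency-idempotent (graphOf S))
      (adjacency-diagonal (graphOf S)) (graphOf-matrix S) k κ μ ε ε²≡1 n≡
      (minimalPolynomial symmetric diagonal {seidelSpectrum} hasSpectrum)
    signs : Σ[ x ∈ Vector ℤ n ] (∀ i → x i * x i ≡ 1ℤ) × ∀ i → mul matrix x i ≡ σ * x i
    signs = signEigenvector (findSigns P-frame (cong ℤ.+_ n≡order))
    x : Vector ℤ n
    x = proj₁ signs
    S′ : SeidelMatrix n
    S′ = switch S x (proj₁ (proj₂ signs))
    rowSums : ∀ i → sum (λ j → x i * matrix i j * x j) ≡ σ
    rowSums i = begin
      sum (λ j → x i * matrix i j * x j)      ≡⟨ sum-cong-≗ (λ j → ℤ.*-assoc (x i) (matrix i j) (x j)) ⟩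
      sum (λ j → x i * (matrix i j * x j))    ≡⟨ *-distribˡ-sum (x i) (λ j → matrix i j * x j) ⟨
      x i * mul matrix x i                    ≡⟨ cong (x i *_) (proj₂ (proj₂ signs) i) ⟩
      x i * (σ * x i)                         ≡⟨ ring (x i) σ ⟩
      x i * x i * σ                           ≡⟨ cong (_* σ) (proj₁ (proj₂ signs) i) ⟩
      1ℤ * σ                                  ≡⟨ ℤ.*-identityˡ σ ⟩
      σ                                       ∎
      where
      ring : ∀ x s → x * (s * x) ≡ x * x * s
      ring = solve-∀

  -- The third equation says that twice the number of edges, read off from `b`, is kn, so k is the
  -- mean degree. The inequality is the negative discriminant used by `eigenvector-of-mean`.
  graph⇒seidel : ∀ {a b} → coefficients graphSpectrum ≡ (order , a , b) →
    ℤ.+ order ≡ ℤ.+ 2 * (k - κ) → ℤ.+ 2 * - b ≡ k * ℤ.+ order →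
    (let α = k - (ℤ.+ 2 + κ + μ) in
      0ℤ ℤ.< ℤ.+ 4 * (k * α + (ℤ.+ 2 * κ + ℤ.+ 2 * μ + κ * μ)) - α * α) →
    GraphExists graphSpectrum → SeidelExists seidelSpectrum
  graph⇒seidel {b = b} coefficients≡ order≡ edges positive (n , G , hasSpectrum) =
    n , seidelOf G , graphSpectrum⇒seidelSpectrum {S = SeidelMatrix.matrix (seidelOf G)} {A} (SeidelMatrix.symmetric (seidelOf G))
      (λ i j → ring (identity n i j) (A i j)) rowSums n≡ n≡order hasSpectrum
    where
    A : Matrix n
    A = adjacencyMatrix G
    one : Vector ℤ n
    one = const 1ℤ
    ring : ∀ e a → 1ℤ - e - ℤ.+ 2 * a + ℤ.+ 2 * a ≡ 1ℤ - e
    ring = solve-∀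
    n≡order : n ≡ order
    n≡order = proj₁ (spectrum-coefficients A (adjacency-diagonal G) {graphSpectrum} hasSpectrum coefficients≡)
    n≡ : ℤ.+ n ≡ ℤ.+ 2 * (k - κ)
    n≡ = trans (cong ℤ.+_ n≡order) order≡
    shift-one : ∀ i → shift A k one i ≡ sum (A i) - k
    shift-one i = cong₂ _-_ (sum-cong-≗ λ j → ℤ.*-identityʳ (A i j)) (ℤ.*-identityʳ k)
    mean : dot one (shift A k one) ≡ 0ℤ
    mean = begin
      sum (λ i → 1ℤ * shift A k one i)
        ≡⟨ sum-cong-≗ (λ i → trans (ℤ.*-identityˡ (shift A k one i)) (shift-one i)) ⟩
      sum (λ i → sum (A i) - k)
        ≡⟨ sum-- (λ i → sum (A i)) (const k) ⟩
      sum (λ i → sum (A i)) - sum {n} (const k)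
        ≡⟨ cong₂ _-_ (sum-cong-≗ λ i → sum-cong-≗ λ j → sym (adjacency-idempotent G i j)) (sum-const n k) ⟩
      sum (λ i → sum λ j → A i j * A i j) - ℤ.+ n * k
        ≡⟨ cong₂ _-_ (squaresAbove-double A (adjacency-symmetric G) (adjacency-diagonal G)) (ℤ.*-comm (ℤ.+ n) k) ⟩
      ℤ.+ 2 * squaresAbove A - k * ℤ.+ n
        ≡⟨ cong₂ (λ e m → ℤ.+ 2 * e - k * ℤ.+ m)
             (proj₂ (spectrum-coefficients A (adjacency-diagonal G) {graphSpectrum} hasSpectrum coefficients≡)) n≡order ⟩
      ℤ.+ 2 * - b - k * ℤ.+ order
        ≡⟨ ℤ.i≡j⇒i-j≡0 edges ⟩
      0ℤ ∎
    regular : ∀ i → sum (A i) ≡ k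
    regular i = ℤ.i-j≡0⇒i≡j (sum (A i)) k (trans (sym (shift-one i))
      (eigenvector-of-mean (adjacency-symmetric G) k (ℤ.+ 2) κ μ one positive
        (minimalPolynomial (adjacency-symmetric G) (adjacency-diagonal G) {graphSpectrum} hasSpectrum one) mean i))
    rowSums : ∀ i → sum (λ j → 1ℤ - identity n i j - ℤ.+ 2 * A i j) ≡ -1ℤ - ℤ.+ 2 * κ
    rowSums i = begin
      sum (λ j → 1ℤ - identity n i j - ℤ.+ 2 * A i j)
        ≡⟨ sum-- (λ j → 1ℤ - identity n i j) (λ j → ℤ.+ 2 * A i j) ⟩
      sum (λ j → 1ℤ - identity n i j) - sum (λ j → ℤ.+ 2 * A i j)
        ≡⟨ cong₂ _-_ (sum-- one (identity n i)) (sym (*-distribˡ-sum (ℤ.+ 2) (A i))) ⟩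
      sum one - sum (identity n i) - ℤ.+ 2 * sum (A i)
        ≡⟨ cong₂ (λ p q → p - q - ℤ.+ 2 * sum (A i)) (sum-all 1ℤ n≡ λ j → refl)
             (trans (sum-cong-≗ λ j → sym (ℤ.*-identityʳ (identity n i j))) (sum-identity i one)) ⟩
      ℤ.+ 2 * (k - κ) * 1ℤ - 1ℤ - ℤ.+ 2 * sum (A i)
        ≡⟨ cong (λ d → ℤ.+ 2 * (k - κ) * 1ℤ - 1ℤ - ℤ.+ 2 * d) (regular i) ⟩
      ℤ.+ 2 * (k - κ) * 1ℤ - 1ℤ - ℤ.+ 2 * k
        ≡⟨ ring′ k κ ⟩
      -1ℤ - ℤ.+ 2 * κ ∎
      where
      ring′ : ∀ k κ → ℤ.+ 2 * (k - κ) * 1ℤ - 1ℤ - ℤ.+ 2 * k ≡ -1ℤ - ℤ.+ 2 * κ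
      ring′ = solve-∀

-- The three pairs of spectra

spectrum-cong : ∀ {n} {A : Matrix n} {σ τ} → (∀ x → spectralPolynomial σ x ≡ spectralPolynomial τ x) →
  HasSpectrum A σ → HasSpectrum A τ
spectrum-cong σ≡τ hasSpectrum x = trans (hasSpectrum x) (σ≡τ x)

spectralPolynomial-swap : ∀ p q ρ x →
  spectralPolynomial (p ∷ q ∷ ρ) x ≡ spectralPolynomial (q ∷ p ∷ ρ) x
spectralPolynomial-swap (θ , m) (η , l) ρ x =
  ring ((x - θ) ^ m) ((x - η) ^ l) (spectralPolynomial ρ x)
  where
  ring : ∀ a b c → a * (b * c) ≡ b * (a * c)
  ring = solve-∀

swap-middle : ∀ {n} {A : Matrix n} p q r → HasSpectrum A (p ∷ q ∷ r ∷ []) → HasSpectrum A (p ∷ r ∷ q ∷ [])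
swap-middle {A = A} p@(θ , m) q r =
  spectrum-cong {A = A} {p ∷ q ∷ r ∷ []} {p ∷ r ∷ q ∷ []} λ x → cong ((x - θ) ^ m *_) (spectralPolynomial-swap q r [] x)

swap-last : ∀ {n} {A : Matrix n} p q r s → HasSpectrum A (p ∷ q ∷ r ∷ s ∷ []) → HasSpectrum A (p ∷ q ∷ s ∷ r ∷ [])
swap-last {A = A} p@(θ , m) q@(η , l) r s =
  spectrum-cong {A = A} {p ∷ q ∷ r ∷ s ∷ []} {p ∷ q ∷ s ∷ r ∷ []} λ x →
    cong (λ y → (x - θ) ^ m * ((x - η) ^ l * y)) (spectralPolynomial-swap r s [] x)

open import Data.Integer using (+_)
open import Function.Bundles using (_⇔_; mk⇔)

-- The spectra are compared by an explicit equation of lists: comparing the types instead would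
-- unfold the powers in the spectral polynomials.
equivalence : ∀ {σ ρ} τ π → σ ≡ τ → ρ ≡ π → (SeidelExists σ → GraphExists ρ) → (GraphExists ρ → SeidelExists σ) →
  SeidelExists τ ⇔ GraphExists π
equivalence _ _ refl refl f g = mk⇔ f g

-- In the first two cases σ and κ are listed last, whereas the general argument places them before τ
-- and μ.
equivalence-swapped : ∀ {σ ρ} p q r a b c d → σ ≡ p ∷ r ∷ q ∷ [] → ρ ≡ a ∷ b ∷ d ∷ c ∷ [] →
  (SeidelExists σ → GraphExists ρ) → (GraphExists ρ → SeidelExists σ) →
  SeidelExists (p ∷ q ∷ r ∷ []) ⇔ GraphExists (a ∷ b ∷ c ∷ d ∷ [])
equivalence-swapped p q r a b c d refl refl f g = mk⇔
  (λ S → swapGraph d c (f (swapSeidel q r S)))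
  (λ G → swapSeidel r q (g (swapGraph c d G)))
  where
  swapSeidel : ∀ q r → SeidelExists (p ∷ q ∷ r ∷ []) → SeidelExists (p ∷ r ∷ q ∷ [])
  swapSeidel q r (n , S , h) = n , S , swap-middle {A = SeidelMatrix.matrix S} p q r h
  swapGraph : ∀ c d → GraphExists (a ∷ b ∷ c ∷ d ∷ []) → GraphExists (a ∷ b ∷ d ∷ c ∷ [])
  swapGraph c d (n , G , h) = n , G , swap-last {A = adjacencyMatrix G} a b c d h

mainTheorem2 : ((∃[ n ] Σ[ S ∈ SeidelMatrix n ] SeidelMatrixHasSpectrum S
    ([ - (+ 5) ]^ 42 ∷ [ + 11 ]^ 15 ∷ [ + 15 ]^ 3 ∷ []))
    ⇔
    (∃[ n ] Σ[ G ∈ Graph n ] GraphHasSpectrum G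
    ([ + 22 ]^ 1 ∷ [ + 2 ]^ 42 ∷ [ - (+ 6) ]^ 15 ∷ [ - (+ 8) ]^ 2 ∷ [])))
    × ((∃[ n ] Σ[ S ∈ SeidelMatrix n ] SeidelMatrixHasSpectrum S
    ([ - (+ 5) ]^ 53 ∷ [ + 13 ]^ 16 ∷ [ + 19 ]^ 3 ∷ []))
    ⇔
    (∃[ n ] Σ[ G ∈ Graph n ] GraphHasSpectrum G
    ([ + 26 ]^ 1 ∷ [ + 2 ]^ 53 ∷ [ - (+ 7) ]^ 16 ∷ [ - (+ 10) ]^ 2 ∷ [])))
    × ((∃[ n ] Σ[ S ∈ SeidelMatrix n ] SeidelMatrixHasSpectrum S
    ([ - (+ 5) ]^ 70 ∷ [ + 13 ]^ 5 ∷ [ + 19 ]^ 15 ∷ []))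
    ⇔
    (∃[ n ] Σ[ G ∈ Graph n ] GraphHasSpectrum G
    ([ + 38 ]^ 1 ∷ [ + 2 ]^ 70 ∷ [ - (+ 7) ]^ 4 ∷ [ - (+ 10) ]^ 15 ∷ [])))
mainTheorem2 =
    equivalence-swapped {E₁.seidelSpectrum} {E₁.graphSpectrum}
      ([ - (+ 5) ]^ 42) ([ + 11 ]^ 15) ([ + 15 ]^ 3)
      ([ + 22 ]^ 1) ([ + 2 ]^ 42) ([ - (+ 6) ]^ 15) ([ - (+ 8) ]^ 2) refl refl
      (E₁.seidel⇒graph refl refl refl signVector-norm2)
      (E₁.graph⇒seidel refl refl refl (ℤ.+<+ (ℕ.s≤s ℕ.z≤n))) ,
    equivalence-swapped {E₂.seidelSpectrum} {E₂.graphSpectrum}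
      ([ - (+ 5) ]^ 53) ([ + 13 ]^ 16) ([ + 19 ]^ 3)
      ([ + 26 ]^ 1) ([ + 2 ]^ 53) ([ - (+ 7) ]^ 16) ([ - (+ 10) ]^ 2) refl refl
      (E₂.seidel⇒graph refl refl refl signVector-norm3)
      (E₂.graph⇒seidel refl refl refl (ℤ.+<+ (ℕ.s≤s ℕ.z≤n))) ,
    equivalence {E₃.seidelSpectrum} {E₃.graphSpectrum}
      ([ - (+ 5) ]^ 70 ∷ [ + 13 ]^ 5 ∷ [ + 19 ]^ 15 ∷ [])
      ([ + 38 ]^ 1 ∷ [ + 2 ]^ 70 ∷ [ - (+ 7) ]^ 4 ∷ [ - (+ 10) ]^ 15 ∷ []) refl refl
      (E₃.seidel⇒graph refl refl refl signVector-norm3′)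
      (E₃.graph⇒seidel refl refl refl (ℤ.+<+ (ℕ.s≤s ℕ.z≤n)))
  where
  -- Here σ is 15, 19 and 13, and τ is 11, 13 and 19. The last argument is the sign of σ - τ, which
  -- makes t and c positive.
  module E₁ = Equivalence 42 2 15 (+ 22) (- + 8) (- + 6) 1ℤ
  module E₂ = Equivalence 53 2 16 (+ 26) (- + 10) (- + 7) 1ℤ
  module E₃ = Equivalence 70 4 15 (+ 38) (- + 7) (- + 10) -1ℤ
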